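{- Let $K$ be the middle third Cantor set, $\mathcal{W}$ the set of very well approximable real numbers, $\mathcal{L}$ the set of Liouville numbers, and $\gamma=\frac{\log 2}{\log 3}$. Then $$\dim\big((\mathcal{W}\setminus\mathcal{L})\cap K\big)\ \ge\ \gamma/2 .$$ In particular, $(\mathcal{W}\setminus\mathcal{L})\cap K\neq\emptyset$.
   Context: $\dim$ denotes Hausdorff dimension. $K\subset[0,1]$ is the standard middle third Cantor set, and $\gamma=\dim K$. For $\epsilon>0$ consider the condition on a real number $x$: $$(\ast_\epsilon)\qquad |x-p/q|<q^{ -(2+\epsilon)}\ \text{ for infinitely many }(p,q)\in\mathbb{Z}\times\mathbb{N}.$$ $x$ is very well approximable if $(\ast_\epsilon)$ holds for some $\epsilon>0$. $x$ is a Liouville number if $(\ast_\epsilon)$ holds for every $\epsilon>0$. -}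

module Defs where

open import Level using (0ℓ; _⊔_)
open import Algebra.Bundles using (CommutativeRing; Semiring)
open import Axiom.ExcludedMiddle using (ExcludedMiddle)
open import Data.Fin using (toℕ)
open import Data.Integer using (ℤ; +_; -[1+_])
open import Data.List using (List)
open import Data.List.Membership.Propositional using (_∉_)
open import Data.Nat as ℕ using (ℕ; zero; suc; _!)
open import Data.Product using (_×_; _,_; Σ-syntax; ∃-syntax)
open import Data.Sum using (_⊎_)
open import Data.Vec.Functional using (foldr)
open import Relation.Binary.Bundles using (TotalOrder)
open import Relation.Binary.Structures using (IsTotalOrder)
open import Relation.Nullary using (¬_; yes; no)
open import Relation.Nullary.Construct.Add.Supremum using (_⁺; [_]; ⊤⁺)
open import Relation.Unary using (Pred; Satisfiable; _⊆_; ⋃)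

import Algebra.Construct.NaturalChoice.Max as Max
import Algebra.Definitions.RawSemiring as RawSemiringDefs
import Relation.Binary.Construct.Add.Supremum.Equality as Equality⁺
import Relation.Binary.Construct.Add.Supremum.NonStrict as NonStrict⁺
import Relation.Binary.Construct.NonStrictToStrict as Strict

-- The real numbers, characterised up to isomorphism as the Dedekind-complete
-- ordered field.  Equality is a setoid equality, so that constructions by
-- Cauchy sequences or cuts are instances.

record RealNumbers : Set₁ where
  field
    commutativeRing : CommutativeRing 0ℓ 0ℓ

  open CommutativeRing commutativeRing public

  infix  4 _≤_
  infix 10 _⁻¹
  field
    _⁻¹          : Carrier → Carrier
    _≤_          : Carrier → Carrier → Set
    0≉1          : ¬ (0# ≈ 1#)
    ⁻¹-inverseʳ  : ∀ x → ¬ (x ≈ 0#) → x * x ⁻¹ ≈ 1#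
    isTotalOrder : IsTotalOrder _≈_ _≤_
    +-monoˡ-≤    : ∀ z {x y} → x ≤ y → x + z ≤ y + z
    *-nonNeg     : ∀ {x y} → 0# ≤ x → 0# ≤ y → 0# ≤ x * y

  UpperBound : Pred Carrier 0ℓ → Carrier → Set
  UpperBound P b = ∀ {x} → P x → x ≤ b

  field
    complete : ∀ (P : Pred Carrier 0ℓ) → Satisfiable P → (∃[ b ] UpperBound P b) →
               ∃[ s ] UpperBound P s × (∀ b → UpperBound P b → s ≤ b)

  totalOrder : TotalOrder 0ℓ 0ℓ 0ℓ
  totalOrder = record { isTotalOrder = isTotalOrder }

Infinite : ∀ {a p} {A : Set a} → Pred A p → Set (a ⊔ p)
Infinite {A = A} P = ∀ (xs : List A) → ∃[ x ] P x × x ∉ xs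

-- Excluded middle makes the mathematics classical.  It also makes `lim`,
-- `log`, `sup` and `inf` below total functions: each selects the element with
-- the defining property, and returns an arbitrary value when there is none.

module Analysis (em : ∀ {ℓ} → ExcludedMiddle ℓ) (R : RealNumbers) where

  open RealNumbers R renaming (Carrier to ℝ)
  open RawSemiringDefs (Semiring.rawSemiring semiring) using (_^_; sum) renaming (_×_ to _•_)
  open Strict _≈_ _≤_ using (_<_)
  open NonStrict⁺ _≤_ using (_≤⁺_) public
  open Equality⁺ _≈_ using (_≈⁺_)

  select : ∀ {a p} {A : Set a} → A → Pred A p → A
  select default P with em {P = Satisfiable P}
  ... | yes (x , _) = x
  ... | no  _       = default

  fromℕ : ℕ → ℝ
  fromℕ n = n • 1#

  fromℤ : ℤ → ℝ
  fromℤ (+ n)    = fromℕ n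
  fromℤ -[1+ n ] = - fromℕ (suc n)

  infixl 7 _/_
  _/_ : ℝ → ℝ → ℝ
  x / y = x * y ⁻¹

  ∣_∣ : ℝ → ℝ
  ∣ x ∣ = Max._⊔_ totalOrder x (- x)

  _⟶_ : (ℕ → ℝ) → ℝ → Set
  a ⟶ l = ∀ ε → 0# < ε → ∃[ N ] (∀ n → N ℕ.≤ n → ∣ a n - l ∣ < ε)

  lim : (ℕ → ℝ) → ℝ
  lim a = select 0# (a ⟶_)

  exp : ℝ → ℝ
  exp x = lim λ n → sum {n} λ i → x ^ toℕ i / fromℕ (toℕ i !)

  log : ℝ → ℝ
  log y = select 0# λ x → exp x ≈ y

  -- Real powers of nonnegative numbers.  The value 0 at base 0 is correct for
  -- positive exponents, and base 0 occurs with no other exponent below.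

  infixr 8 _^ʳ_
  _^ʳ_ : ℝ → ℝ → ℝ
  x ^ʳ s with em {P = 0# < x}
  ... | yes _ = exp (s * log x)
  ... | no  _ = 0#

  -- ℝ ⁺ is ℝ with a point ⊤⁺ = ∞ added; [0,∞] is its part above [ 0# ].
  -- Suprema and infima are taken in [0,∞], so that sup ∅ = 0 and inf ∅ = ∞.

  IsSup : ∀ {i} {I : Set i} → (I → ℝ ⁺) → ℝ ⁺ → Set i
  IsSup f s = [ 0# ] ≤⁺ s × (∀ i → f i ≤⁺ s) ×
              (∀ t → [ 0# ] ≤⁺ t → (∀ i → f i ≤⁺ t) → s ≤⁺ t)

  IsInf : ∀ {i} {I : Set i} → (I → ℝ ⁺) → ℝ ⁺ → Set i
  IsInf f s = [ 0# ] ≤⁺ s × (∀ i → s ≤⁺ f i) ×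
              (∀ t → [ 0# ] ≤⁺ t → (∀ i → t ≤⁺ f i) → t ≤⁺ s)

  sup : ∀ {i} {I : Set i} → (I → ℝ ⁺) → ℝ ⁺
  sup f = select ⊤⁺ (IsSup f)

  inf : ∀ {i} {I : Set i} → (I → ℝ ⁺) → ℝ ⁺
  inf f = select ⊤⁺ (IsInf f)

  infixl 6 _+⁺_
  _+⁺_ : ℝ ⁺ → ℝ ⁺ → ℝ ⁺
  [ x ] +⁺ [ y ] = [ x + y ]
  [ x ] +⁺ ⊤⁺    = ⊤⁺
  ⊤⁺    +⁺ y     = ⊤⁺

  infixr 8 _^⁺_
  _^⁺_ : ℝ ⁺ → ℝ → ℝ ⁺
  [ x ] ^⁺ s = [ x ^ʳ s ]
  ⊤⁺    ^⁺ s = ⊤⁺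

  series : (ℕ → ℝ ⁺) → ℝ ⁺
  series a = sup λ n → foldr _+⁺_ [ 0# ] {n} (λ i → a (toℕ i))

  diam : Pred ℝ 0ℓ → ℝ ⁺
  diam U = sup {I = Satisfiable U × Satisfiable U}
               λ { ((x , _) , (y , _)) → [ ∣ x - y ∣ ] }

  -- The sets U i need not respect _≈_: closing them under _≈_ changes neither
  -- the diameters nor the covering property.

  record Cover (δ : ℝ) (E : Pred ℝ 0ℓ) : Set₁ where
    field
      U      : ℕ → Pred ℝ 0ℓ
      covers : E ⊆ ⋃ ℕ U
      small  : ∀ i → diam (U i) ≤⁺ [ δ ]

  hausdorffPremeasure : ℝ → ℝ → Pred ℝ 0ℓ → ℝ ⁺
  hausdorffPremeasure s δ E = inf {I = Cover δ E} λ C →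
    series λ i → diam (Cover.U C i) ^⁺ s

  hausdorffMeasure : ℝ → Pred ℝ 0ℓ → ℝ ⁺
  hausdorffMeasure s E = sup {I = Σ[ δ ∈ ℝ ] 0# < δ} λ { (δ , _) →
    hausdorffPremeasure s δ E }

  -- Omitting s = 0 does not change the infimum: if the counting measure of E
  -- vanishes then E is empty and every other Hausdorff measure of E vanishes.

  dim : Pred ℝ 0ℓ → ℝ ⁺
  dim E = inf {I = Σ[ s ∈ ℝ ] (0# < s × hausdorffMeasure s E ≈⁺ [ 0# ])} λ { (s , _) → [ s ] }

  preCantor : ℕ → Pred ℝ 0ℓ
  preCantor zero    x = 0# ≤ x × x ≤ 1#
  preCantor (suc n) x = preCantor n (fromℕ 3 * x) ⊎ preCantor n (fromℕ 3 * x - fromℕ 2)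

  K : Pred ℝ 0ℓ
  K x = ∀ n → preCantor n x

  -- Fractions p/q need not be in lowest terms, and p/q = x is allowed.

  Approx : ℝ → Pred ℝ 0ℓ
  Approx ε x = Infinite {A = ℤ × ℕ} λ { (p , q) →
    0 ℕ.< q × ∣ x - fromℤ p / fromℕ q ∣ < fromℕ q ^ʳ (- (fromℕ 2 + ε)) }

  𝓦 : Pred ℝ 0ℓ
  𝓦 x = ∃[ ε ] 0# < ε × Approx ε x

  𝓛 : Pred ℝ 0ℓ
  𝓛 x = ∀ ε → 0# < ε → Approx ε x

  γ : ℝ
  γ = log (fromℕ 2) / log (fromℕ 3)

{-# OPTIONS --safe #-}

-- Fix an integer m ≥ 8.  For Q = m^(j+1) and L = m^j prescribe that the ternary
-- digits of x at the positions Q, …, 2Q+L-1 are 0 and that the digit at 2Q+L is 2;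
-- fill the remaining positions with arbitrary digits 0 and 2.  Truncating x before
-- the j-th block gives a fraction with denominator 3^Q and error between
-- (2/3) 3^-(2Q+L) and 3^-(2Q+L), so x is very well approximable with exponent
-- 2 + 1/(m+1).  As the denominators grow only like a power of one another, any
-- other fraction can be compared with a suitable truncation, and x is not a
-- Liouville number.
--
-- Among the first n digits at least about n/2 (up to a factor 1 - O(1/m)) are
-- free.  Two such points closer than 3^-n agree in their first n digits, so a set
-- of diameter d < 3^-n lies in a cylinder of measure 2^-(number of free digits
-- before n) of the space of binary sequences.  Let s < γ/2 and let m be large:
-- this measure is then at most a constant times d^s, and a cover with small sum
-- of d^s would give countably many cylinders of total measure < 1 covering all
-- binary sequences.  A branch along which the relative measure of the cylinders
-- stays below 1 avoids all of them.

module Submission where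

open import Defs
open import Algebra.Bundles using (CommutativeRing; Semiring)
open import Axiom.ExcludedMiddle using (ExcludedMiddle)
open import Data.Bool using (Bool; true; false; if_then_else_)
open import Data.Empty using (⊥)
open import Data.Fin using (toℕ)
open import Data.Fin.Properties using (toℕ<n)
open import Data.Integer as ℤ using (ℤ; +_; -[1+_])
open import Data.List using (List; []; _∷_; length)
open import Data.List.Membership.Propositional using (_∈_; _∉_)
open import Data.List.Relation.Unary.Any using (here; there)
open import Data.Maybe using (Maybe; just; nothing)
open import Data.Nat as ℕ using (ℕ; zero; suc; _!; s≤s; z≤n)
open import Data.Nat.Combinatorics using (nCk≡n!/k![n-k]!; k![n∸k]!∣n!) renaming (_C_ to _choose_)
open import Data.Nat.DivMod using (m/n*n≡m)
open import Data.Nat.Tactic.RingSolver using (solve-∀)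
open import Data.Product using (_×_; _,_; proj₁; proj₂; ∃-syntax)
open import Data.Sum using (_⊎_; inj₁; inj₂)
open import Data.Unit using (⊤; tt)
open import Data.Vec.Functional using (foldr)
open import Function using (_∘_; case_of_)
open import Level using (0ℓ)
open import Relation.Binary.Bundles using (TotalOrder)
open import Relation.Binary.PropositionalEquality as ≡ using (_≡_)
open import Relation.Nullary using (¬_; yes; no; Dec; contradiction)
open import Relation.Nullary.Construct.Add.Supremum using (_⁺; [_]; ⊤⁺)
open import Relation.Nullary.Decidable using (True; toWitness; fromWitness; does; dec-true; dec-false)
open import Relation.Unary using (Pred; Satisfiable; _∖_; _∩_)

import Algebra.Construct.NaturalChoice.Max as Max
import Algebra.Definitions.RawSemiring as RawSemiringDefs
import Algebra.Properties.CommutativeSemiring.Binomial as Binomial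
import Algebra.Properties.Ring as RingProperties
import Algebra.Properties.Semiring.Exp as Exp
import Algebra.Properties.Semiring.Mult as Mult
import Algebra.Properties.Semiring.Mult.TCOptimised as Mult′
import Algebra.Properties.Semiring.Sum as Sum
import Algebra.Solver.Ring as RingSolver
import Algebra.Solver.Ring.AlmostCommutativeRing as ACR
import Data.Integer.Properties as ℤ
import Data.Nat.Properties as ℕ
import Relation.Binary.Construct.Add.Supremum.Equality as Equality⁺
import Relation.Binary.Construct.Add.Supremum.NonStrict as NonStrict⁺
import Relation.Binary.Construct.NonStrictToStrict as Strict
import Relation.Binary.Reasoning.PartialOrder as PartialOrderReasoning

-- The factor 1/2 comes from the ends of the blocks: up to 2Q + L only about the Q positions before
-- the block are free, and the digits fixed earlier lie below 4L. A constant ratio m between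
-- consecutive scales meets two opposing demands. It must be large for the earlier blocks to be
-- negligible, and it must not grow with j, or the gaps between denominators would no longer bound
-- the irrationality exponent. Covering sets of diameter 0 add nothing to the sum of d^s, yet each
-- must still be enclosed in a cylinder of positive measure. The i-th set is therefore allowed an
-- extra 2^-(2+i). No measure is constructed: total measure enters only through bounds on all finite
-- partial sums of cylinder weights, and the key property is that a weight is the average of the
-- relative weights in the two halves. The reals are known only as a complete ordered field, with
-- `exp` and `log` selected by their defining properties, so convergence, functional equation and
-- surjectivity of `exp` are established before powers d^s can be estimated.

-- A ring solver with integer coefficients

module Solver {c ℓ} (A : CommutativeRing c ℓ) where
  open CommutativeRing A
  open RingProperties ring
  open import Algebra.Properties.AbelianGroup +-abelianGroup using (⁻¹-∙-comm)
  open import Algebra.Properties.Group +-group using (ε⁻¹≈ε; ⁻¹-involutive)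
  open Mult′ semiring using (1+×; ×-homo-+; ×1-homo-*) renaming (_×_ to _×′_)
  open import Relation.Binary.Reasoning.Setoid setoid

  -- With the optimised multiple the coefficients 0, 1, 2 evaluate definitionally to `0#`, `1#`,
  -- `1# + 1#`, so solved equations fit goals that mention these elements.
  ⟦_⟧ℤ : ℤ → Carrier
  ⟦ + n ⟧ℤ      = n ×′ 1#
  ⟦ -[1+ n ] ⟧ℤ = - (suc n ×′ 1#)

  ⟦⟧-neg : ∀ i → ⟦ ℤ.- i ⟧ℤ ≈ - ⟦ i ⟧ℤ
  ⟦⟧-neg (+ zero)   = sym ε⁻¹≈ε
  ⟦⟧-neg (+ suc n)  = refl
  ⟦⟧-neg (-[1+ n ]) = sym (⁻¹-involutive _)

  ⟦⟧-⊖ : ∀ m n → ⟦ m ℤ.⊖ n ⟧ℤ ≈ m ×′ 1# - n ×′ 1#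
  ⟦⟧-⊖ m zero          = sym (trans (+-congˡ ε⁻¹≈ε) (+-identityʳ _))
  ⟦⟧-⊖ zero (suc n)    = sym (+-identityˡ _)
  ⟦⟧-⊖ (suc m) (suc n) = begin
    ⟦ suc m ℤ.⊖ suc n ⟧ℤ                ≡⟨ ≡.cong ⟦_⟧ℤ (ℤ.[1+m]⊖[1+n]≡m⊖n m n) ⟩
    ⟦ m ℤ.⊖ n ⟧ℤ                        ≈⟨ ⟦⟧-⊖ m n ⟩
    m ×′ 1# - n ×′ 1#                   ≈⟨ +-congˡ (+-identityˡ _) ⟨
    m ×′ 1# + (0# - n ×′ 1#)            ≈⟨ +-congˡ (+-congʳ (-‿inverseʳ 1#)) ⟨
    m ×′ 1# + (1# - 1# - n ×′ 1#)       ≈⟨ +-congˡ (+-assoc _ _ _) ⟩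
    m ×′ 1# + (1# + (- 1# - n ×′ 1#))   ≈⟨ +-assoc _ _ _ ⟨
    m ×′ 1# + 1# + (- 1# - n ×′ 1#)     ≈⟨ +-cong (trans (+-comm _ _) (sym (1+× m 1#))) (⁻¹-∙-comm _ _) ⟩
    suc m ×′ 1# - (1# + n ×′ 1#)        ≈⟨ +-congˡ (-‿cong (1+× n 1#)) ⟨
    suc m ×′ 1# - suc n ×′ 1#           ∎

  ⟦⟧-+ : ∀ i j → ⟦ i ℤ.+ j ⟧ℤ ≈ ⟦ i ⟧ℤ + ⟦ j ⟧ℤ
  ⟦⟧-+ (+ m) (+ n)           = ×-homo-+ 1# m n
  ⟦⟧-+ (+ m) (-[1+ n ])      = ⟦⟧-⊖ m (suc n)
  ⟦⟧-+ (-[1+ m ]) (+ n)      = trans (⟦⟧-⊖ n (suc m)) (+-comm _ _)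
  ⟦⟧-+ (-[1+ m ]) (-[1+ n ]) = begin
    - (suc (suc (m ℕ.+ n)) ×′ 1#)   ≡⟨ ≡.cong (λ k → - (suc k ×′ 1#)) (ℕ.+-suc m n) ⟨
    - ((suc m ℕ.+ suc n) ×′ 1#)     ≈⟨ -‿cong (×-homo-+ 1# (suc m) (suc n)) ⟩
    - (suc m ×′ 1# + suc n ×′ 1#)   ≈⟨ ⁻¹-∙-comm _ _ ⟨
    - (suc m ×′ 1#) - suc n ×′ 1#   ∎

  ⟦⟧-*-nonNeg : ∀ m n → ⟦ + m ℤ.* + n ⟧ℤ ≈ ⟦ + m ⟧ℤ * ⟦ + n ⟧ℤ
  ⟦⟧-*-nonNeg m n = begin
    ⟦ + m ℤ.* + n ⟧ℤ      ≡⟨ ≡.cong ⟦_⟧ℤ (ℤ.pos-* m n) ⟨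
    (m ℕ.* n) ×′ 1#       ≈⟨ ×1-homo-* m n ⟩
    m ×′ 1# * n ×′ 1#     ∎

  ⟦⟧-*-pos : ∀ i n → ⟦ i ℤ.* + n ⟧ℤ ≈ ⟦ i ⟧ℤ * ⟦ + n ⟧ℤ
  ⟦⟧-*-pos (+ m)      n = ⟦⟧-*-nonNeg m n
  ⟦⟧-*-pos (-[1+ m ]) n = begin
    ⟦ -[1+ m ] ℤ.* + n ⟧ℤ           ≡⟨ ≡.cong ⟦_⟧ℤ (ℤ.neg-distribˡ-* (+ suc m) (+ n)) ⟨
    ⟦ ℤ.- (+ suc m ℤ.* + n) ⟧ℤ      ≈⟨ ⟦⟧-neg (+ suc m ℤ.* + n) ⟩
    - ⟦ + suc m ℤ.* + n ⟧ℤ          ≈⟨ -‿cong (⟦⟧-*-nonNeg (suc m) n) ⟩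
    - (⟦ + suc m ⟧ℤ * ⟦ + n ⟧ℤ)     ≈⟨ -‿distribˡ-* _ _ ⟩
    ⟦ -[1+ m ] ⟧ℤ * ⟦ + n ⟧ℤ        ∎

  ⟦⟧-* : ∀ i j → ⟦ i ℤ.* j ⟧ℤ ≈ ⟦ i ⟧ℤ * ⟦ j ⟧ℤ
  ⟦⟧-* i (+ n)      = ⟦⟧-*-pos i n
  ⟦⟧-* i (-[1+ n ]) = begin
    ⟦ i ℤ.* -[1+ n ] ⟧ℤ          ≡⟨ ≡.cong ⟦_⟧ℤ (ℤ.neg-distribʳ-* i (+ suc n)) ⟨
    ⟦ ℤ.- (i ℤ.* + suc n) ⟧ℤ     ≈⟨ ⟦⟧-neg (i ℤ.* + suc n) ⟩
    - ⟦ i ℤ.* + suc n ⟧ℤ         ≈⟨ -‿cong (⟦⟧-*-pos i (suc n)) ⟩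
    - (⟦ i ⟧ℤ * ⟦ + suc n ⟧ℤ)    ≈⟨ -‿distribʳ-* _ _ ⟩
    ⟦ i ⟧ℤ * ⟦ -[1+ n ] ⟧ℤ       ∎

  morphism : ℤ.+-*-rawRing ACR.-Raw-AlmostCommutative⟶ ACR.fromCommutativeRing A
  morphism = record
    { ⟦_⟧ = ⟦_⟧ℤ ; +-homo = ⟦⟧-+ ; *-homo = ⟦⟧-* ; -‿homo = ⟦⟧-neg ; 0-homo = refl ; 1-homo = refl }

  coeff≟ : ∀ i j → Maybe (⟦ i ⟧ℤ ≈ ⟦ j ⟧ℤ)
  coeff≟ i j with i ℤ.≟ j
  ... | yes i≡j = just (reflexive (≡.cong ⟦_⟧ℤ i≡j))
  ... | no  _   = nothing

  open RingSolver ℤ.+-*-rawRing (ACR.fromCommutativeRing A) morphism coeff≟ public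
    using (solve; con; _:=_; _:+_; _:*_; _:-_; :-_)

  :0 :1 :2 : ∀ {n} → RingSolver.Polynomial ℤ.+-*-rawRing (ACR.fromCommutativeRing A) morphism coeff≟ n
  :0 = con (+ 0)
  :1 = con (+ 1)
  :2 = con (+ 2)

-- Combinatorics of the prescribed blocks

module PrescribedDigits (em : ∀ {ℓ} → ExcludedMiddle ℓ) where

  n<b^n : ∀ {b} → 2 ℕ.≤ b → ∀ n → n ℕ.< b ℕ.^ n
  n<b^n         2≤b zero    = s≤s z≤n
  n<b^n {b} 2≤b (suc n) = begin-strict
    suc n              ≤⟨ n<b^n 2≤b n ⟩
    b ℕ.^ n            <⟨ ℕ.m<m*n (b ℕ.^ n) b {{ℕ.>-nonZero (ℕ.≤-<-trans z≤n (n<b^n 2≤b n))}} 2≤b ⟩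
    b ℕ.^ n ℕ.* b      ≡⟨ ℕ.*-comm (b ℕ.^ n) b ⟩
    b ℕ.* b ℕ.^ n      ∎
    where open ℕ.≤-Reasoning

  module Blocks (m : ℕ) (8≤m : 8 ℕ.≤ m) where

    open import Data.Nat using (_≤_; _<_; _+_; _*_; _^_)
    open ℕ.≤-Reasoning

    L Q Z : ℕ → ℕ
    L j = m ^ j
    Q j = m ^ suc j
    Z j = Q j + (Q j + L j)

    InBlock IsEnd : ℕ → Set
    InBlock k = ∃[ j ] Q j ≤ k × k ≤ Z j
    IsEnd k = ∃[ j ] k ≡ Z j

    blocked : ℕ → Bool
    blocked k = does (em {P = InBlock k})

    #free : ℕ → ℕ
    #free zero    = 0
    #free (suc n) = if blocked n then #free n else suc (#free n)

    -- In a block [Q , Z] all digits are 0 except the last, which is 2; the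
    -- remaining positions are filled by t.
    digits : (ℕ → Bool) → ℕ → Bool
    digits t k = if blocked k then does (em {P = IsEnd k}) else t (#free k)

    instance
      m≢0 : ℕ.NonZero m
      m≢0 = ℕ.>-nonZero (ℕ.≤-trans (s≤s z≤n) 8≤m)

    1≤L : ∀ j → 1 ≤ L j
    1≤L j = ℕ.m^n>0 m j

    8L≤Q : ∀ j → 8 * L j ≤ Q j
    8L≤Q j = ℕ.*-monoˡ-≤ (L j) 8≤m

    L≤Q : ∀ j → L j ≤ Q j
    L≤Q j = ℕ.≤-trans (ℕ.m≤n*m (L j) 8) (8L≤Q j)

    Q-mono : ∀ {i j} → i ≤ j → Q i ≤ Q j
    Q-mono i≤j = ℕ.^-monoʳ-≤ m (s≤s i≤j)

    Z-mono : ∀ {i j} → i ≤ j → Z i ≤ Z j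
    Z-mono i≤j = ℕ.+-mono-≤ (Q-mono i≤j) (ℕ.+-mono-≤ (Q-mono i≤j) (ℕ.^-monoʳ-≤ m i≤j))

    1+Z≤4Q : ∀ j → suc (Z j) ≤ 4 * Q j
    1+Z≤4Q j = begin
      suc (Q j + (Q j + L j))      ≡⟨ (λ q l → 1+q+[q+l] q l) (Q j) (L j) ⟩
      2 * Q j + (1 + L j)          ≤⟨ ℕ.+-monoʳ-≤ (2 * Q j) (ℕ.+-monoˡ-≤ (L j) (1≤L j)) ⟩
      2 * Q j + (L j + L j)        ≤⟨ ℕ.+-monoʳ-≤ (2 * Q j) (ℕ.+-mono-≤ (L≤Q j) (L≤Q j)) ⟩
      2 * Q j + (Q j + Q j)        ≡⟨ 2q+[q+q] (Q j) ⟩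
      4 * Q j                      ∎
      where
      1+q+[q+l] : ∀ q l → suc (q + (q + l)) ≡ 2 * q + (1 + l)
      1+q+[q+l] = solve-∀
      2q+[q+q] : ∀ q → 2 * q + (q + q) ≡ 4 * q
      2q+[q+q] = solve-∀

    Z<Q : ∀ j → Z j < Q (suc j)
    Z<Q j = ℕ.≤-trans (1+Z≤4Q j) (ℕ.*-monoˡ-≤ (Q j) (ℕ.≤-trans (ℕ.m≤m+n 4 4) 8≤m))

    blocked-true : ∀ {k} → InBlock k → blocked k ≡ true
    blocked-true = dec-true em

    blocked-false : ∀ {k} → ¬ InBlock k → blocked k ≡ false
    blocked-false = dec-false em

    digits-blocked : ∀ t {k} → InBlock k → digits t k ≡ does (em {P = IsEnd k})
    digits-blocked t {k} b rewrite blocked-true b = ≡.refl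

    digits-free : ∀ t {k} → ¬ InBlock k → digits t k ≡ t (#free k)
    digits-free t {k} f rewrite blocked-false f = ≡.refl

    digits-end : ∀ t j → digits t (Z j) ≡ true
    digits-end t j = ≡.trans (digits-blocked t (j , ℕ.m≤m+n (Q j) _ , ℕ.≤-refl)) (dec-true em (j , ≡.refl))

    -- Such a position is not the end of any block: earlier blocks end before `Q j`, and the blocks
    -- from the j-th on end beyond it.
    digits-zeros : ∀ t j i → i < Q j + L j → digits t (Q j + i) ≡ false
    digits-zeros t j i i< = ≡.trans
      (digits-blocked t (j , ℕ.m≤m+n (Q j) i , ℕ.<⇒≤ k<Z)) (dec-false em not-end)
      where
      k<Z : Q j + i < Z j
      k<Z = ℕ.+-monoʳ-< (Q j) i<
      not-end : ¬ IsEnd (Q j + i)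
      not-end (j′ , k≡Z) with ℕ.≤-<-connex j j′
      ... | inj₁ j≤j′ = ℕ.<-irrefl k≡Z (ℕ.<-≤-trans k<Z (Z-mono j≤j′))
      ... | inj₂ j′<j = ℕ.<-irrefl (≡.sym k≡Z) (ℕ.<-≤-trans (Z<Q j′) (ℕ.≤-trans (Q-mono j′<j) (ℕ.m≤m+n (Q j) i)))

    not-blocked : ∀ j {k} → Z j < k → k < Q (suc j) → ¬ InBlock k
    not-blocked j Z<k k<Q (j′ , Q≤k , k≤Z) with ℕ.≤-<-connex j′ j
    ... | inj₁ j′≤j = ℕ.<⇒≱ Z<k (ℕ.≤-trans k≤Z (Z-mono j′≤j))
    ... | inj₂ j<j′ = ℕ.<⇒≱ k<Q (ℕ.≤-trans (Q-mono j<j′) Q≤k)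

    not-blocked₀ : ∀ {k} → k < Q 0 → ¬ InBlock k
    not-blocked₀ k<Q (j , Q≤k , _) = ℕ.<⇒≱ k<Q (ℕ.≤-trans (Q-mono (z≤n {j})) Q≤k)

    #free-suc : ∀ {k} → ¬ InBlock k → #free (suc k) ≡ suc (#free k)
    #free-suc f rewrite blocked-false f = ≡.refl

    agree⇒agree-free : ∀ n {t u} → (∀ i → i < n → digits t i ≡ digits u i) →
                       ∀ i → i < #free n → t i ≡ u i
    agree⇒agree-free (suc n) {t} {u} agree i i< with em {P = InBlock n}
    -- Splitting on the decision behind `blocked n` makes `#free (suc n)` compute: a blocked
    -- position contributes nothing, a free one contributes the entry with index `#free n`.
    ... | yes b = agree⇒agree-free n (λ k k<n → agree k (ℕ.m<n⇒m<1+n k<n)) i i<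
    ... | no  f with ℕ.m≤n⇒m<n∨m≡n (ℕ.≤-pred i<)
    ...   | inj₁ i<′    = agree⇒agree-free n (λ k k<n → agree k (ℕ.m<n⇒m<1+n k<n)) i i<′
    ...   | inj₂ ≡.refl = ≡.trans (≡.sym (digits-free t f)) (≡.trans (agree n ℕ.≤-refl) (digits-free u f))

    #free-step : ∀ n → #free n ≤ #free (suc n)
    #free-step n with blocked n
    ... | true  = ℕ.≤-refl
    ... | false = ℕ.n≤1+n _

    #free-mono : ∀ k {n} → n ≤ k → #free n ≤ #free k
    #free-mono k {n} n≤k = go (ℕ.≤⇒≤′ n≤k)
      where
      go : ∀ {k} → n ℕ.≤′ k → #free n ≤ #free k
      go (ℕ.≤′-reflexive ≡.refl) = ℕ.≤-refl
      go (ℕ.≤′-step p)           = ℕ.≤-trans (go p) (#free-step _)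

    #free-run : ∀ a l → (∀ k → a ≤ k → k < a + l → ¬ InBlock k) → #free (a + l) ≡ #free a + l
    #free-run a zero    _ = ≡.trans (≡.cong #free (ℕ.+-identityʳ a)) (≡.sym (ℕ.+-identityʳ _))
    #free-run a (suc l) f rewrite ℕ.+-suc a l | ℕ.+-suc (#free a) l =
      ≡.trans (#free-suc (f (a + l) (ℕ.m≤m+n a l) ℕ.≤-refl))
              (≡.cong suc (#free-run a l λ k a≤k k< → f k a≤k (ℕ.m<n⇒m<1+n k<)))

    #free-after : ∀ j l → suc (Z j) + l ≤ Q (suc j) → #free (suc (Z j) + l) ≡ #free (suc (Z j)) + l
    #free-after j l ≤Q = #free-run (suc (Z j)) l λ k Z<k k< → not-blocked j Z<k (ℕ.<-≤-trans k< ≤Q)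

    -- All positions up to the end of the preceding block are written off. That costs at most 4
    -- times the preceding `Q`, which is the present `L` by definition; beyond that block everything
    -- is free.
    Q≤#free+4L : ∀ j → Q j ≤ #free (Q j) + 4 * L j
    Q≤#free+4L zero = ℕ.≤-trans (ℕ.≤-reflexive (≡.sym (#free-run 0 (Q 0) λ k _ → not-blocked₀))) (ℕ.m≤m+n _ _)
    Q≤#free+4L (suc j) = begin
      Q (suc j)                            ≡⟨ split ⟨
      suc (Z j) + l                        ≡⟨ ℕ.+-comm (suc (Z j)) l ⟩
      l + suc (Z j)                        ≤⟨ ℕ.+-mono-≤ (ℕ.m≤n+m l (#free (suc (Z j)))) (1+Z≤4Q j) ⟩
      #free (suc (Z j)) + l + 4 * Q j      ≡⟨ ≡.cong (_+ 4 * Q j) (#free-after j l (ℕ.≤-reflexive split)) ⟨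
      #free (suc (Z j) + l) + 4 * Q j      ≡⟨ ≡.cong (λ k → #free k + 4 * Q j) split ⟩
      #free (Q (suc j)) + 4 * L (suc j)    ∎
      where
      l = Q (suc j) ℕ.∸ suc (Z j)
      split : suc (Z j) + l ≡ Q (suc j)
      split = ℕ.m+[n∸m]≡n (Z<Q j)

    n<Q : ∀ n → n < Q n
    n<Q n = ℕ.<-≤-trans (n<b^n (ℕ.≤-trans (ℕ.m≤m+n 2 6) 8≤m) n) (ℕ.^-monoʳ-≤ m (ℕ.n≤1+n n))

    locate : ∀ {n} k → n < Q k → n < Q 0 ⊎ ∃[ j ] Q j ≤ n × n < Q (suc j)
    locate zero    n< = inj₁ n<
    locate {n} (suc k) n< with ℕ.≤-<-connex (Q k) n
    ... | inj₁ Q≤n = inj₂ (k , Q≤n , n<)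
    ... | inj₂ n<Q = locate k n<Q

    private
      -- Origin of the constant 20. With q = ml at least q - 4l positions are free, and (2m + 20)(q
      -- - 4l) = 2mq + 12q - 80l. Since 8l ≤ q this is at least 2mq + 2q = m(2q + 2l). The
      -- subtracted term is added to both sides to stay in ℕ.
      within-block : ∀ j → m * suc (Z j) ≤ (2 * m + 20) * #free (Q j)
      within-block j = ℕ.+-cancelʳ-≤ ((2 * m + 20) * (4 * l)) _ _ (begin
        m * suc (q + (q + l)) + (2 * m + 20) * (4 * l)     ≤⟨ ℕ.+-monoˡ-≤ _ (ℕ.*-monoʳ-≤ m (ℕ.+-monoˡ-≤ (q + (q + l)) (1≤L j))) ⟩
        m * (l + (q + (q + l))) + (2 * m + 20) * (4 * l)   ≡⟨ expand m l ⟩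
        2 * m * (m * l) + 10 * (m * l) + 10 * (8 * l)      ≤⟨ ℕ.+-monoʳ-≤ (2 * m * (m * l) + 10 * (m * l)) (ℕ.*-monoʳ-≤ 10 (8L≤Q j)) ⟩
        2 * m * (m * l) + 10 * (m * l) + 10 * (m * l)      ≡⟨ collect m l ⟩
        (2 * m + 20) * q                                   ≤⟨ ℕ.*-monoʳ-≤ (2 * m + 20) (Q≤#free+4L j) ⟩
        (2 * m + 20) * (#free q + 4 * l)                   ≡⟨ ℕ.*-distribˡ-+ (2 * m + 20) (#free q) (4 * l) ⟩
        (2 * m + 20) * #free q + (2 * m + 20) * (4 * l)    ∎)
        where
        l = L j
        q = m * l
        expand : ∀ m l → m * (l + (m * l + (m * l + l))) + (2 * m + 20) * (4 * l)
                       ≡ 2 * m * (m * l) + 10 * (m * l) + 10 * (8 * l)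
        expand = solve-∀
        collect : ∀ m l → 2 * m * (m * l) + 10 * (m * l) + 10 * (m * l) ≡ (2 * m + 20) * (m * l)
        collect = solve-∀

    m≤2m+20 : m ≤ 2 * m + 20
    m≤2m+20 = ℕ.≤-trans (ℕ.m≤n*m m 2) (ℕ.m≤m+n (2 * m) 20)

    -- Free positions have lower density at least 1/2 - O(1/m).
    #free-density : ∀ n → m * n ≤ (2 * m + 20) * #free n
    #free-density n with locate n (n<Q n)
    ... | inj₁ n<Q₀ = ℕ.*-mono-≤ m≤2m+20 (ℕ.≤-reflexive (≡.sym (#free-run 0 n λ k _ k<n → not-blocked₀ (ℕ.<-trans k<n n<Q₀))))
    ... | inj₂ (j , Q≤n , n<Q′) with ℕ.≤-<-connex n (Z j)
    -- No free position is gained inside a block, so the ratio is worst at its end.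
    ...   | inj₁ n≤Z = begin
            m * n                     ≤⟨ ℕ.*-monoʳ-≤ m (ℕ.m≤n⇒m≤1+n n≤Z) ⟩
            m * suc (Z j)             ≤⟨ within-block j ⟩
            (2 * m + 20) * #free (Q j) ≤⟨ ℕ.*-monoʳ-≤ (2 * m + 20) (#free-mono n Q≤n) ⟩
            (2 * m + 20) * #free n    ∎
    -- Beyond the block each position is free: it adds m on the left and 2m + 20 on the right.
    ...   | inj₂ Z<n = begin
            m * n                                    ≡⟨ ≡.cong (m *_) split ⟨
            m * (z + l)                              ≡⟨ ℕ.*-distribˡ-+ m z l ⟩
            m * z + m * l                            ≤⟨ ℕ.+-mono-≤ (within-block j) (ℕ.*-monoˡ-≤ l m≤2m+20) ⟩
            (2 * m + 20) * #free (Q j) + (2 * m + 20) * l ≡⟨ ℕ.*-distribˡ-+ (2 * m + 20) (#free (Q j)) l ⟨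
            (2 * m + 20) * (#free (Q j) + l)         ≤⟨ ℕ.*-monoʳ-≤ (2 * m + 20) (ℕ.+-monoˡ-≤ l
                                                          (#free-mono z (ℕ.≤-trans (ℕ.m≤m+n (Q j) _) (ℕ.n≤1+n (Z j))))) ⟩
            (2 * m + 20) * (#free z + l)             ≡⟨ ≡.cong ((2 * m + 20) *_) (#free-after j l (ℕ.≤-trans (ℕ.≤-reflexive split) (ℕ.<⇒≤ n<Q′))) ⟨
            (2 * m + 20) * #free (z + l)             ≡⟨ ≡.cong (λ k → (2 * m + 20) * #free k) split ⟩
            (2 * m + 20) * #free n                   ∎
      where
      z = suc (Z j)
      l = n ℕ.∸ z
      split : z + l ≡ n
      split = ℕ.m+[n∸m]≡n Z<n

    2*q≤q² : ∀ {q} → 2 ≤ q → 2 * q ≤ q ^ 2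
    2*q≤q² {q} 2≤q = ℕ.≤-trans (ℕ.*-monoˡ-≤ q 2≤q) (ℕ.≤-reflexive (≡.cong (q *_) (≡.sym (ℕ.*-identityʳ q))))

    -- Descend to a scale where the first bound holds but fails one scale earlier. The failure says
    -- that the earlier power of 3 is below 2q ≤ q², and passing to the next scale multiplies the
    -- exponent `Q` by m. At scale 0 the estimate 3 ≤ q² takes the place of the failure.
    scale-exists : ∀ {q} → 2 ≤ q → ∃[ j ] 2 * q ≤ 3 ^ (Q j + L j) × 3 ^ Q j ≤ q ^ (2 * m)
    scale-exists {q} 2≤q = search (2 * q) (begin
      2 * q                            ≤⟨ ℕ.<⇒≤ (n<Q (2 * q)) ⟩
      Q (2 * q)                        ≤⟨ ℕ.m≤m+n _ _ ⟩
      Q (2 * q) + L (2 * q)            ≤⟨ ℕ.<⇒≤ (n<b^n (s≤s (s≤s z≤n)) _) ⟩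
      3 ^ (Q (2 * q) + L (2 * q))      ∎)
      where
      ≤q² : ∀ {b} → b ≤ q ^ 2 → b ^ m ≤ q ^ (2 * m)
      ≤q² b≤ = ℕ.≤-trans (ℕ.^-monoˡ-≤ m b≤) (ℕ.≤-reflexive (ℕ.^-*-assoc q 2 m))
      search : ∀ k → 2 * q ≤ 3 ^ (Q k + L k) → ∃[ j ] 2 * q ≤ 3 ^ (Q j + L j) × 3 ^ Q j ≤ q ^ (2 * m)
      search zero 2q≤ = 0 , 2q≤ , (begin
        3 ^ (m * 1)     ≡⟨ ≡.cong (3 ^_) (ℕ.*-identityʳ m) ⟩
        3 ^ m           ≤⟨ ≤q² (ℕ.≤-trans (ℕ.≤-trans (ℕ.n≤1+n 3) (ℕ.*-monoʳ-≤ 2 2≤q)) (2*q≤q² 2≤q)) ⟩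
        q ^ (2 * m)     ∎)
      search (suc k) 2q≤ with ℕ.≤-<-connex (2 * q) (3 ^ (Q k + L k))
      ... | inj₁ 2q≤′ = search k 2q≤′
      ... | inj₂ <2q  = suc k , 2q≤ , (begin
        3 ^ (m * Q k)   ≡⟨ ≡.cong (3 ^_) (ℕ.*-comm m (Q k)) ⟩
        3 ^ (Q k * m)   ≡⟨ ℕ.^-*-assoc 3 (Q k) m ⟨
        (3 ^ Q k) ^ m   ≤⟨ ≤q² (ℕ.≤-trans (ℕ.^-monoʳ-≤ 3 (ℕ.m≤m+n (Q k) (L k))) (ℕ.≤-trans (ℕ.<⇒≤ <2q) (2*q≤q² 2≤q))) ⟩
        q ^ (2 * m)     ∎)

    -- The exponent of q² (q^(2m))³, which dominates 3 · 3^(Q+L) · 3^Q when L is replaced by Q; the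
    -- other product to be bounded only needs 2m + 2.
    v : ℕ
    v = 6 * m + 2

    2q3^Q≤q^v : ∀ {q} j → 2 ≤ q → 3 ^ Q j ≤ q ^ (2 * m) → 2 * q * 3 ^ Q j ≤ q ^ v
    2q3^Q≤q^v {q} j 2≤q 3^Q≤ = begin
      2 * q * 3 ^ Q j         ≤⟨ ℕ.*-mono-≤ (2*q≤q² 2≤q) 3^Q≤ ⟩
      q ^ 2 * q ^ (2 * m)     ≡⟨ ℕ.^-distribˡ-+-* q 2 (2 * m) ⟨
      q ^ (2 + 2 * m)         ≤⟨ ℕ.^-monoʳ-≤ q {{ℕ.>-nonZero (ℕ.≤-trans (s≤s z≤n) 2≤q)}} (ℕ.≤-trans
                                   (ℕ.+-monoʳ-≤ 2 (ℕ.*-monoˡ-≤ m (ℕ.m≤m+n 2 4))) (ℕ.≤-reflexive (ℕ.+-comm 2 (6 * m)))) ⟩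
      q ^ v                   ∎

    3·3^z3^Q≤q^v : ∀ {q} j → 2 ≤ q → 3 ^ Q j ≤ q ^ (2 * m) → 3 * 3 ^ (Q j + L j) * 3 ^ Q j ≤ q ^ v
    3·3^z3^Q≤q^v {q} j 2≤q 3^Q≤ = begin
      3 * 3 ^ (Q j + L j) * 3 ^ Q j              ≤⟨ ℕ.*-monoˡ-≤ (3 ^ Q j) (ℕ.*-monoʳ-≤ 3 (ℕ.^-monoʳ-≤ 3 (ℕ.+-monoʳ-≤ (Q j) (L≤Q j)))) ⟩
      3 * 3 ^ (Q j + Q j) * 3 ^ Q j              ≡⟨ ≡.cong (λ k → 3 * k * 3 ^ Q j) (ℕ.^-distribˡ-+-* 3 (Q j) (Q j)) ⟩
      3 * (3 ^ Q j * 3 ^ Q j) * 3 ^ Q j          ≤⟨ ℕ.*-mono-≤ (ℕ.*-mono-≤ 3≤q² (ℕ.*-mono-≤ 3^Q≤ 3^Q≤)) 3^Q≤ ⟩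
      q ^ 2 * (q ^ (2 * m) * q ^ (2 * m)) * q ^ (2 * m)
        ≡⟨ ≡.cong (λ k → q ^ 2 * k * q ^ (2 * m)) (ℕ.^-distribˡ-+-* q (2 * m) (2 * m)) ⟨
      q ^ 2 * q ^ (2 * m + 2 * m) * q ^ (2 * m)  ≡⟨ ≡.cong (_* q ^ (2 * m)) (ℕ.^-distribˡ-+-* q 2 (2 * m + 2 * m)) ⟨
      q ^ (2 + (2 * m + 2 * m)) * q ^ (2 * m)    ≡⟨ ℕ.^-distribˡ-+-* q (2 + (2 * m + 2 * m)) (2 * m) ⟨
      q ^ (2 + (2 * m + 2 * m) + 2 * m)          ≡⟨ ≡.cong (q ^_) (exponent m) ⟩
      q ^ v                                      ∎
      where
      3≤q² : 3 ≤ q ^ 2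
      3≤q² = ℕ.≤-trans (ℕ.≤-trans (ℕ.n≤1+n 3) (ℕ.*-monoʳ-≤ 2 2≤q)) (2*q≤q² 2≤q)
      exponent : ∀ m → 2 + (2 * m + 2 * m) + 2 * m ≡ 6 * m + 2
      exponent = solve-∀

module Proof (em : ∀ {ℓ} → ExcludedMiddle ℓ) (R : RealNumbers) where

  open Analysis em R
  open PrescribedDigits em
  open RealNumbers R renaming (Carrier to ℝ)
  open Solver commutativeRing
  open TotalOrder totalOrder using (poset; antisym)
    renaming (refl to ≤-refl; trans to ≤-trans; reflexive to ≤-reflexive; total to ≤-total)
  open Strict _≈_ _≤_ using (_<_)
  open PartialOrderReasoning poset
  open NonStrict⁺ _≤_ using ([_]; _≤⊤⁺)
  open Equality⁺ _≈_ using (_≈⁺_)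
  open RawSemiringDefs (Semiring.rawSemiring semiring) using (_^_; sum) renaming (_×_ to _•_)
  open Mult semiring using (×-homo-+; ×1-homo-*; ×-assoc-*; ×-congʳ)
  open Exp semiring using (^-congˡ; ^-homo-*)
  open Sum semiring using (sum-cong-≋; *-distribˡ-sum; *-distribʳ-sum)
  open Binomial commutativeSemiring using (binomialTerm) renaming (theorem to binomial-theorem)

  -- Consequences of the ordered field axioms

  0≤-resp : ∀ {x y} → x ≈ y → 0# ≤ x → 0# ≤ y
  0≤-resp x≈y 0≤x = ≤-trans 0≤x (≤-reflexive x≈y)

  x≤y⇒0≤y-x : ∀ {x y} → x ≤ y → 0# ≤ y - x
  x≤y⇒0≤y-x {x} {y} x≤y = begin
    0#    ≈⟨ -‿inverseʳ x ⟨
    x - x ≤⟨ +-monoˡ-≤ (- x) x≤y ⟩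
    y - x ∎

  -- Most inequalities below are certificates: y - x is identified by the ring
  -- solver with a sum of products of nonnegative elements.
  ≤-from : ∀ {x y e} → 0# ≤ e → e ≈ y - x → x ≤ y
  ≤-from {x} {y} {e} 0≤e e≈ = begin
    x         ≈⟨ +-identityˡ x ⟨
    0# + x    ≤⟨ +-monoˡ-≤ x (0≤-resp e≈ 0≤e) ⟩
    y - x + x ≈⟨ solve 2 (λ x y → y :- x :+ x := y) refl x y ⟩
    y         ∎

  +-nonNeg : ∀ {x y} → 0# ≤ x → 0# ≤ y → 0# ≤ x + y
  +-nonNeg {x} {y} 0≤x 0≤y = ≤-trans 0≤y (≤-from 0≤x (solve 2 (λ x y → x := x :+ y :- y) refl x y))

  infixl 6 _⊕_
  infixl 7 _⊛_
  _⊕_ : ∀ {x y} → 0# ≤ x → 0# ≤ y → 0# ≤ x + y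
  _⊕_ = +-nonNeg
  _⊛_ : ∀ {x y} → 0# ≤ x → 0# ≤ y → 0# ≤ x * y
  _⊛_ = *-nonNeg

  +-mono-≤ : ∀ {a b c d} → a ≤ b → c ≤ d → a + c ≤ b + d
  +-mono-≤ {a} {b} {c} {d} p q = ≤-from (x≤y⇒0≤y-x p ⊕ x≤y⇒0≤y-x q)
    (solve 4 (λ a b c d → (b :- a) :+ (d :- c) := b :+ d :- (a :+ c)) refl a b c d)

  neg-mono-≤ : ∀ {a b} → a ≤ b → - b ≤ - a
  neg-mono-≤ {a} {b} p = ≤-from (x≤y⇒0≤y-x p) (solve 2 (λ a b → b :- a := :- a :- :- b) refl a b)

  *-monoˡ-≤ : ∀ {a b} c → 0# ≤ c → a ≤ b → c * a ≤ c * b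
  *-monoˡ-≤ {a} {b} c 0≤c p = ≤-from (0≤c ⊛ x≤y⇒0≤y-x p)
    (solve 3 (λ a b c → c :* (b :- a) := c :* b :- c :* a) refl a b c)

  *-monoʳ-≤ : ∀ {a b} c → 0# ≤ c → a ≤ b → a * c ≤ b * c
  *-monoʳ-≤ {a} {b} c 0≤c p = ≤-from (0≤c ⊛ x≤y⇒0≤y-x p)
    (solve 3 (λ a b c → c :* (b :- a) := b :* c :- a :* c) refl a b c)

  *-mono-≤ : ∀ {a b c d} → 0# ≤ a → 0# ≤ c → a ≤ b → c ≤ d → a * c ≤ b * d
  *-mono-≤ {a} {b} {c} {d} 0≤a 0≤c a≤b c≤d =
    ≤-trans (*-monoʳ-≤ c 0≤c a≤b) (*-monoˡ-≤ b (≤-trans 0≤a a≤b) c≤d)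

  0≤1 : 0# ≤ 1#
  0≤1 with ≤-total 0# 1#
  ... | inj₁ 0≤1 = 0≤1
  ... | inj₂ 1≤0 = 0≤-resp (solve 0 (:- :1 :* :- :1 := :1) refl) (0≤-1 ⊛ 0≤-1)
    where
    0≤-1 : 0# ≤ - 1#
    0≤-1 = 0≤-resp (+-identityˡ _) (x≤y⇒0≤y-x 1≤0)

  0<1 : 0# < 1#
  0<1 = 0≤1 , 0≉1

  <⇒≱ : ∀ {x y} → x < y → ¬ y ≤ x
  <⇒≱ = Strict.<⇒≱ _≈_ _≤_ antisym

  ≰⇒> : ∀ {x y} → ¬ x ≤ y → y < x
  ≰⇒> = Strict.≰⇒> _≈_ _≤_ sym ≤-reflexive (≤-total)

  ≮⇒≥ : ∀ {x y} → ¬ x < y → y ≤ x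
  ≮⇒≥ {x} {y} x≮y with em {P = y ≤ x}
  ... | yes y≤x = y≤x
  ... | no  y≰x = contradiction (≰⇒> y≰x) x≮y

  infix 4 _≤?_
  _≤?_ : ∀ x y → Dec (x ≤ y)
  x ≤? y = em

  <-respʳ : ∀ {x y z} → y ≈ z → x < y → x < z
  <-respʳ {x} {y} {z} y≈z x<y = begin-strict x <⟨ x<y ⟩ y ≈⟨ y≈z ⟩ z ∎

  <-respˡ : ∀ {x y z} → x ≈ y → x < z → y < z
  <-respˡ {x} {y} {z} x≈y x<z = begin-strict y ≈⟨ x≈y ⟨ x <⟨ x<z ⟩ z ∎

  x<y⇒0<y-x : ∀ {x y} → x < y → 0# < y - x
  x<y⇒0<y-x {x} {y} x<y = ≰⇒> λ y-x≤0 → <⇒≱ x<y (≤-from (x≤y⇒0≤y-x y-x≤0)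
    (solve 2 (λ x y → :0 :- (y :- x) := x :- y) refl x y))

  0<y-x⇒x<y : ∀ {x y} → 0# < y - x → x < y
  0<y-x⇒x<y {x} {y} 0<y-x = ≰⇒> λ y≤x → <⇒≱ 0<y-x (≤-from (x≤y⇒0≤y-x y≤x)
    (solve 2 (λ x y → x :- y := :0 :- (y :- x)) refl x y))

  <-from : ∀ {x y e} → 0# < e → e ≈ y - x → x < y
  <-from 0<e e≈ = 0<y-x⇒x<y (<-respʳ e≈ 0<e)

  pos⇒≉0 : ∀ {x} → 0# < x → ¬ x ≈ 0#
  pos⇒≉0 (_ , 0≉x) x≈0 = 0≉x (sym x≈0)

  ⁻¹-inverseˡ : ∀ {x} → ¬ x ≈ 0# → x ⁻¹ * x ≈ 1#
  ⁻¹-inverseˡ x≉0 = trans (*-comm _ _) (⁻¹-inverseʳ _ x≉0)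

  *-cancelˡ-0 : ∀ {x y} → ¬ x ≈ 0# → x * y ≈ 0# → y ≈ 0#
  *-cancelˡ-0 {x} {y} x≉0 xy≈0 = begin-equality
    y              ≈⟨ *-identityˡ y ⟨
    1# * y         ≈⟨ *-congʳ (⁻¹-inverseˡ x≉0) ⟨
    x ⁻¹ * x * y   ≈⟨ *-assoc _ _ _ ⟩
    x ⁻¹ * (x * y) ≈⟨ *-congˡ xy≈0 ⟩
    x ⁻¹ * 0#      ≈⟨ zeroʳ _ ⟩
    0#             ∎

  *-pos : ∀ {x y} → 0# < x → 0# < y → 0# < x * y
  *-pos 0<x 0<y = *-nonNeg (proj₁ 0<x) (proj₁ 0<y) ,
    λ 0≈xy → pos⇒≉0 0<y (*-cancelˡ-0 (pos⇒≉0 0<x) (sym 0≈xy))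

  +-pos-nonNeg : ∀ {x y} → 0# < x → 0# ≤ y → 0# < x + y
  +-pos-nonNeg {x} {y} 0<x 0≤y = begin-strict
    0# <⟨ 0<x ⟩ x ≈⟨ +-identityʳ x ⟨ x + 0# ≤⟨ +-mono-≤ ≤-refl 0≤y ⟩ x + y ∎

  *-cancelʳ-≤ : ∀ {x y} z → 0# < z → x * z ≤ y * z → x ≤ y
  *-cancelʳ-≤ {x} {y} z 0<z xz≤yz with x ≤? y
  ... | yes x≤y = x≤y
  ... | no  x≰y = contradiction xz≤yz (<⇒≱ (<-from (*-pos (x<y⇒0<y-x (≰⇒> x≰y)) 0<z)
    (solve 3 (λ x y z → (x :- y) :* z := x :* z :- y :* z) refl x y z)))

  ⁻¹-pos : ∀ {x} → 0# < x → 0# < x ⁻¹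
  ⁻¹-pos {x} 0<x = ≰⇒> λ x⁻¹≤0 → <⇒≱ 0<1 (begin
    1#         ≈⟨ ⁻¹-inverseʳ x (pos⇒≉0 0<x) ⟨
    x * x ⁻¹   ≤⟨ *-monoˡ-≤ x (proj₁ 0<x) x⁻¹≤0 ⟩
    x * 0#     ≈⟨ zeroʳ x ⟩
    0#         ∎)

  2# 3# : ℝ
  2# = 1# + 1#
  3# = 1# + 1# + 1#

  ½ : ℝ
  ½ = 2# ⁻¹

  0<2 : 0# < 2#
  0<2 = +-pos-nonNeg 0<1 0≤1

  0<3 : 0# < 3#
  0<3 = +-pos-nonNeg 0<2 0≤1

  0<½ : 0# < ½
  0<½ = ⁻¹-pos 0<2

  ½*2 : ½ * 2# ≈ 1#
  ½*2 = ⁻¹-inverseˡ (pos⇒≉0 0<2)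

  0≤½ : 0# ≤ ½
  0≤½ = proj₁ 0<½

  ½≤1 : ½ ≤ 1#
  ½≤1 = ≤-trans (≤-from 0≤½ (solve 1 (λ h → h := h :* :2 :- h) refl ½)) (≤-reflexive ½*2)

  */-cancel : ∀ {x} y → ¬ y ≈ 0# → x / y * y ≈ x
  */-cancel {x} y y≉0 = begin-equality
    x * y ⁻¹ * y   ≈⟨ *-assoc _ _ _ ⟩
    x * (y ⁻¹ * y) ≈⟨ *-congˡ (⁻¹-inverseˡ y≉0) ⟩
    x * 1#         ≈⟨ *-identityʳ x ⟩
    x              ∎

  -- Natural numbers and powers in the reals

  fromℕ-+ : ∀ m n → fromℕ (m ℕ.+ n) ≈ fromℕ m + fromℕ n
  fromℕ-+ = ×-homo-+ 1#

  fromℕ-* : ∀ m n → fromℕ (m ℕ.* n) ≈ fromℕ m * fromℕ n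
  fromℕ-* = ×1-homo-*

  fromℕ-^ : ∀ m n → fromℕ (m ℕ.^ n) ≈ fromℕ m ^ n
  fromℕ-^ m zero    = +-identityʳ 1#
  fromℕ-^ m (suc n) = trans (fromℕ-* m (m ℕ.^ n)) (*-congˡ (fromℕ-^ m n))

  fromℕ-nonNeg : ∀ n → 0# ≤ fromℕ n
  fromℕ-nonNeg zero    = ≤-refl
  fromℕ-nonNeg (suc n) = +-nonNeg 0≤1 (fromℕ-nonNeg n)

  fromℕ-mono-≤ : ∀ {m n} → m ℕ.≤ n → fromℕ m ≤ fromℕ n
  fromℕ-mono-≤ {n = n} z≤n = fromℕ-nonNeg n
  fromℕ-mono-≤ (s≤s m≤n)   = +-mono-≤ ≤-refl (fromℕ-mono-≤ m≤n)

  fromℕ-pos : ∀ {n} → 0 ℕ.< n → 0# < fromℕ n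
  fromℕ-pos {suc n} _ = +-pos-nonNeg 0<1 (fromℕ-nonNeg n)

  fromℕ-1 : fromℕ 1 ≈ 1#
  fromℕ-1 = +-identityʳ 1#

  fromℕ-2 : fromℕ 2 ≈ 2#
  fromℕ-2 = +-congˡ fromℕ-1

  fromℕ-3 : fromℕ 3 ≈ 3#
  fromℕ-3 = trans (+-congˡ fromℕ-2) (sym (+-assoc _ _ _))

  ^-nonNeg : ∀ {x} n → 0# ≤ x → 0# ≤ x ^ n
  ^-nonNeg zero    0≤x = 0≤1
  ^-nonNeg (suc n) 0≤x = *-nonNeg 0≤x (^-nonNeg n 0≤x)

  ^-pos : ∀ {x} n → 0# < x → 0# < x ^ n
  ^-pos zero    0<x = 0<1
  ^-pos (suc n) 0<x = *-pos 0<x (^-pos n 0<x)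

  ^-monoˡ-≤ : ∀ {x y} n → 0# ≤ x → x ≤ y → x ^ n ≤ y ^ n
  ^-monoˡ-≤ zero    0≤x x≤y = ≤-refl
  ^-monoˡ-≤ (suc n) 0≤x x≤y = *-mono-≤ 0≤x (^-nonNeg n 0≤x) x≤y (^-monoˡ-≤ n 0≤x x≤y)

  ^-≤1 : ∀ {x} n → 0# ≤ x → x ≤ 1# → x ^ n ≤ 1#
  ^-≤1 zero    0≤x x≤1 = ≤-refl
  ^-≤1 (suc n) 0≤x x≤1 = ≤-trans (*-mono-≤ 0≤x (^-nonNeg n 0≤x) x≤1 (^-≤1 n 0≤x x≤1)) (≤-reflexive (*-identityʳ 1#))

  1≤^ : ∀ {x} n → 1# ≤ x → 1# ≤ x ^ n
  1≤^ zero    1≤x = ≤-refl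
  1≤^ (suc n) 1≤x = ≤-trans (≤-reflexive (sym (*-identityʳ 1#))) (*-mono-≤ 0≤1 0≤1 1≤x (1≤^ n 1≤x))

  ^-monoʳ-≤ : ∀ {x m n} → 1# ≤ x → m ℕ.≤ n → x ^ m ≤ x ^ n
  ^-monoʳ-≤ {n = n} 1≤x z≤n = 1≤^ n 1≤x
  ^-monoʳ-≤ {x} 1≤x (s≤s m≤n) = *-monoˡ-≤ x (≤-trans 0≤1 1≤x) (^-monoʳ-≤ 1≤x m≤n)

  -- If the naturals were bounded, their supremum lowered by 1 would still be an upper bound, since
  -- n + 1 is again a natural number.
  archimedean : ∀ x → ∃[ n ] x < fromℕ n
  archimedean x with em {P = ∃[ n ] x < fromℕ n}
  ... | yes p = p
  ... | no ¬p = contradiction s≤s-1 (<⇒≱ (<-from 0<1 (solve 1 (λ s → :1 := s :- (s :- :1)) refl s)))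
    where
    isNat : Pred ℝ 0ℓ
    isNat y = ∃[ n ] y ≈ fromℕ n
    lub = complete isNat (0# , 0 , refl)
            (x , λ { (n , y≈n) → ≤-trans (≤-reflexive y≈n) (≮⇒≥ λ x<n → ¬p (n , x<n)) })
    s = proj₁ lub
    s≤s-1 : s ≤ s - 1#
    s≤s-1 = proj₂ (proj₂ lub) (s - 1#) λ {y} → λ { (n , y≈n) →
      ≤-from (x≤y⇒0≤y-x (proj₁ (proj₂ lub) {1# + y} (suc n , +-congˡ y≈n)))
             (solve 2 (λ s y → s :- (:1 :+ y) := s :- :1 :- y) refl s y) }

  -- Absolute values and limits

  infix 4 _⊑_
  -- The bound of the absolute value of a by b, kept as two inequalities so that sums and products
  -- are handled by certificates instead of sign distinctions.
  _⊑_ : ℝ → ℝ → Set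
  a ⊑ b = - b ≤ a × a ≤ b

  module Abs = Max totalOrder

  x≤∣x∣ : ∀ x → x ≤ ∣ x ∣
  x≤∣x∣ x = Abs.x≤x⊔y x (- x)

  -x≤∣x∣ : ∀ x → - x ≤ ∣ x ∣
  -x≤∣x∣ x = Abs.x≤y⊔x x (- x)

  neg-swap-≤ : ∀ {x y} → - x ≤ y → - y ≤ x
  neg-swap-≤ {x} {y} p = ≤-from (x≤y⇒0≤y-x p) (solve 2 (λ x y → y :- :- x := x :- :- y) refl x y)

  ∣∣≤ : ∀ {x b} → x ⊑ b → ∣ x ∣ ≤ b
  ∣∣≤ (l , u) = Abs.⊔-lub u (neg-swap-≤ l)

  ⊑∣∣ : ∀ x → x ⊑ ∣ x ∣
  ⊑∣∣ x = neg-swap-≤ (-x≤∣x∣ x) , x≤∣x∣ x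

  0≤∣x∣ : ∀ x → 0# ≤ ∣ x ∣
  0≤∣x∣ x with ≤-total 0# x
  ... | inj₁ 0≤x = ≤-trans 0≤x (x≤∣x∣ x)
  ... | inj₂ x≤0 = ≤-trans (≤-from (x≤y⇒0≤y-x x≤0) (solve 1 (λ x → :0 :- x := :- x :- :0) refl x)) (-x≤∣x∣ x)

  ⊑-refl : ∀ {a} → 0# ≤ a → a ⊑ a
  ⊑-refl {a} 0≤a = ≤-from (0≤a ⊕ 0≤a) (solve 1 (λ a → a :+ a := a :- :- a) refl a) , ≤-refl

  ⊑-≤ : ∀ {a b c} → a ⊑ b → b ≤ c → a ⊑ c
  ⊑-≤ (l , u) b≤c = ≤-trans (neg-mono-≤ b≤c) l , ≤-trans u b≤c

  ⊑-resp : ∀ {a b c} → a ≈ b → a ⊑ c → b ⊑ c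
  ⊑-resp a≈b (l , u) = ≤-trans l (≤-reflexive a≈b) , ≤-trans (≤-reflexive (sym a≈b)) u

  ⊑-+ : ∀ {a b c d} → a ⊑ b → c ⊑ d → a + c ⊑ b + d
  ⊑-+ {a} {b} {c} {d} (l , u) (l′ , u′) =
    ≤-trans (≤-reflexive (solve 2 (λ b d → :- (b :+ d) := :- b :+ :- d) refl b d)) (+-mono-≤ l l′) , +-mono-≤ u u′

  ⊑-neg : ∀ {a b} → a ⊑ b → - a ⊑ b
  ⊑-neg (l , u) = neg-mono-≤ u , neg-swap-≤ l

  0≤2*⇒0≤ : ∀ {x} → 0# ≤ x * 2# → 0# ≤ x
  0≤2*⇒0≤ {x} 0≤x*2 = *-cancelʳ-≤ 2# 0<2 (≤-trans (≤-reflexive (zeroˡ 2#)) 0≤x*2)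

  -- Both halves come from identities: (b-a)(d-c) + (b+a)(d+c) = 2(bd + ac) and (b-a)(d+c) +
  -- (b+a)(d-c) = 2(bd - ac), where all factors on the left are nonnegative.
  ⊑-* : ∀ {a b c d} → a ⊑ b → c ⊑ d → a * c ⊑ b * d
  ⊑-* {a} {b} {c} {d} (l , u) (l′ , u′) =
      ≤-from (0≤2*⇒0≤ (0≤-resp (solve 4 (λ a b c d →
        (b :- a) :* (d :- c) :+ (a :- :- b) :* (c :- :- d) := (b :* d :+ a :* c) :* :2) refl a b c d)
        (x≤y⇒0≤y-x u ⊛ x≤y⇒0≤y-x u′ ⊕ x≤y⇒0≤y-x l ⊛ x≤y⇒0≤y-x l′)))
        (solve 4 (λ a b c d → b :* d :+ a :* c := a :* c :- :- (b :* d)) refl a b c d)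
    , ≤-from (0≤2*⇒0≤ (0≤-resp (solve 4 (λ a b c d →
        (b :- a) :* (c :- :- d) :+ (a :- :- b) :* (d :- c) := (b :* d :- a :* c) :* :2) refl a b c d)
        (x≤y⇒0≤y-x u ⊛ x≤y⇒0≤y-x l′ ⊕ x≤y⇒0≤y-x l ⊛ x≤y⇒0≤y-x u′)))
        refl

  ½*-pos : ∀ {ε} → 0# < ε → 0# < ½ * ε
  ½*-pos = *-pos 0<½

  ½+½ : ∀ x → ½ * x + ½ * x ≈ x
  ½+½ x = begin-equality
    ½ * x + ½ * x ≈⟨ solve 2 (λ h x → h :* x :+ h :* x := h :* :2 :* x) refl ½ x ⟩
    ½ * 2# * x    ≈⟨ *-congʳ ½*2 ⟩
    1# * x        ≈⟨ *-identityˡ x ⟩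
    x             ∎

  ½*< : ∀ {ε} → 0# < ε → ½ * ε < ε
  ½*< {ε} 0<ε = <-from (½*-pos 0<ε) (begin-equality
    ½ * ε                   ≈⟨ solve 1 (λ h → h := h :+ h :- h) refl (½ * ε) ⟩
    ½ * ε + ½ * ε - ½ * ε   ≈⟨ +-congʳ (½+½ ε) ⟩
    ε - ½ * ε               ∎)

  ≤-ε : ∀ {x y} → (∀ ε → 0# < ε → x ≤ y + ε) → x ≤ y
  ≤-ε {x} {y} h with x ≤? y
  ... | yes x≤y = x≤y
  ... | no  x≰y = contradiction (h (½ * (x - y)) (½*-pos 0<x-y)) (<⇒≱ (begin-strict
    y + ½ * (x - y) <⟨ <-from (x<y⇒0<y-x (½*< 0<x-y))
                         (solve 3 (λ x y h → x :- y :- h := y :+ (x :- y) :- (y :+ h)) refl x y (½ * (x - y))) ⟩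
    y + (x - y)     ≈⟨ solve 2 (λ x y → y :+ (x :- y) := x) refl x y ⟩
    x               ∎))
    where
    0<x-y = x<y⇒0<y-x (≰⇒> x≰y)

  Tends : (ℕ → ℝ) → ℝ → Set
  Tends a l = ∀ ε → 0# < ε → ∃[ N ] (∀ n → N ℕ.≤ n → a n - l ⊑ ε)

  Tends⇒⟶ : ∀ {a l} → Tends a l → a ⟶ l
  Tends⇒⟶ {a} {l} t ε 0<ε =
    let N , h = t (½ * ε) (½*-pos 0<ε) in
    N , λ n N≤n → begin-strict ∣ a n - l ∣ ≤⟨ ∣∣≤ (h n N≤n) ⟩ ½ * ε <⟨ ½*< 0<ε ⟩ ε ∎

  ⟶⇒Tends : ∀ {a l} → a ⟶ l → Tends a l
  ⟶⇒Tends {a} {l} t ε 0<ε =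
    let N , h = t ε 0<ε in N , λ n N≤n → ⊑-≤ (⊑∣∣ (a n - l)) (proj₁ (h n N≤n))

  tends-cong : ∀ {a b l} → (∀ n → a n ≈ b n) → Tends a l → Tends b l
  tends-cong a≈b t ε 0<ε = let N , h = t ε 0<ε in
    N , λ n N≤n → ⊑-resp (+-congʳ (a≈b n)) (h n N≤n)

  limit-≤ : ∀ {a b l m} → Tends a l → Tends b m → (∀ n → a n ≤ b n) → l ≤ m
  limit-≤ {a} {b} {l} {m} s t a≤b = ≤-ε bound
    where
    bound : ∀ ε → 0# < ε → l ≤ m + ε
    bound ε 0<ε =
      let M , f = s (½ * ε) (½*-pos 0<ε)
          N , g = t (½ * ε) (½*-pos 0<ε)
          n = M ℕ.+ N in
      ≤-trans (≤-from
      (x≤y⇒0≤y-x (proj₁ (f n (ℕ.m≤m+n M N))) ⊕ x≤y⇒0≤y-x (proj₂ (g n (ℕ.m≤n+m N M))) ⊕ x≤y⇒0≤y-x (a≤b n))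
      (solve 5 (λ h l m x y → (x :- l :- :- h) :+ (h :- (y :- m)) :+ (y :- x) := m :+ (h :+ h) :- l)
        refl (½ * ε) l m (a n) (b n)))
      (+-mono-≤ ≤-refl (≤-reflexive (½+½ ε)))

  tends-const : ∀ c → Tends (λ _ → c) c
  tends-const c ε 0<ε = 0 , λ n _ → ⊑-resp (sym (-‿inverseʳ c)) (⊑-≤ (⊑-refl ≤-refl) (proj₁ 0<ε))

  limit-unique : ∀ {a l m} → Tends a l → Tends a m → l ≈ m
  limit-unique s t = antisym (limit-≤ s t λ _ → ≤-refl) (limit-≤ t s λ _ → ≤-refl)

  limit-≤-const : ∀ {a l c} → Tends a l → (∀ n → a n ≤ c) → l ≤ c
  limit-≤-const {c = c} t = limit-≤ t (tends-const c)

  -- Lets limit proofs end with an error of the form C ε. The restriction to ε ≤ 1 serves products,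
  -- where ε ε has to be absorbed into ε.
  tends-scale : ∀ {a l} C → 0# < C →
    (∀ ε → 0# < ε → ε ≤ 1# → ∃[ N ] (∀ n → N ℕ.≤ n → a n - l ⊑ C * ε)) → Tends a l
  tends-scale {a} {l} C 0<C h ε 0<ε = case em of λ
    { (yes ≤1) → let N , g = h (ε / C) (*-pos 0<ε (⁻¹-pos 0<C)) ≤1 in
        N , λ n N≤n → ⊑-≤ (g n N≤n) (≤-reflexive C*[ε/C]≈ε)
    ; (no ≰1) → let N , g = h 1# 0<1 ≤-refl in
        N , λ n N≤n → ⊑-≤ (g n N≤n)
          (≤-trans (*-monoˡ-≤ C (proj₁ 0<C) (proj₁ (≰⇒> ≰1))) (≤-reflexive C*[ε/C]≈ε)) }
    where
    C*[ε/C]≈ε : C * (ε / C) ≈ ε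
    C*[ε/C]≈ε = trans (*-comm C _) (*/-cancel C (pos⇒≉0 0<C))

  tends-+ : ∀ {a b l m} → Tends a l → Tends b m → Tends (λ n → a n + b n) (l + m)
  tends-+ {a} {b} {l} {m} s t = tends-scale 2# 0<2 go
    where
    go : ∀ ε → 0# < ε → ε ≤ 1# → ∃[ N ] (∀ n → N ℕ.≤ n → a n + b n - (l + m) ⊑ 2# * ε)
    go ε 0<ε _ = let M , f = s ε 0<ε
                     N , g = t ε 0<ε in
      M ℕ.+ N , λ n MN≤n →
      ⊑-≤ (⊑-resp (solve 4 (λ x y l m → x :- l :+ (y :- m) := x :+ y :- (l :+ m)) refl (a n) (b n) l m)
        (⊑-+ (f n (ℕ.≤-trans (ℕ.m≤m+n M N) MN≤n)) (g n (ℕ.≤-trans (ℕ.m≤n+m N M) MN≤n))))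
        (≤-reflexive (solve 1 (λ e → e :+ e := :2 :* e) refl ε))

  tends-neg : ∀ {a l} → Tends a l → Tends (λ n → - a n) (- l)
  tends-neg {a} {l} t ε 0<ε = let N , f = t ε 0<ε in
    N , λ n N≤n → ⊑-resp (solve 2 (λ x l → :- (x :- l) := :- x :- :- l) refl (a n) l) (⊑-neg (f n N≤n))

  tends-* : ∀ {a b l m} → Tends a l → Tends b m → Tends (λ n → a n * b n) (l * m)
  tends-* {a} {b} {l} {m} s t = tends-scale (1# + (∣ l ∣ + ∣ m ∣)) (+-pos-nonNeg 0<1 (0≤∣x∣ l ⊕ 0≤∣x∣ m)) go
    where
    go : ∀ ε → 0# < ε → ε ≤ 1# → ∃[ N ] (∀ n → N ℕ.≤ n → a n * b n - l * m ⊑ (1# + (∣ l ∣ + ∣ m ∣)) * ε)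
    go ε 0<ε ε≤1 = let M , f = s ε 0<ε
                       N , g = t ε 0<ε in
      M ℕ.+ N , λ n MN≤n →
      let F = f n (ℕ.≤-trans (ℕ.m≤m+n M N) MN≤n)
          G = g n (ℕ.≤-trans (ℕ.m≤n+m N M) MN≤n) in
      ⊑-≤ (⊑-resp (solve 4 (λ x y l m → (x :- l) :* (y :- m) :+ (l :* (y :- m) :+ m :* (x :- l)) := x :* y :- l :* m)
                     refl (a n) (b n) l m)
                  (⊑-+ (⊑-* F G) (⊑-+ (⊑-* (⊑∣∣ l) G) (⊑-* (⊑∣∣ m) F))))
          (begin
            ε * ε + (∣ l ∣ * ε + ∣ m ∣ * ε)   ≤⟨ +-mono-≤ (*-monoʳ-≤ ε (proj₁ 0<ε) ε≤1) ≤-refl ⟩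
            1# * ε + (∣ l ∣ * ε + ∣ m ∣ * ε)  ≈⟨ solve 3 (λ e l m → :1 :* e :+ (l :* e :+ m :* e) := (:1 :+ (l :+ m)) :* e)
                                                  refl ε ∣ l ∣ ∣ m ∣ ⟩
            (1# + (∣ l ∣ + ∣ m ∣)) * ε        ∎)

  monotone-step : ∀ {a : ℕ → ℝ} → (∀ n → a n ≤ a (suc n)) → ∀ {m n} → m ℕ.≤ n → a m ≤ a n
  monotone-step {a} step {m} m≤n = go (ℕ.≤⇒≤′ m≤n)
    where
    go : ∀ {n} → m ℕ.≤′ n → a m ≤ a n
    go (ℕ.≤′-reflexive ≡.refl) = ≤-refl
    go (ℕ.≤′-step p)           = ≤-trans (go p) (step _)

  monotone-converges : ∀ {a : ℕ → ℝ} b → (∀ n → a n ≤ a (suc n)) → (∀ n → a n ≤ b) →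
    ∃[ l ] Tends a l × (∀ n → a n ≤ l)
  monotone-converges {a} b step bounded = s , tends , upper
    where
    lub = complete (λ x → ∃[ n ] x ≈ a n) (a 0 , 0 , refl)
            (b , λ { (n , x≈) → ≤-trans (≤-reflexive x≈) (bounded n) })
    s = proj₁ lub
    upper : ∀ n → a n ≤ s
    upper n = proj₁ (proj₂ lub) (n , refl)
    tends : Tends a s
    tends ε 0<ε with em {P = ∃[ N ] s - ε ≤ a N}
    ... | yes (N , s-ε≤) = N , λ n N≤n →
          ≤-from (x≤y⇒0≤y-x (≤-trans s-ε≤ (monotone-step step N≤n)))
                 (solve 3 (λ s e x → x :- (s :- e) := x :- s :- :- e) refl s ε (a n))
        , ≤-from (x≤y⇒0≤y-x (upper n) ⊕ proj₁ 0<ε)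
                 (solve 3 (λ s e x → s :- x :+ e := e :- (x :- s)) refl s ε (a n))
    ... | no none = contradiction
          (proj₂ (proj₂ lub) (s - ε) λ { (n , x≈) → ≤-trans (≤-reflexive x≈) (proj₁ (≰⇒> λ p → none (n , p))) })
          (<⇒≱ (<-from 0<ε (solve 2 (λ s e → e := s :- (s :- e)) refl s ε)))

  -- Finite sums

  ∑ : ℕ → (ℕ → ℝ) → ℝ
  ∑ n f = sum {n} (λ i → f (toℕ i))

  ∑-last : ∀ n f → ∑ (suc n) f ≈ ∑ n f + f n
  ∑-last zero    f = +-comm _ _
  ∑-last (suc n) f = trans (+-congˡ (∑-last n (f ∘ suc))) (sym (+-assoc _ _ _))

  ∑-cong : ∀ n {f g} → (∀ i → f i ≈ g i) → ∑ n f ≈ ∑ n g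
  ∑-cong zero    f≈g = refl
  ∑-cong (suc n) f≈g = +-cong (f≈g 0) (∑-cong n (f≈g ∘ suc))

  ∑-mono : ∀ n {f g} → (∀ i → f i ≤ g i) → ∑ n f ≤ ∑ n g
  ∑-mono zero    f≤g = ≤-refl
  ∑-mono (suc n) f≤g = +-mono-≤ (f≤g 0) (∑-mono n (f≤g ∘ suc))

  ∑-nonNeg : ∀ n {f} → (∀ i → 0# ≤ f i) → 0# ≤ ∑ n f
  ∑-nonNeg zero    0≤f = ≤-refl
  ∑-nonNeg (suc n) 0≤f = +-nonNeg (0≤f 0) (∑-nonNeg n (0≤f ∘ suc))

  ∑-⊑ : ∀ n {f g} → (∀ i → f i ⊑ g i) → ∑ n f ⊑ ∑ n g
  ∑-⊑ zero    f⊑g = ⊑-refl ≤-refl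
  ∑-⊑ (suc n) f⊑g = ⊑-+ (f⊑g 0) (∑-⊑ n (f⊑g ∘ suc))

  ∑-+ : ∀ n f g → ∑ n (λ i → f i + g i) ≈ ∑ n f + ∑ n g
  ∑-+ zero    f g = sym (+-identityˡ 0#)
  ∑-+ (suc n) f g = trans (+-congˡ (∑-+ n (f ∘ suc) (g ∘ suc)))
    (solve 4 (λ a b c d → a :+ b :+ (c :+ d) := a :+ c :+ (b :+ d)) refl (f 0) (g 0) (∑ n (f ∘ suc)) (∑ n (g ∘ suc)))

  ∑-*ˡ : ∀ n c f → ∑ n (λ i → c * f i) ≈ c * ∑ n f
  ∑-*ˡ n c f = sym (*-distribˡ-sum {n} c (λ i → f (toℕ i)))

  ∑-monoˡ : ∀ {f} → (∀ i → 0# ≤ f i) → ∀ {m n} → m ℕ.≤ n → ∑ m f ≤ ∑ n f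
  ∑-monoˡ {f} 0≤f = monotone-step λ n → ≤-from (0≤f n) (begin-equality
    f n                   ≈⟨ solve 2 (λ x s → x := s :+ x :- s) refl (f n) (∑ n f) ⟩
    ∑ n f + f n - ∑ n f   ≈⟨ +-congʳ (∑-last n f) ⟨
    ∑ (suc n) f - ∑ n f   ∎)

  conv : (ℕ → ℝ) → (ℕ → ℝ) → ℕ → ℝ
  conv f g n = ∑ (suc n) λ i → f i * g (n ℕ.∸ i)

  ∑-conv : ∀ n f g → ∑ (suc n) (conv f g) ≈ f 0 * ∑ (suc n) g + ∑ n (conv (f ∘ suc) g)
  ∑-conv n f g = begin-equality
    conv f g 0 + ∑ n (λ k → f 0 * g (suc k) + conv (f ∘ suc) g k)
      ≈⟨ +-cong (+-identityʳ _) (trans (∑-+ n (λ k → f 0 * g (suc k)) (conv (f ∘ suc) g))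
                                       (+-congʳ (∑-*ˡ n (f 0) (g ∘ suc)))) ⟩
    f 0 * g 0 + (f 0 * ∑ n (g ∘ suc) + ∑ n (conv (f ∘ suc) g))
      ≈⟨ solve 4 (λ a b c d → a :* b :+ (a :* c :+ d) := a :* (b :+ c) :+ d) refl
           (f 0) (g 0) (∑ n (g ∘ suc)) (∑ n (conv (f ∘ suc) g)) ⟩
    f 0 * ∑ (suc n) g + ∑ n (conv (f ∘ suc) g) ∎

  -- The part of the product of two partial sums lying outside the triangle
  -- summed by the partial sum of the Cauchy product.
  remainder : (ℕ → ℝ) → (ℕ → ℝ) → ℕ → ℝ
  remainder f g zero    = 0#
  remainder f g (suc n) = ∑ n (f ∘ suc) * g n + remainder (f ∘ suc) g n

  ∑-*-∑ : ∀ n f g → ∑ n f * ∑ n g ≈ ∑ n (conv f g) + remainder f g n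
  ∑-*-∑ zero    f g = solve 0 (:0 :* :0 := :0 :+ :0) refl
  ∑-*-∑ (suc n) f g = begin-equality
    (f 0 + F) * G₁                    ≈⟨ distribʳ _ _ _ ⟩
    f 0 * G₁ + F * G₁                 ≈⟨ +-congˡ (*-congˡ (∑-last n g)) ⟩
    f 0 * G₁ + F * (G + g n)          ≈⟨ +-congˡ (distribˡ _ _ _) ⟩
    f 0 * G₁ + (F * G + F * g n)      ≈⟨ +-congˡ (+-congʳ (∑-*-∑ n (f ∘ suc) g)) ⟩
    f 0 * G₁ + (C + r + F * g n)      ≈⟨ solve 4 (λ a c r x → a :+ (c :+ r :+ x) := a :+ c :+ (x :+ r)) refl
                                           (f 0 * G₁) C r (F * g n) ⟩
    f 0 * G₁ + C + (F * g n + r)      ≈⟨ +-congʳ (∑-conv n f g) ⟨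
    ∑ (suc n) (conv f g) + remainder f g (suc n) ∎
    where
    F = ∑ n (f ∘ suc)
    G = ∑ n g
    G₁ = ∑ (suc n) g
    C = ∑ n (conv (f ∘ suc) g)
    r = remainder (f ∘ suc) g n

  remainder-⊑ : ∀ n {f g F G} → (∀ i → f i ⊑ F i) → (∀ i → g i ⊑ G i) → remainder f g n ⊑ remainder F G n
  remainder-⊑ zero    f⊑F g⊑G = ⊑-refl ≤-refl
  remainder-⊑ (suc n) f⊑F g⊑G =
    ⊑-+ (⊑-* (∑-⊑ n (f⊑F ∘ suc)) (g⊑G n)) (remainder-⊑ n (f⊑F ∘ suc) g⊑G)

  remainder-nonNeg : ∀ n {f g} → (∀ i → 0# ≤ f i) → (∀ i → 0# ≤ g i) → 0# ≤ remainder f g n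
  remainder-nonNeg zero    0≤f 0≤g = ≤-refl
  remainder-nonNeg (suc n) 0≤f 0≤g = ∑-nonNeg n (0≤f ∘ suc) ⊛ 0≤g n ⊕ remainder-nonNeg n (0≤f ∘ suc) 0≤g

  -- The n by m rectangle of index pairs lies in the triangle of size n + m.
  ∑-*-∑-≤ : ∀ n m {f g} → (∀ i → 0# ≤ f i) → (∀ i → 0# ≤ g i) → ∑ n f * ∑ m g ≤ ∑ (n ℕ.+ m) (conv f g)
  ∑-*-∑-≤ zero    m {f} {g} 0≤f 0≤g = ≤-trans (≤-reflexive (zeroˡ _))
    (∑-nonNeg m λ k → ∑-nonNeg (suc k) λ i → *-nonNeg (0≤f i) (0≤g (k ℕ.∸ i)))
  ∑-*-∑-≤ (suc n) m {f} {g} 0≤f 0≤g = begin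
    (f 0 + ∑ n (f ∘ suc)) * ∑ m g
      ≈⟨ distribʳ _ _ _ ⟩
    f 0 * ∑ m g + ∑ n (f ∘ suc) * ∑ m g
      ≤⟨ +-mono-≤ (*-monoˡ-≤ (f 0) (0≤f 0) (∑-monoˡ 0≤g (ℕ.m≤n⇒m≤1+n (ℕ.m≤n+m m n)))) (∑-*-∑-≤ n m (0≤f ∘ suc) 0≤g) ⟩
    f 0 * ∑ (suc (n ℕ.+ m)) g + ∑ (n ℕ.+ m) (conv (f ∘ suc) g)
      ≈⟨ ∑-conv (n ℕ.+ m) f g ⟨
    ∑ (suc (n ℕ.+ m)) (conv f g) ∎

  -- The exponential series

  term : ℝ → ℕ → ℝ
  term x i = x ^ i / fromℕ (i !)

  E : ℕ → ℝ → ℝ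
  E n x = ∑ n (term x)

  0<! : ∀ n → 0# < fromℕ (n !)
  0<! n = fromℕ-pos (ℕ.1≤n! n)

  !≉0 : ∀ n → ¬ fromℕ (n !) ≈ 0#
  !≉0 n = pos⇒≉0 (0<! n)

  0≤!⁻¹ : ∀ n → 0# ≤ fromℕ (n !) ⁻¹
  0≤!⁻¹ n = proj₁ (⁻¹-pos (0<! n))

  term-nonNeg : ∀ {x} → 0# ≤ x → ∀ i → 0# ≤ term x i
  term-nonNeg 0≤x i = *-nonNeg (^-nonNeg i 0≤x) (0≤!⁻¹ i)

  ^-⊑ : ∀ {a b} n → a ⊑ b → a ^ n ⊑ b ^ n
  ^-⊑ zero    a⊑b = ⊑-refl 0≤1
  ^-⊑ (suc n) a⊑b = ⊑-* a⊑b (^-⊑ n a⊑b)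

  term-⊑ : ∀ {x y} → x ⊑ y → ∀ i → term x i ⊑ term y i
  term-⊑ x⊑y i = ⊑-* (^-⊑ i x⊑y) (⊑-refl (0≤!⁻¹ i))

  C*k!*[n∸k]!≡n! : ∀ {n k} → k ℕ.≤ n → (n choose k) ℕ.* (k ! ℕ.* (n ℕ.∸ k) !) ≡ n !
  C*k!*[n∸k]!≡n! {n} {k} k≤n rewrite nCk≡n!/k![n-k]! k≤n =
    m/n*n≡m {{ℕ._!*_!≢0 k (n ℕ.∸ k)}} (k![n∸k]!∣n! k≤n)

  term-conv : ∀ x y n → conv (term x) (term y) n ≈ term (x + y) n
  term-conv x y n = begin-equality
    conv (term x) (term y) n              ≈⟨ sum-cong-≋ {suc n} (λ i → summand (toℕ i) (ℕ.≤-pred (toℕ<n i))) ⟩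
    sum {suc n} (λ i → B i * d ⁻¹)        ≈⟨ *-distribʳ-sum {suc n} (d ⁻¹) B ⟨
    sum {suc n} B * d ⁻¹                  ≈⟨ *-congʳ (binomial-theorem n x y) ⟨
    term (x + y) n                        ∎
    where
    d = fromℕ (n !)
    B = binomialTerm x y n
    summand : ∀ k → k ℕ.≤ n → term x k * term y (n ℕ.∸ k) ≈ (n choose k) • (x ^ k * y ^ (n ℕ.∸ k)) * d ⁻¹
    summand k k≤n = begin-equality
      X * a ⁻¹ * (Y * b ⁻¹)                   ≈⟨ *-identityʳ _ ⟨
      X * a ⁻¹ * (Y * b ⁻¹) * 1#              ≈⟨ *-congˡ (⁻¹-inverseʳ d (!≉0 n)) ⟨
      X * a ⁻¹ * (Y * b ⁻¹) * (d * d ⁻¹)      ≈⟨ *-congˡ (*-congʳ d≈cab) ⟩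
      X * a ⁻¹ * (Y * b ⁻¹) * (c * (a * b) * d ⁻¹)
        ≈⟨ solve 8 (λ X Y a b a⁻¹ b⁻¹ c d⁻¹ → X :* a⁻¹ :* (Y :* b⁻¹) :* (c :* (a :* b) :* d⁻¹)
             := c :* (X :* Y) :* d⁻¹ :* (a :* a⁻¹) :* (b :* b⁻¹)) refl X Y a b (a ⁻¹) (b ⁻¹) c (d ⁻¹) ⟩
      c * (X * Y) * d ⁻¹ * (a * a ⁻¹) * (b * b ⁻¹)
        ≈⟨ *-cong (*-congˡ (⁻¹-inverseʳ a (!≉0 k))) (⁻¹-inverseʳ b (!≉0 (n ℕ.∸ k))) ⟩
      c * (X * Y) * d ⁻¹ * 1# * 1#            ≈⟨ trans (*-identityʳ _) (*-identityʳ _) ⟩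
      c * (X * Y) * d ⁻¹                      ≈⟨ *-congʳ (trans (×-assoc-* (n choose k) 1# (X * Y)) (×-congʳ (n choose k) (*-identityˡ _))) ⟩
      (n choose k) • (X * Y) * d ⁻¹                ∎
      where
      X = x ^ k
      Y = y ^ (n ℕ.∸ k)
      a = fromℕ (k !)
      b = fromℕ ((n ℕ.∸ k) !)
      c = fromℕ (n choose k)
      d≈cab : d ≈ c * (a * b)
      d≈cab = begin-equality
        d                                              ≡⟨ ≡.cong fromℕ (C*k!*[n∸k]!≡n! k≤n) ⟨
        fromℕ ((n choose k) ℕ.* (k ! ℕ.* (n ℕ.∸ k) !))      ≈⟨ fromℕ-* (n choose k) (k ! ℕ.* (n ℕ.∸ k) !) ⟩
        c * fromℕ (k ! ℕ.* (n ℕ.∸ k) !)                ≈⟨ *-congˡ (fromℕ-* (k !) ((n ℕ.∸ k) !)) ⟩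
        c * (a * b)                                    ∎

  E-* : ∀ n x y → E n x * E n y ≈ E n (x + y) + remainder (term x) (term y) n
  E-* n x y = trans (∑-*-∑ n (term x) (term y)) (+-congʳ (∑-cong n (term-conv x y)))

  E-mono : ∀ n {x y} → 0# ≤ x → x ≤ y → E n x ≤ E n y
  E-mono n 0≤x x≤y = ∑-mono n λ i → *-monoʳ-≤ _ (0≤!⁻¹ i) (^-monoˡ-≤ i 0≤x x≤y)

  E-subhom : ∀ n {x y} → 0# ≤ x → 0# ≤ y → E n (x + y) ≤ E n x * E n y
  E-subhom n {x} {y} 0≤x 0≤y = ≤-from (remainder-nonNeg n (term-nonNeg 0≤x) (term-nonNeg 0≤y))
    (begin-equality
      r                           ≈⟨ solve 2 (λ r e → r := e :+ r :- e) refl r (E n (x + y)) ⟩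
      E n (x + y) + r - E n (x + y) ≈⟨ +-congʳ (E-* n x y) ⟨
      E n x * E n y - E n (x + y) ∎)
    where r = remainder (term x) (term y) n

  term≤^ : ∀ {x} i → 0# ≤ x → term x i ≤ x ^ i
  term≤^ {x} i 0≤x = ≤-trans (*-monoˡ-≤ (x ^ i) (^-nonNeg i 0≤x) !⁻¹≤1) (≤-reflexive (*-identityʳ _))
    where
    !⁻¹≤1 : fromℕ (i !) ⁻¹ ≤ 1#
    !⁻¹≤1 = *-cancelʳ-≤ (fromℕ (i !)) (0<! i) (begin
      fromℕ (i !) ⁻¹ * fromℕ (i !) ≈⟨ ⁻¹-inverseˡ (!≉0 i) ⟩
      1#                           ≈⟨ fromℕ-1 ⟨
      fromℕ 1                      ≤⟨ fromℕ-mono-≤ (ℕ.1≤n! i) ⟩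
      fromℕ (i !)                  ≈⟨ *-identityˡ _ ⟨
      1# * fromℕ (i !)             ∎)

  -- Comparison with the geometric series, multiplied out to avoid a division; keeping the term h^n
  -- makes the induction close.
  E-geometric : ∀ n {h} → 0# ≤ h → h ≤ 1# → E n h * (1# - h) + h ^ n ≤ 1#
  E-geometric zero    {h} 0≤h h≤1 = ≤-reflexive (solve 1 (λ h → :0 :* (:1 :- h) :+ :1 := :1) refl h)
  E-geometric (suc n) {h} 0≤h h≤1 = begin
    E (suc n) h * (1# - h) + h * h ^ n            ≈⟨ +-congʳ (*-congʳ (∑-last n (term h))) ⟩
    (E n h + term h n) * (1# - h) + h * h ^ n     ≤⟨ +-mono-≤ (*-monoʳ-≤ _ (x≤y⇒0≤y-x h≤1)
                                                       (+-mono-≤ ≤-refl (term≤^ n 0≤h))) ≤-refl ⟩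
    (E n h + h ^ n) * (1# - h) + h * h ^ n        ≈⟨ solve 3 (λ e h p → (e :+ p) :* (:1 :- h) :+ h :* p := e :* (:1 :- h) :+ p)
                                                       refl (E n h) h (h ^ n) ⟩
    E n h * (1# - h) + h ^ n                      ≤⟨ E-geometric n 0≤h h≤1 ⟩
    1#                                            ∎

  E-*[1-h]≤1 : ∀ n {h} → 0# ≤ h → h ≤ 1# → E n h * (1# - h) ≤ 1#
  E-*[1-h]≤1 n {h} 0≤h h≤1 = ≤-trans (≤-from (^-nonNeg n 0≤h)
    (solve 2 (λ e p → p := e :+ p :- e) refl (E n h * (1# - h)) (h ^ n))) (E-geometric n 0≤h h≤1)

  E-½≤2 : ∀ n → E n ½ ≤ 2#
  E-½≤2 n = *-cancelʳ-≤ ½ 0<½ (begin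
    E n ½ * ½          ≈⟨ *-congˡ (solve 1 (λ h → h := h :* :2 :- h) refl ½) ⟩
    E n ½ * (½ * 2# - ½) ≈⟨ *-congˡ (+-congʳ ½*2) ⟩
    E n ½ * (1# - ½)   ≤⟨ E-*[1-h]≤1 n (proj₁ 0<½) ½≤1 ⟩
    1#                 ≈⟨ ½*2 ⟨
    ½ * 2#             ≈⟨ *-comm _ _ ⟩
    2# * ½             ∎)

  -- The geometric comparison works only below 1. Submultiplicativity of the partial sums carries
  -- the bound 2 at ½ to every multiple of ½, uniformly in n.
  E-bound : ∀ n k → E n (fromℕ k * ½) ≤ 2# * 2# ^ k
  E-bound n zero = begin
    E n (0# * ½)  ≤⟨ E-mono n (≤-reflexive (sym (zeroˡ ½))) (≤-trans (≤-reflexive (zeroˡ ½)) (proj₁ 0<½)) ⟩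
    E n ½         ≤⟨ E-½≤2 n ⟩
    2#            ≈⟨ *-identityʳ 2# ⟨
    2# * 1#       ∎
  E-bound n (suc k) = begin
    E n ((1# + fromℕ k) * ½)      ≤⟨ E-mono n (*-nonNeg (fromℕ-nonNeg (suc k)) (proj₁ 0<½))
                                       (≤-reflexive (trans (distribʳ _ _ _) (+-congʳ (*-identityˡ ½)))) ⟩
    E n (½ + fromℕ k * ½)         ≤⟨ E-subhom n (proj₁ 0<½) (*-nonNeg (fromℕ-nonNeg k) (proj₁ 0<½)) ⟩
    E n ½ * E n (fromℕ k * ½)     ≤⟨ *-mono-≤ (∑-nonNeg n (term-nonNeg (proj₁ 0<½)))
                                       (∑-nonNeg n (term-nonNeg (*-nonNeg (fromℕ-nonNeg k) (proj₁ 0<½)))) (E-½≤2 n) (E-bound n k) ⟩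
    2# * (2# * 2# ^ k)            ∎

  select-spec : ∀ {a p} {A : Set a} default (P : Pred A p) → Satisfiable P → P (select default P)
  select-spec default P (x , Px) with em {P = Satisfiable P}
  ... | yes (_ , Py) = Py
  ... | no  ¬P       = contradiction (x , Px) ¬P

  E-bounded : ∀ x → 0# ≤ x → ∃[ b ] (∀ n → E n x ≤ b)
  E-bounded x 0≤x = let k , x*2<k = archimedean (x * 2#) in
    2# * 2# ^ k , λ n → ≤-trans (E-mono n 0≤x (*-cancelʳ-≤ 2# 0<2 (begin
      x * 2#             ≤⟨ proj₁ x*2<k ⟩
      fromℕ k            ≈⟨ *-identityʳ _ ⟨
      fromℕ k * 1#       ≈⟨ *-congˡ ½*2 ⟨
      fromℕ k * (½ * 2#) ≈⟨ *-assoc _ _ _ ⟨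
      fromℕ k * ½ * 2#   ∎))) (E-bound n k)

  E-step : ∀ {x} n → 0# ≤ term x n → E n x ≤ E (suc n) x
  E-step {x} n 0≤t = ≤-trans (≤-from 0≤t (solve 2 (λ e t → t := e :+ t :- e) refl (E n x) (term x n)))
    (≤-reflexive (sym (∑-last n (term x))))

  E-converges-nonNeg : ∀ {x} → 0# ≤ x → ∃[ l ] Tends (λ n → E n x) l × (∀ n → E n x ≤ l)
  E-converges-nonNeg {x} 0≤x = let b , bounded = E-bounded x 0≤x in
    monotone-converges b (λ n → E-step n (term-nonNeg 0≤x n)) bounded

  -- The series with terms x^i/i! + |x|^i/i! has nonnegative terms.
  E-converges : ∀ x → ∃[ l ] Tends (λ n → E n x) l
  E-converges x =
    let a , t , upper = E-converges-nonNeg (0≤∣x∣ x)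
        l , s , _ = monotone-converges (a + a) step λ n →
                      +-mono-≤ (≤-trans (proj₂ (∑-⊑ n (term-⊑ (⊑∣∣ x)))) (upper n)) (upper n) in
    l - a , tends-cong (λ n → solve 2 (λ e f → e :+ f :- f := e) refl (E n x) (E n ∣ x ∣)) (tends-+ s (tends-neg t))
    where
    z = ∣ x ∣
    step : ∀ n → E n x + E n z ≤ E (suc n) x + E (suc n) z
    step n = begin
      E n x + E n z
        ≤⟨ ≤-from (x≤y⇒0≤y-x (proj₁ (term-⊑ (⊑∣∣ x) n)))
             (solve 4 (λ a b c d → b :- :- d := a :+ b :+ (c :+ d) :- (a :+ c)) refl (E n x) (term x n) (E n z) (term z n)) ⟩
      E n x + term x n + (E n z + term z n)
        ≈⟨ +-cong (∑-last n (term x)) (∑-last n (term z)) ⟨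
      E (suc n) x + E (suc n) z ∎

  -- The functional equation of the exponential, and the logarithm

  exp-tends : ∀ x → Tends (λ n → E n x) (exp x)
  exp-tends x = let l , t = E-converges x in
    ⟶⇒Tends (select-spec 0# ((λ n → E n x) ⟶_) (l , Tends⇒⟶ t))

  exp-cong : ∀ {x y} → x ≈ y → exp x ≈ exp y
  exp-cong {x} {y} x≈y = limit-unique
    (tends-cong (λ n → ∑-cong n λ i → *-congʳ {fromℕ (i !) ⁻¹} (^-congˡ i x≈y)) (exp-tends x)) (exp-tends y)

  E≤exp : ∀ {x} → 0# ≤ x → ∀ n → E n x ≤ exp x
  E≤exp {x} 0≤x n = let l , t , upper = E-converges-nonNeg 0≤x in
    ≤-trans (upper n) (≤-reflexive (limit-unique t (exp-tends x)))

  -- The remainder is dominated by the one for the absolute values, with sum s. There the product of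
  -- the n-th partial sums is at most the 2n-th partial sum at s, so the remainder is at most the
  -- difference of the 2n-th and n-th partial sums at s, which tends to 0.
  remainder-tends : ∀ x y → Tends (remainder (term x) (term y)) 0#
  remainder-tends x y ε 0<ε =
    let N , f = exp-tends s (½ * ε) (½*-pos 0<ε) in
    N , λ n N≤n → ⊑-resp (solve 1 (λ r → r := r :- :0) refl (r n))
      (⊑-≤ (remainder-⊑ n (term-⊑ (⊑∣∣ x)) (term-⊑ (⊑∣∣ y))) (begin
        r′ n                                        ≈⟨ solve 2 (λ r e → r := e :+ r :- e) refl (r′ n) (E n s) ⟩
        E n s + r′ n - E n s                        ≈⟨ +-congʳ (E-* n ∣ x ∣ ∣ y ∣) ⟨
        E n ∣ x ∣ * E n ∣ y ∣ - E n s               ≤⟨ +-monoˡ-≤ (- E n s) (≤-trans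
                                                         (∑-*-∑-≤ n n (term-nonNeg (0≤∣x∣ x)) (term-nonNeg (0≤∣x∣ y)))
                                                         (≤-reflexive (∑-cong (n ℕ.+ n) (term-conv ∣ x ∣ ∣ y ∣)))) ⟩
        E (n ℕ.+ n) s - E n s                       ≤⟨ ≤-from (x≤y⇒0≤y-x (proj₂ (f (n ℕ.+ n) (ℕ.≤-trans N≤n (ℕ.m≤m+n n n))))
                                                               ⊕ x≤y⇒0≤y-x (proj₁ (f n N≤n)))
                                                         (solve 4 (λ h a b l → (h :- (a :- l)) :+ (b :- l :- :- h) := h :+ h :- (a :- b))
                                                           refl (½ * ε) (E (n ℕ.+ n) s) (E n s) (exp s)) ⟩
        ½ * ε + ½ * ε                               ≈⟨ ½+½ ε ⟩
        ε                                           ∎))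
    where
    s = ∣ x ∣ + ∣ y ∣
    r = remainder (term x) (term y)
    r′ = remainder (term ∣ x ∣) (term ∣ y ∣)

  exp-+ : ∀ x y → exp (x + y) ≈ exp x * exp y
  exp-+ x y = trans (sym (+-identityʳ _)) (limit-unique
    (tends-cong (λ n → sym (E-* n x y)) (tends-+ (exp-tends (x + y)) (remainder-tends x y)))
    (tends-* (exp-tends x) (exp-tends y)))

  1+x≤exp : ∀ {x} → 0# ≤ x → 1# + x ≤ exp x
  1+x≤exp {x} 0≤x = ≤-trans (≤-reflexive (sym (begin-equality
    1# / fromℕ 1 + (x * 1# / fromℕ 1 + 0#) ≈⟨ solve 2 (λ x i → :1 :* i :+ (x :* :1 :* i :+ :0) := (:1 :+ x) :* i) refl x (fromℕ 1 ⁻¹) ⟩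
    (1# + x) / fromℕ 1                     ≈⟨ *-congˡ (trans (sym (*-identityˡ _)) (trans (*-congʳ (sym fromℕ-1))
                                                (⁻¹-inverseʳ (fromℕ 1) (!≉0 1)))) ⟩
    (1# + x) * 1#                          ≈⟨ *-identityʳ _ ⟩
    1# + x                                 ∎))) (E≤exp 0≤x 2)

  exp-pos-nonNeg : ∀ {x} → 0# ≤ x → 0# < exp x
  exp-pos-nonNeg {x} 0≤x = begin-strict
    0# <⟨ +-pos-nonNeg 0<1 0≤x ⟩ 1# + x ≤⟨ 1+x≤exp 0≤x ⟩ exp x ∎

  exp-0 : exp 0# ≈ 1#
  exp-0 = begin-equality
    exp 0#                      ≈⟨ solve 1 (λ e → e := :1 :* e) refl (exp 0#) ⟩
    1# * exp 0#                 ≈⟨ *-congʳ (⁻¹-inverseˡ e≉0) ⟨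
    exp 0# ⁻¹ * exp 0# * exp 0# ≈⟨ *-assoc _ _ _ ⟩
    exp 0# ⁻¹ * (exp 0# * exp 0#) ≈⟨ *-congˡ (trans (exp-cong (sym (+-identityʳ 0#))) (exp-+ 0# 0#)) ⟨
    exp 0# ⁻¹ * exp 0#          ≈⟨ ⁻¹-inverseˡ e≉0 ⟩
    1#                          ∎
    where e≉0 = pos⇒≉0 (exp-pos-nonNeg ≤-refl)

  exp-neg : ∀ x → exp x * exp (- x) ≈ 1#
  exp-neg x = trans (sym (exp-+ x (- x))) (trans (exp-cong (-‿inverseʳ x)) exp-0)

  exp-pos : ∀ x → 0# < exp x
  exp-pos x with ≤-total 0# x
  ... | inj₁ 0≤x = exp-pos-nonNeg 0≤x
  ... | inj₂ x≤0 = ≰⇒> λ exp≤0 → <⇒≱ 0<1 (begin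
    1#                 ≈⟨ exp-neg x ⟨
    exp x * exp (- x)  ≤⟨ *-monoʳ-≤ (exp (- x)) (proj₁ (exp-pos-nonNeg 0≤-x)) exp≤0 ⟩
    0# * exp (- x)     ≈⟨ zeroˡ _ ⟩
    0#                 ∎)
    where
    0≤-x : 0# ≤ - x
    0≤-x = ≤-from (x≤y⇒0≤y-x x≤0) (solve 1 (λ x → :0 :- x := :- x :- :0) refl x)

  exp-minus : ∀ x y → exp y ≈ exp x * exp (y - x)
  exp-minus x y = trans (exp-cong (solve 2 (λ x y → y := x :+ (y :- x)) refl x y)) (exp-+ x (y - x))

  exp-mono-≤ : ∀ {x y} → x ≤ y → exp x ≤ exp y
  exp-mono-≤ {x} {y} x≤y = begin
    exp x                ≈⟨ *-identityʳ _ ⟨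
    exp x * 1#           ≤⟨ *-monoˡ-≤ (exp x) (proj₁ (exp-pos x)) (≤-trans
                              (≤-from (x≤y⇒0≤y-x x≤y) (solve 1 (λ d → d := :1 :+ d :- :1) refl (y - x)))
                              (1+x≤exp (x≤y⇒0≤y-x x≤y))) ⟩
    exp x * exp (y - x)  ≈⟨ exp-minus x y ⟨
    exp y                ∎

  exp-mono-< : ∀ {x y} → x < y → exp x < exp y
  exp-mono-< {x} {y} x<y = begin-strict
    exp x                  <⟨ <-from (*-pos (exp-pos x) (x<y⇒0<y-x x<y))
                                (solve 2 (λ e d → e :* d := e :* (:1 :+ d) :- e) refl (exp x) (y - x)) ⟩
    exp x * (1# + (y - x)) ≤⟨ *-monoˡ-≤ (exp x) (proj₁ (exp-pos x)) (1+x≤exp (proj₁ (x<y⇒0<y-x x<y))) ⟩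
    exp x * exp (y - x)    ≈⟨ exp-minus x y ⟨
    exp y                  ∎

  exp-cancel-≤ : ∀ {x y} → exp x ≤ exp y → x ≤ y
  exp-cancel-≤ {x} {y} e = ≮⇒≥ λ y<x → <⇒≱ (exp-mono-< y<x) e

  -- This upper bound near 0 stands in for continuity of `exp` when `exp x ≈ y` is solved.
  exp-*[1-h]≤1 : ∀ {h} → 0# ≤ h → h ≤ 1# → exp h * (1# - h) ≤ 1#
  exp-*[1-h]≤1 {h} 0≤h h≤1 = limit-≤-const (tends-* (exp-tends h) (tends-const (1# - h))) λ n → E-*[1-h]≤1 n 0≤h h≤1

  exp-fromℕ-* : ∀ n x → exp (fromℕ n * x) ≈ exp x ^ n
  exp-fromℕ-* zero    x = trans (exp-cong (zeroˡ x)) exp-0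
  exp-fromℕ-* (suc n) x = begin-equality
    exp ((1# + fromℕ n) * x)     ≈⟨ exp-cong (solve 2 (λ x n → (:1 :+ n) :* x := x :+ n :* x) refl x (fromℕ n)) ⟩
    exp (x + fromℕ n * x)        ≈⟨ exp-+ x (fromℕ n * x) ⟩
    exp x * exp (fromℕ n * x)    ≈⟨ *-congˡ (exp-fromℕ-* n x) ⟩
    exp x * exp x ^ n            ∎

  exp-neg-cancel : ∀ {x y} → exp x ≈ y → exp (- x) ≈ y ⁻¹
  exp-neg-cancel {x} {y} e = begin-equality
    exp (- x)                  ≈⟨ *-identityʳ _ ⟨
    exp (- x) * 1#             ≈⟨ *-congˡ (⁻¹-inverseʳ y y≉0) ⟨
    exp (- x) * (y * y ⁻¹)     ≈⟨ *-congˡ (*-congʳ e) ⟨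
    exp (- x) * (exp x * y ⁻¹) ≈⟨ solve 3 (λ a b c → a :* (b :* c) := b :* a :* c) refl (exp (- x)) (exp x) (y ⁻¹) ⟩
    exp x * exp (- x) * y ⁻¹   ≈⟨ *-congʳ (exp-neg x) ⟩
    1# * y ⁻¹                  ≈⟨ *-identityˡ _ ⟩
    y ⁻¹                       ∎
    where
    y≉0 : ¬ y ≈ 0#
    y≉0 y≈0 = pos⇒≉0 (exp-pos x) (trans e y≈0)

  -- Since 1 - h ≤ exp (- h) and exp h ≤ 1 / (1 - h), a value of exp other than y
  -- at the supremum of { x | exp x ≤ y } could be improved by h = 1 - u / v,
  -- where {u , v} = {y , exp s}.
  exp-surjective : ∀ {y} → 0# < y → ∃[ x ] exp x ≈ y
  exp-surjective {y} 0<y = s , antisym (≮⇒≥ not-above) (≮⇒≥ not-below)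
    where
    y≉0 = pos⇒≉0 0<y
    0<y⁻¹ = ⁻¹-pos 0<y
    below : exp (- (y ⁻¹)) ≤ y
    below = *-cancelʳ-≤ (exp (y ⁻¹)) (exp-pos _) (begin
      exp (- (y ⁻¹)) * exp (y ⁻¹) ≈⟨ trans (*-comm _ _) (exp-neg (y ⁻¹)) ⟩
      1#                          ≈⟨ ⁻¹-inverseʳ y y≉0 ⟨
      y * y ⁻¹                    ≤⟨ *-monoˡ-≤ y (proj₁ 0<y) (≤-trans
                                       (≤-from 0≤1 (solve 1 (λ i → :1 := :1 :+ i :- i) refl (y ⁻¹))) (1+x≤exp (proj₁ 0<y⁻¹))) ⟩
      y * exp (y ⁻¹)              ∎)
    upper : ∀ {x} → exp x ≤ y → x ≤ y
    upper {x} e = exp-cancel-≤ (≤-trans e (≤-trans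
      (≤-from 0≤1 (solve 1 (λ y → :1 := :1 :+ y :- y) refl y)) (1+x≤exp (proj₁ 0<y))))
    lub = complete (λ x → exp x ≤ y) (- (y ⁻¹) , below) (y , upper)
    s = proj₁ lub
    0<e = exp-pos s
    e≉0 = pos⇒≉0 0<e
    0≤1-[1-z] : ∀ {z} → 0# ≤ z → 1# - z ≤ 1#
    0≤1-[1-z] {z} 0≤z = ≤-from 0≤z (solve 1 (λ z → z := :1 :- (:1 :- z)) refl z)
    /<1 : ∀ {u v} → 0# < v → u < v → 0# < 1# - u / v
    /<1 {u} {v} 0<v u<v = <-respʳ (begin-equality
      (v - u) * v ⁻¹       ≈⟨ solve 3 (λ u v i → (v :- u) :* i := v :* i :- u :* i) refl u v (v ⁻¹) ⟩
      v * v ⁻¹ - u * v ⁻¹  ≈⟨ +-congʳ (⁻¹-inverseʳ v (pos⇒≉0 0<v)) ⟩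
      1# - u / v           ∎) (*-pos (x<y⇒0<y-x u<v) (⁻¹-pos 0<v))
    not-below : ¬ exp s < y
    not-below e<y = <⇒≱ (<-from 0<h (solve 2 (λ s h → h := s :+ h :- s) refl s h)) (proj₁ (proj₂ lub) (begin
      exp (s + h)           ≈⟨ exp-+ s h ⟩
      exp s * exp h         ≈⟨ *-congʳ (*/-cancel y y≉0) ⟨
      q * y * exp h         ≈⟨ solve 3 (λ q y h → q :* y :* h := y :* (h :* (:1 :- (:1 :- q)))) refl q y (exp h) ⟩
      y * (exp h * (1# - h)) ≤⟨ *-monoˡ-≤ y (proj₁ 0<y) (exp-*[1-h]≤1 (proj₁ 0<h)
                                  (0≤1-[1-z] (*-nonNeg (proj₁ 0<e) (proj₁ 0<y⁻¹)))) ⟩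
      y * 1#                ≈⟨ *-identityʳ y ⟩
      y                     ∎))
      where
      q = exp s / y
      h = 1# - q
      0<h = /<1 0<y e<y
    not-above : ¬ y < exp s
    not-above y<e = <⇒≱ (<-from 0<h (solve 2 (λ s h → h := s :- (s :- h)) refl s h))
      (proj₂ (proj₂ lub) (s - h) λ {x} ex≤y → exp-cancel-≤ (≤-trans ex≤y y≤))
      where
      q = y / exp s
      h = 1# - q
      0<h = /<1 0<e y<e
      y≤ : y ≤ exp (s - h)
      y≤ = *-cancelʳ-≤ (exp h) (exp-pos h) (begin
        y * exp h                  ≈⟨ *-congʳ (*/-cancel (exp s) e≉0) ⟨
        q * exp s * exp h          ≈⟨ solve 3 (λ q s h → q :* s :* h := s :* (h :* (:1 :- (:1 :- q)))) refl q (exp s) (exp h) ⟩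
        exp s * (exp h * (1# - h)) ≤⟨ *-monoˡ-≤ (exp s) (proj₁ 0<e) (exp-*[1-h]≤1 (proj₁ 0<h)
                                        (0≤1-[1-z] (*-nonNeg (proj₁ 0<y) (proj₁ (⁻¹-pos 0<e))))) ⟩
        exp s * 1#                 ≈⟨ *-identityʳ _ ⟩
        exp s                      ≈⟨ exp-cong (solve 2 (λ s h → s := s :- h :+ h) refl s h) ⟩
        exp (s - h + h)            ≈⟨ exp-+ (s - h) h ⟩
        exp (s - h) * exp h        ∎)

  exp-log : ∀ {y} → 0# < y → exp (log y) ≈ y
  exp-log {y} 0<y = select-spec 0# (λ x → exp x ≈ y) (exp-surjective 0<y)

  log-pos : ∀ {y} → 1# < y → 0# < log y
  log-pos {y} 1<y = ≰⇒> λ l≤0 → <⇒≱ 1<y (begin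
    y           ≈⟨ exp-log (begin-strict 0# <⟨ 0<1 ⟩ 1# <⟨ 1<y ⟩ y ∎) ⟨
    exp (log y) ≤⟨ exp-mono-≤ l≤0 ⟩
    exp 0#      ≈⟨ exp-0 ⟩
    1#          ∎)

  ^ʳ-pos : ∀ {x} s → 0# < x → x ^ʳ s ≡ exp (s * log x)
  ^ʳ-pos {x} s 0<x with em {P = 0# < x}
  ... | yes _   = ≡.refl
  ... | no  0≮x = contradiction 0<x 0≮x

  -- Suprema and infima in [0,∞]

  ≤⁺-trans : ∀ {x y z} → x ≤⁺ y → y ≤⁺ z → x ≤⁺ z
  ≤⁺-trans = NonStrict⁺.≤⁺-trans _≤_ ≤-trans

  ≤⁺-total : ∀ x y → x ≤⁺ y ⊎ y ≤⁺ x
  ≤⁺-total = NonStrict⁺.≤⁺-total _≤_ (≤-total)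

  [≤]-injective : ∀ {x y} → [ x ] ≤⁺ [ y ] → x ≤ y
  [≤]-injective [ x≤y ] = x≤y

  -- `True em` brings a proposition at any level down to the level 0 demanded by
  -- completeness.
  sup-exists : ∀ {i} {I : Set i} (f : I → ℝ ⁺) → ∃[ s ] IsSup f s
  sup-exists {i} {I} f with em {P = ∃[ b ] (∀ i → f i ≤⁺ [ b ])}
  ... | no unbounded = ⊤⁺ , (_ ≤⊤⁺) , (λ i → _ ≤⊤⁺) ,
        λ { ⊤⁺ _ _ → _ ≤⊤⁺ ; [ t ] _ f≤t → contradiction (t , f≤t) unbounded }
  ... | yes (b , f≤b) = [ s ] , [ 0≤s ] , f≤s , least
    where
    -- Adjoining 0 makes the set nonempty and its supremum nonnegative, and gives 0 for an empty
    -- family.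
    Value : ℝ → Set i
    Value x = x ≈ 0# ⊎ ∃[ i ] f i ≡ [ x ]
    value≤ : ∀ {t} → 0# ≤ t → (∀ i → f i ≤⁺ [ t ]) → ∀ {x} → Value x → x ≤ t
    value≤ 0≤t f≤t (inj₁ x≈0)       = ≤-trans (≤-reflexive x≈0) 0≤t
    value≤ 0≤t f≤t (inj₂ (i , fi≡)) = [≤]-injective (≡.subst (_≤⁺ _) fi≡ (f≤t i))
    -- `b` itself may be negative and then would not bound the adjoined 0.
    bound : ℝ
    bound = ∣ b ∣
    lub = complete (λ x → True (em {P = Value x})) (0# , fromWitness (inj₁ refl))
      (bound , λ v → value≤ (0≤∣x∣ b) (λ i → ≤⁺-trans (f≤b i) [ x≤∣x∣ b ]) (toWitness v))
    s = proj₁ lub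
    0≤s : 0# ≤ s
    0≤s = proj₁ (proj₂ lub) (fromWitness (inj₁ refl))
    f≤s : ∀ i → f i ≤⁺ [ s ]
    f≤s i with f i in fi≡ | f≤b i
    ... | [ x ] | _ = [ proj₁ (proj₂ lub) (fromWitness (inj₂ (i , fi≡))) ]
    least : ∀ t → [ 0# ] ≤⁺ t → (∀ i → f i ≤⁺ t) → [ s ] ≤⁺ t
    least ⊤⁺    _       _   = _ ≤⊤⁺
    least [ t ] [ 0≤t ] f≤t = [ proj₂ (proj₂ lub) t (λ v → value≤ 0≤t f≤t (toWitness v)) ]

  sup-spec : ∀ {i} {I : Set i} (f : I → ℝ ⁺) → IsSup f (sup f)
  sup-spec f = select-spec ⊤⁺ (IsSup f) (sup-exists f)

  -- Completeness supplies suprema only, so the infimum is the supremum of the nonnegative lower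
  -- bounds. A finite value of `f` bounds that set; without one the infimum is ∞.
  inf-exists : ∀ {i} {I : Set i} (f : I → ℝ ⁺) → (∀ i → [ 0# ] ≤⁺ f i) → ∃[ s ] IsInf f s
  inf-exists {i} {I} f 0≤f with em {P = ∃[ i ] ∃[ x ] f i ≡ [ x ]}
  ... | no infinite = ⊤⁺ , (_ ≤⊤⁺) , ⊤≤f , λ _ _ _ → _ ≤⊤⁺
    where
    ⊤≤f : ∀ i → ⊤⁺ ≤⁺ f i
    ⊤≤f i with f i in fi≡
    ... | ⊤⁺    = _ ≤⊤⁺
    ... | [ x ] = contradiction (i , x , fi≡) infinite
  ... | yes (i₀ , x₀ , fi₀≡) = [ s ] , [ 0≤s ] , s≤f , greatest
    where
    Lower : ℝ → Set i
    Lower y = 0# ≤ y × (∀ i → [ y ] ≤⁺ f i)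
    lower≤ : ∀ {i x} → f i ≡ [ x ] → ∀ {y} → Lower y → y ≤ x
    lower≤ {i} fi≡ (_ , y≤f) = [≤]-injective (≡.subst (_ ≤⁺_) fi≡ (y≤f i))
    lub = complete (λ y → True (em {P = Lower y})) (0# , fromWitness (≤-refl , 0≤f))
      (x₀ , λ l → lower≤ fi₀≡ (toWitness l))
    s = proj₁ lub
    0≤s : 0# ≤ s
    0≤s = proj₁ (proj₂ lub) (fromWitness (≤-refl , 0≤f))
    s≤f : ∀ i → [ s ] ≤⁺ f i
    s≤f i with f i in fi≡
    ... | ⊤⁺    = _ ≤⊤⁺
    ... | [ x ] = [ proj₂ (proj₂ lub) x (λ l → lower≤ fi≡ (toWitness l)) ]
    greatest : ∀ t → [ 0# ] ≤⁺ t → (∀ i → t ≤⁺ f i) → t ≤⁺ [ s ]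
    greatest ⊤⁺    _       t≤f = contradiction (≡.subst (⊤⁺ ≤⁺_) fi₀≡ (t≤f i₀)) λ ()
    greatest [ t ] [ 0≤t ] t≤f = [ proj₁ (proj₂ lub) (fromWitness (0≤t , t≤f)) ]

  inf-spec : ∀ {i} {I : Set i} (f : I → ℝ ⁺) → (∀ i → [ 0# ] ≤⁺ f i) → IsInf f (inf f)
  inf-spec f 0≤f = select-spec ⊤⁺ (IsInf f) (inf-exists f 0≤f)

  -- Hausdorff measure

  ≤-dim : ∀ {b A} → 0# ≤ b → (∀ s → 0# < s → hausdorffMeasure s A ≈⁺ [ 0# ] → b ≤ s) → [ b ] ≤⁺ dim A
  ≤-dim {b} 0≤b h = proj₂ (proj₂ (inf-spec _ λ { (s , 0<s , _) → [ proj₁ 0<s ] })) [ b ] [ 0≤b ]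
    λ { (s , 0<s , null) → [ h s 0<s null ] }

  partial⁺ : (ℕ → ℝ ⁺) → ℕ → ℝ ⁺
  partial⁺ a n = foldr _+⁺_ [ 0# ] {n} (λ i → a (toℕ i))

  partial⁺-finite : ∀ n {a r} → (∀ i → a i ≡ [ r i ]) → partial⁺ a n ≡ [ ∑ n r ]
  partial⁺-finite zero    a≡r = ≡.refl
  partial⁺-finite (suc n) a≡r = ≡.cong₂ _+⁺_ (a≡r 0) (partial⁺-finite n (a≡r ∘ suc))

  finite : ∀ {z δ} → z ≤⁺ [ δ ] → ∃[ r ] z ≡ [ r ] × r ≤ δ
  finite [ r≤δ ] = _ , ≡.refl , r≤δ

  -- A cover whose diameters are controlled by real numbers, so that the combinatorial argument
  -- never meets ∞.
  record CoverBy (A : Pred ℝ 0ℓ) (d : ℕ → ℝ) : Set₁ where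
    field
      U       : ℕ → Pred ℝ 0ℓ
      covers  : ∀ {x} → A x → ∃[ i ] U i x
      within  : ∀ i {x y} → U i x → U i y → ∣ x - y ∣ ≤ d i

  -- Measure 0 forces the premeasure at each δ to be 0. If every cover cost at least ε, then ε would
  -- be a lower bound and hence at most that infimum. Diameters at most δ are finite, which allows
  -- the passage to real numbers.
  null⇒small-cover : ∀ {s A} → hausdorffMeasure s A ≈⁺ [ 0# ] → ∀ {δ ε} → 0# < δ → 0# < ε →
    ∃[ d ] CoverBy A d × (∀ i → 0# ≤ d i × d i ≤ δ) × (∀ n → ∑ n (λ i → d i ^ʳ s) ≤ ε)
  null⇒small-cover {s} {A} null {δ} {ε} 0<δ 0<ε =
    d , record
      { U      = U
      ; covers = Cover.covers C
      ; within = λ i {x} {y} Ux Uy → [≤]-injective (≡.subst (_ ≤⁺_) (diam≡ i) (proj₁ (proj₂ (sup-spec _)) ((x , Ux) , (y , Uy)))) }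
    , (λ i → [≤]-injective (≡.subst ([ 0# ] ≤⁺_) (diam≡ i) (proj₁ (sup-spec _))) , proj₂ (proj₂ (diam-finite i)))
    , λ n → [≤]-injective (≡.subst (_≤⁺ [ ε ]) (partial⁺-finite n λ i → ≡.cong (_^⁺ s) (diam≡ i))
              (≤⁺-trans (proj₁ (proj₂ (sup-spec (partial⁺ λ i → diam (U i) ^⁺ s))) n) small))
    where
    cost : Cover δ A → ℝ ⁺
    cost C = series λ i → diam (Cover.U C i) ^⁺ s
    premeasure≤0 : hausdorffPremeasure s δ A ≤⁺ [ 0# ]
    premeasure≤0 = ≤⁺-trans (proj₁ (proj₂ (sup-spec _)) (δ , 0<δ)) (NonStrict⁺.≤⁺-reflexive _≤_ ≤-reflexive null)
    cheap : ∃[ C ] cost C ≤⁺ [ ε ]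
    cheap with em {P = ∃[ C ] cost C ≤⁺ [ ε ]}
    ... | yes p = p
    ... | no ¬p = contradiction ([≤]-injective (≤⁺-trans
          (proj₂ (proj₂ (inf-spec cost λ C → proj₁ (sup-spec _))) [ ε ] [ proj₁ 0<ε ] ε≤cost) premeasure≤0)) (<⇒≱ 0<ε)
      where
      ε≤cost : ∀ C → [ ε ] ≤⁺ cost C
      ε≤cost C with ≤⁺-total [ ε ] (cost C)
      ... | inj₁ p = p
      ... | inj₂ p = contradiction (C , p) ¬p
    C = proj₁ cheap
    small = proj₂ cheap
    U = Cover.U C
    diam-finite : ∀ i → ∃[ r ] diam (U i) ≡ [ r ] × r ≤ δ
    diam-finite i = finite (Cover.small C i)
    d : ℕ → ℝ
    d i = proj₁ (diam-finite i)
    diam≡ : ∀ i → diam (U i) ≡ [ d i ]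
    diam≡ i = proj₁ (proj₂ (diam-finite i))

  -- Points of the Cantor set

  tail : (ℕ → Bool) → ℕ → Bool
  tail a = a ∘ suc

  shift : ℕ → (ℕ → Bool) → ℕ → Bool
  shift n a i = a (n ℕ.+ i)

  digit : Bool → ℝ
  digit false = 0#
  digit true  = 2#

  ⅓ : ℝ
  ⅓ = 3# ⁻¹

  ⅓*3 : ⅓ * 3# ≈ 1#
  ⅓*3 = ⁻¹-inverseˡ (pos⇒≉0 0<3)

  0<⅓ : 0# < ⅓
  0<⅓ = ⁻¹-pos 0<3

  1≤3 : 1# ≤ 3#
  1≤3 = ≤-from (proj₁ 0<2) (solve 0 (:1 :+ :1 := :1 :+ :1 :+ :1 :- :1) refl)

  digit-nonNeg : ∀ b → 0# ≤ digit b
  digit-nonNeg false = ≤-refl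
  digit-nonNeg true  = proj₁ 0<2

  digit≤2 : ∀ b → digit b ≤ 2#
  digit≤2 false = proj₁ 0<2
  digit≤2 true  = ≤-refl

  -- Horner form with the leading digit outermost: recursion then follows the tail of the sequence,
  -- as `preCantor` follows the expanding maps.
  partialVal : ℕ → (ℕ → Bool) → ℝ
  partialVal zero    a = 0#
  partialVal (suc n) a = ⅓ * (digit (a 0) + partialVal n (tail a))

  partialVal≤1 : ∀ n a → partialVal n a ≤ 1#
  partialVal≤1 zero    a = 0≤1
  partialVal≤1 (suc n) a = begin
    ⅓ * (digit (a 0) + partialVal n (tail a)) ≤⟨ *-monoˡ-≤ ⅓ (proj₁ 0<⅓) (+-mono-≤ (digit≤2 (a 0)) (partialVal≤1 n (tail a))) ⟩
    ⅓ * 3#                                    ≈⟨ ⅓*3 ⟩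
    1#                                        ∎

  val-lub : ∀ a → ∃[ s ] UpperBound (λ x → ∃[ n ] x ≈ partialVal n a) s ×
                         (∀ b → UpperBound (λ x → ∃[ n ] x ≈ partialVal n a) b → s ≤ b)
  val-lub a = complete _ (0# , 0 , refl) (1# , λ { (n , x≈) → ≤-trans (≤-reflexive x≈) (partialVal≤1 n a) })

  val : (ℕ → Bool) → ℝ
  val a = proj₁ (val-lub a)

  partialVal≤val : ∀ n a → partialVal n a ≤ val a
  partialVal≤val n a = proj₁ (proj₂ (val-lub a)) (n , refl)

  val-least : ∀ {b} a → (∀ n → partialVal n a ≤ b) → val a ≤ b
  val-least a bound = proj₂ (proj₂ (val-lub a)) _ λ { (n , x≈) → ≤-trans (≤-reflexive x≈) (bound n) }

  val-nonNeg : ∀ a → 0# ≤ val a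
  val-nonNeg = partialVal≤val 0

  val≤1 : ∀ a → val a ≤ 1#
  val≤1 a = val-least a λ n → partialVal≤1 n a

  3*⅓* : ∀ x → 3# * (⅓ * x) ≈ x
  3*⅓* x = begin-equality
    3# * (⅓ * x) ≈⟨ solve 3 (λ t x y → t :* (y :* x) := y :* t :* x) refl 3# x ⅓ ⟩
    ⅓ * 3# * x   ≈⟨ *-congʳ ⅓*3 ⟩
    1# * x       ≈⟨ *-identityˡ x ⟩
    x            ∎

  -- The self-similarity of the Cantor set. From here on `val` is used only through this equation
  -- and the bounds 0 and 1.
  val-step : ∀ a → 3# * val a ≈ digit (a 0) + val (tail a)
  val-step a = antisym
    (≤-trans (*-monoˡ-≤ 3# (proj₁ 0<3) (val-least a upper)) (≤-reflexive (3*⅓* (digit (a 0) + val (tail a)))))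
    (≤-from (x≤y⇒0≤y-x (val-least {3# * val a - digit (a 0)} (tail a) λ n → tail≤ n))
      (solve 3 (λ t d v → t :- d :- v := t :- (d :+ v)) refl (3# * val a) (digit (a 0)) (val (tail a))))
    where
    upper : ∀ n → partialVal n a ≤ ⅓ * (digit (a 0) + val (tail a))
    upper zero    = *-nonNeg (proj₁ 0<⅓) (+-nonNeg (digit-nonNeg (a 0)) (val-nonNeg (tail a)))
    upper (suc n) = *-monoˡ-≤ ⅓ (proj₁ 0<⅓) (+-mono-≤ ≤-refl (partialVal≤val n (tail a)))
    tail≤ : ∀ n → partialVal n (tail a) ≤ 3# * val a - digit (a 0)
    tail≤ n = ≤-from (x≤y⇒0≤y-x (≤-trans (≤-reflexive (sym (3*⅓* (digit (a 0) + partialVal n (tail a)))))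
                                   (*-monoˡ-≤ 3# (proj₁ 0<3) (partialVal≤val (suc n) a))))
      (solve 3 (λ t d p → t :- (d :+ p) := t :- d :- p) refl (3# * val a) (digit (a 0)) (partialVal n (tail a)))

  preCantor-resp : ∀ n {x y} → x ≈ y → preCantor n x → preCantor n y
  preCantor-resp zero    x≈y (0≤x , x≤1) = 0≤-resp x≈y 0≤x , ≤-trans (≤-reflexive (sym x≈y)) x≤1
  preCantor-resp (suc n) x≈y (inj₁ p) = inj₁ (preCantor-resp n (*-congˡ x≈y) p)
  preCantor-resp (suc n) x≈y (inj₂ p) = inj₂ (preCantor-resp n (+-congʳ (*-congˡ x≈y)) p)

  val∈K : ∀ a → K (val a)
  val∈K a zero    = val-nonNeg a , val≤1 a
  val∈K a (suc n) with a 0 in eq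
  ... | false = inj₁ (preCantor-resp n (sym (begin-equality
    fromℕ 3 * val a             ≈⟨ *-congʳ fromℕ-3 ⟩
    3# * val a                  ≈⟨ val-step a ⟩
    digit (a 0) + val (tail a)  ≡⟨ ≡.cong (λ b → digit b + val (tail a)) eq ⟩
    0# + val (tail a)           ≈⟨ +-identityˡ _ ⟩
    val (tail a)                ∎)) (val∈K (tail a) n))
  ... | true  = inj₂ (preCantor-resp n (sym (begin-equality
    fromℕ 3 * val a - fromℕ 2        ≈⟨ +-cong (*-congʳ fromℕ-3) (-‿cong fromℕ-2) ⟩
    3# * val a - 2#                  ≈⟨ +-congʳ (val-step a) ⟩
    digit (a 0) + val (tail a) - 2#  ≡⟨ ≡.cong (λ b → digit b + val (tail a) - 2#) eq ⟩
    2# + val (tail a) - 2#           ≈⟨ solve 1 (λ v → :2 :+ v :- :2 := v) refl (val (tail a)) ⟩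
    val (tail a)                     ∎)) (val∈K (tail a) n))

  -- The first n ternary digits of val a, read as an integer.
  prefix : ℕ → (ℕ → Bool) → ℕ
  prefix zero    a = 0
  prefix (suc n) a = (if a 0 then 2 ℕ.* 3 ℕ.^ n else 0) ℕ.+ prefix n (tail a)

  3#^ : ∀ n → fromℕ (3 ℕ.^ n) ≈ 3# ^ n
  3#^ n = trans (fromℕ-^ 3 n) (^-congˡ n fromℕ-3)

  prefix-spec : ∀ n a → 3# ^ n * val a ≈ fromℕ (prefix n a) + val (shift n a)
  prefix-spec zero    a = trans (*-identityˡ _) (sym (+-identityˡ _))
  prefix-spec (suc n) a = begin-equality
    3# * 3# ^ n * val a                                      ≈⟨ solve 3 (λ t p v → t :* p :* v := p :* (t :* v)) refl 3# (3# ^ n) (val a) ⟩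
    3# ^ n * (3# * val a)                                    ≈⟨ *-congˡ (val-step a) ⟩
    3# ^ n * (digit (a 0) + val (tail a))                    ≈⟨ distribˡ _ _ _ ⟩
    3# ^ n * digit (a 0) + 3# ^ n * val (tail a)             ≈⟨ +-cong (sym (leading (a 0))) (prefix-spec n (tail a)) ⟩
    fromℕ d + (fromℕ (prefix n (tail a)) + val (shift (suc n) a)) ≈⟨ +-assoc _ _ _ ⟨
    fromℕ d + fromℕ (prefix n (tail a)) + val (shift (suc n) a)  ≈⟨ +-congʳ (fromℕ-+ d (prefix n (tail a))) ⟨
    fromℕ (prefix (suc n) a) + val (shift (suc n) a)         ∎
    where
    lead : Bool → ℕ
    lead b = if b then 2 ℕ.* 3 ℕ.^ n else 0
    d = lead (a 0)
    leading : ∀ b → fromℕ (lead b) ≈ 3# ^ n * digit b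
    leading false = sym (zeroʳ _)
    leading true  = trans (fromℕ-* 2 (3 ℕ.^ n)) (trans (*-cong fromℕ-2 (3#^ n)) (*-comm _ _))

  val-zeros : ∀ z a → (∀ i → i ℕ.< z → a i ≡ false) → 3# ^ z * val a ≈ val (shift z a)
  val-zeros zero    a zeros = *-identityˡ _
  val-zeros (suc z) a zeros = begin-equality
    3# * 3# ^ z * val a                    ≈⟨ solve 3 (λ t p v → t :* p :* v := p :* (t :* v)) refl 3# (3# ^ z) (val a) ⟩
    3# ^ z * (3# * val a)                  ≈⟨ *-congˡ (val-step a) ⟩
    3# ^ z * (digit (a 0) + val (tail a))  ≡⟨ ≡.cong (λ b → 3# ^ z * (digit b + val (tail a))) (zeros 0 (s≤s z≤n)) ⟩
    3# ^ z * (0# + val (tail a))           ≈⟨ *-congˡ (+-identityˡ _) ⟩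
    3# ^ z * val (tail a)                  ≈⟨ val-zeros z (tail a) (λ i i<z → zeros (suc i) (s≤s i<z)) ⟩
    val (shift (suc z) a)                  ∎

  2≤3*val : ∀ a → a 0 ≡ true → 2# ≤ 3# * val a
  2≤3*val a a₀ = begin
    2#                          ≤⟨ ≤-from (val-nonNeg (tail a)) (solve 1 (λ v → v := :2 :+ v :- :2) refl (val (tail a))) ⟩
    2# + val (tail a)           ≡⟨ ≡.cong (λ b → digit b + val (tail a)) a₀ ⟨
    digit (a 0) + val (tail a)  ≈⟨ val-step a ⟨
    3# * val a                  ∎

  -- At the first difference the digits differ by 2, and the remaining tails can take back at most 1
  -- of this. This is where the absence of the digit 1 counts.
  val-gap : ∀ n a b → (∀ i → i ℕ.< n → a i ≡ b i) → a n ≡ true → b n ≡ false →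
    1# ≤ 3# ^ suc n * (val a - val b)
  val-gap zero a b _ a₀ b₀ = begin
    1#                                           ≤⟨ ≤-from (val-nonNeg (tail a) ⊕ x≤y⇒0≤y-x (val≤1 (tail b)))
                                                      (solve 2 (λ v w → v :+ (:1 :- w) := :2 :+ v :- (:0 :+ w) :- :1) refl (val (tail a)) (val (tail b))) ⟩
    2# + val (tail a) - (0# + val (tail b))      ≡⟨ ≡.cong₂ (λ c d → digit c + val (tail a) - (digit d + val (tail b))) a₀ b₀ ⟨
    digit (a 0) + val (tail a) - (digit (b 0) + val (tail b)) ≈⟨ +-cong (val-step a) (-‿cong (val-step b)) ⟨
    3# * val a - 3# * val b                      ≈⟨ solve 3 (λ t v w → t :* v :- t :* w := t :* :1 :* (v :- w)) refl 3# (val a) (val b) ⟩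
    3# * 1# * (val a - val b)                    ∎
  val-gap (suc n) a b a≡b aₙ bₙ = begin
    1#                                                  ≤⟨ val-gap n (tail a) (tail b) (λ i i<n → a≡b (suc i) (s≤s i<n)) aₙ bₙ ⟩
    3# * 3# ^ n * (val (tail a) - val (tail b))         ≈⟨ solve 4 (λ p v w d → p :* (v :- w) := p :* (d :+ v :- (d :+ w))) refl
                                                             (3# ^ suc n) (val (tail a)) (val (tail b)) (digit (a 0)) ⟩
    3# ^ suc n * (digit (a 0) + val (tail a) - (digit (a 0) + val (tail b)))
      ≡⟨ ≡.cong (λ c → 3# ^ suc n * (digit (a 0) + val (tail a) - (digit c + val (tail b)))) (a≡b 0 (s≤s z≤n)) ⟩
    3# ^ suc n * (digit (a 0) + val (tail a) - (digit (b 0) + val (tail b)))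
      ≈⟨ *-congˡ (+-cong (val-step a) (-‿cong (val-step b))) ⟨
    3# ^ suc n * (3# * val a - 3# * val b)              ≈⟨ solve 4 (λ t p v w → p :* (t :* v :- t :* w) := t :* p :* (v :- w)) refl
                                                             3# (3# ^ suc n) (val a) (val b) ⟩
    3# * 3# ^ suc n * (val a - val b)                   ∎

  ∣-∣-comm-≤ : ∀ x y → y - x ≤ ∣ x - y ∣
  ∣-∣-comm-≤ x y = ≤-trans (≤-reflexive (solve 2 (λ x y → y :- x := :- (x :- y)) refl x y)) (-x≤∣x∣ (x - y))

  0≤3^ : ∀ n → 0# ≤ 3# ^ n
  0≤3^ n = ^-nonNeg n (proj₁ 0<3)

  -- Induction on n: once all earlier digits agree, a disagreement in the last one would be the
  -- first and would separate the values by the full gap.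
  close⇒agree : ∀ n a b → 3# ^ n * ∣ val a - val b ∣ < 1# → ∀ i → i ℕ.< n → a i ≡ b i
  close⇒agree (suc n) a b close i i<1+n with ℕ.m≤n⇒m<n∨m≡n (ℕ.≤-pred i<1+n)
  ... | inj₁ i<n = close⇒agree n a b (begin-strict
          3# ^ n * ∣ val a - val b ∣      ≤⟨ *-monoʳ-≤ _ (0≤∣x∣ _) (^-monoʳ-≤ 1≤3 (ℕ.n≤1+n n)) ⟩
          3# ^ suc n * ∣ val a - val b ∣  <⟨ close ⟩
          1#                              ∎) i i<n
  ... | inj₂ ≡.refl = agree-at (a n) (b n) ≡.refl ≡.refl
    where
    agree : ∀ j → j ℕ.< n → a j ≡ b j
    agree = close⇒agree n a b (begin-strict
          3# ^ n * ∣ val a - val b ∣      ≤⟨ *-monoʳ-≤ _ (0≤∣x∣ _) (^-monoʳ-≤ 1≤3 (ℕ.n≤1+n n)) ⟩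
          3# ^ suc n * ∣ val a - val b ∣  <⟨ close ⟩
          1#                              ∎)
    agree-at : ∀ c d → a n ≡ c → b n ≡ d → a n ≡ b n
    agree-at false false p q = ≡.trans p (≡.sym q)
    agree-at true  true  p q = ≡.trans p (≡.sym q)
    agree-at true  false p q = contradiction (≤-trans (val-gap n a b agree p q)
      (*-monoˡ-≤ (3# ^ suc n) (0≤3^ (suc n)) (x≤∣x∣ (val a - val b)))) (<⇒≱ close)
    agree-at false true  p q = contradiction (≤-trans (val-gap n b a (λ j j<n → ≡.sym (agree j j<n)) q p)
      (*-monoˡ-≤ (3# ^ suc n) (0≤3^ (suc n)) (∣-∣-comm-≤ (val a) (val b)))) (<⇒≱ close)

  -- Integers in the reals and powers of 3

  fromℕ≈⟦⟧ : ∀ n → fromℕ n ≈ ⟦ + n ⟧ℤ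
  fromℕ≈⟦⟧ n = Mult′.×ᵤ≈× semiring n 1#

  -- Carries the homomorphism laws of the solver's coefficient map over to `fromℤ`.
  fromℤ≈⟦⟧ : ∀ i → fromℤ i ≈ ⟦ i ⟧ℤ
  fromℤ≈⟦⟧ (+ n)      = fromℕ≈⟦⟧ n
  fromℤ≈⟦⟧ (-[1+ n ]) = -‿cong (fromℕ≈⟦⟧ (suc n))

  fromℤ-+ : ∀ i j → fromℤ (i ℤ.+ j) ≈ fromℤ i + fromℤ j
  fromℤ-+ i j = trans (fromℤ≈⟦⟧ (i ℤ.+ j)) (trans (⟦⟧-+ i j) (sym (+-cong (fromℤ≈⟦⟧ i) (fromℤ≈⟦⟧ j))))

  fromℤ-* : ∀ i j → fromℤ (i ℤ.* j) ≈ fromℤ i * fromℤ j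
  fromℤ-* i j = trans (fromℤ≈⟦⟧ (i ℤ.* j)) (trans (⟦⟧-* i j) (sym (*-cong (fromℤ≈⟦⟧ i) (fromℤ≈⟦⟧ j))))

  fromℤ-neg : ∀ i → fromℤ (ℤ.- i) ≈ - fromℤ i
  fromℤ-neg i = trans (fromℤ≈⟦⟧ (ℤ.- i)) (trans (⟦⟧-neg i) (-‿cong (sym (fromℤ≈⟦⟧ i))))

  1≤fromℕ-suc : ∀ n → 1# ≤ fromℕ (suc n)
  1≤fromℕ-suc n = ≤-from (fromℕ-nonNeg n) (solve 1 (λ n → n := :1 :+ n :- :1) refl (fromℕ n))

  -- Discreteness of ℤ. The sign is kept because the two nonzero cases will be estimated
  -- differently.
  fromℤ-trichotomy : ∀ i → 1# ≤ fromℤ i ⊎ fromℤ i ≈ 0# ⊎ fromℤ i ≤ - 1#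
  fromℤ-trichotomy (+ zero)   = inj₂ (inj₁ refl)
  fromℤ-trichotomy (+ suc n)  = inj₁ (1≤fromℕ-suc n)
  fromℤ-trichotomy (-[1+ n ]) = inj₂ (inj₂ (neg-mono-≤ (1≤fromℕ-suc n)))

  *-[-/] : ∀ {x p q} → 0# < q → q * (x - p / q) ≈ q * x - p
  *-[-/] {x} {p} {q} 0<q = trans (solve 3 (λ x r q → q :* (x :- r) := q :* x :- r :* q) refl x (p / q) q)
                                (+-congˡ (-‿cong (*/-cancel q (pos⇒≉0 0<q))))

  log-cong-exp : ∀ {x y} → 0# < y → exp x ≈ y → log y ≈ x
  log-cong-exp {x} {y} 0<y e = antisym
    (exp-cancel-≤ (≤-reflexive (trans (exp-log 0<y) (sym e))))
    (exp-cancel-≤ (≤-reflexive (trans e (sym (exp-log 0<y)))))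

  0<fromℕ3 : 0# < fromℕ 3
  0<fromℕ3 = fromℕ-pos {3} (s≤s z≤n)

  1<fromℕ : ∀ {n} → 2 ℕ.≤ n → 1# < fromℕ n
  1<fromℕ {suc (suc n)} (s≤s (s≤s _)) = <-from (fromℕ-pos {suc n} (s≤s z≤n)) (solve 1 (λ n → n := :1 :+ n :- :1) refl (fromℕ (suc n)))

  ln3 : ℝ
  ln3 = log (fromℕ 3)

  0<ln3 : 0# < ln3
  0<ln3 = log-pos (1<fromℕ {3} (s≤s (s≤s z≤n)))

  exp-*ln3 : ∀ n → exp (fromℕ n * ln3) ≈ 3# ^ n
  exp-*ln3 n = trans (exp-fromℕ-* n ln3) (^-congˡ n (trans (exp-log 0<fromℕ3) fromℕ-3))

  0<3^ : ∀ n → 0# < 3# ^ n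
  0<3^ n = ^-pos n 0<3

  snds-bounded : ∀ (xs : List (ℤ × ℕ)) → ∃[ b ] (∀ {p q} → (p , q) ∈ xs → q ℕ.≤ b)
  snds-bounded []             = 0 , λ ()
  snds-bounded ((p , q) ∷ xs) = let b , bounded = snds-bounded xs in
    q ℕ.+ b , λ { (here ≡.refl) → ℕ.m≤m+n q b ; (there x∈) → ℕ.≤-trans (bounded x∈) (ℕ.m≤n+m b q) }

  -- Good rational approximations to the constructed points

  module Approximation (m : ℕ) (8≤m : 8 ℕ.≤ m) (t : ℕ → Bool) where

    open Blocks m 8≤m

    a : ℕ → Bool
    a = digits t

    x : ℝ
    x = val a

    -- What truncation before the j-th block leaves of `3# ^ Q j * x`; it begins with the zeros of
    -- that block.
    θ : ℕ → ℝ
    θ j = val (shift (Q j) a)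

    θ-zeros : ∀ j → 3# ^ (Q j ℕ.+ L j) * θ j ≈ val (shift (Q j ℕ.+ L j) (shift (Q j) a))
    θ-zeros j = val-zeros (Q j ℕ.+ L j) (shift (Q j) a) (digits-zeros t j)

    3^*θ≤1 : ∀ j → 3# ^ (Q j ℕ.+ L j) * θ j ≤ 1#
    3^*θ≤1 j = ≤-trans (≤-reflexive (θ-zeros j)) (val≤1 _)

    2≤3*3^*θ : ∀ j → 2# ≤ 3# * (3# ^ (Q j ℕ.+ L j) * θ j)
    2≤3*3^*θ j = ≤-trans (2≤3*val (shift (Q j ℕ.+ L j) (shift (Q j) a))
        (≡.trans (≡.cong (λ k → a (Q j ℕ.+ k)) (ℕ.+-identityʳ _)) (digits-end t j)))
      (≤-reflexive (*-congˡ (sym (θ-zeros j))))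

    numerator : ℕ → ℕ
    numerator j = prefix (Q j) a

    x-expansion : ∀ j → 3# ^ Q j * x ≈ fromℕ (numerator j) + θ j
    x-expansion j = prefix-spec (Q j) a

    denominator : ℕ → ℕ
    denominator j = 3 ℕ.^ Q j

    0<denominator : ∀ j → 0 ℕ.< denominator j
    0<denominator j = ℕ.m^n>0 3 (Q j)

    error : ℕ → ℝ
    error j = x - fromℤ (+ numerator j) / fromℕ (denominator j)

    3^Q*error≈θ : ∀ j → 3# ^ Q j * error j ≈ θ j
    3^Q*error≈θ j = begin-equality
      3# ^ Q j * error j                                 ≈⟨ *-congʳ (3#^ (Q j)) ⟨
      fromℕ (denominator j) * error j                    ≈⟨ *-[-/] (fromℕ-pos (0<denominator j)) ⟩
      fromℕ (denominator j) * x - fromℕ (numerator j)    ≈⟨ +-congʳ (trans (*-congʳ (3#^ (Q j))) (x-expansion j)) ⟩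
      fromℕ (numerator j) + θ j - fromℕ (numerator j)    ≈⟨ solve 2 (λ p θ → p :+ θ :- p := θ) refl (fromℕ (numerator j)) (θ j) ⟩
      θ j                                                ∎

    ∣error∣≈error : ∀ j → ∣ error j ∣ ≤ error j
    ∣error∣≈error j = ∣∣≤ (⊑-refl (*-cancelʳ-≤ (3# ^ Q j) (0<3^ (Q j)) (begin
      0# * 3# ^ Q j        ≈⟨ zeroˡ _ ⟩
      0#                   ≤⟨ val-nonNeg _ ⟩
      θ j                  ≈⟨ 3^Q*error≈θ j ⟨
      3# ^ Q j * error j   ≈⟨ *-comm _ _ ⟩
      error j * 3# ^ Q j   ∎)))

    3^*∣error∣≤1 : ∀ j → 3# ^ (Q j ℕ.+ (Q j ℕ.+ L j)) * ∣ error j ∣ ≤ 1#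
    3^*∣error∣≤1 j = begin
      3# ^ (Q j ℕ.+ z) * ∣ error j ∣        ≤⟨ *-monoˡ-≤ _ (0≤3^ (Q j ℕ.+ z)) (∣error∣≈error j) ⟩
      3# ^ (Q j ℕ.+ z) * error j            ≈⟨ *-congʳ (^-homo-* 3# (Q j) z) ⟩
      3# ^ Q j * 3# ^ z * error j           ≈⟨ solve 3 (λ a b e → a :* b :* e := b :* (a :* e)) refl (3# ^ Q j) (3# ^ z) (error j) ⟩
      3# ^ z * (3# ^ Q j * error j)         ≈⟨ *-congˡ (3^Q*error≈θ j) ⟩
      3# ^ z * θ j                          ≤⟨ 3^*θ≤1 j ⟩
      1#                                    ∎
      where z = Q j ℕ.+ L j

    -- The error is at most the power of the denominator with exponent -(2 + 1/m). Taking 1/(m+1) in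
    -- place of 1/m leaves room for the strict inequality in `Approx`.
    M : ℝ
    M = fromℕ (suc m)

    0<M : 0# < M
    0<M = fromℕ-pos {suc m} (s≤s z≤n)

    -- As Q = m L, the exponent (2 + 1/(m+1)) Q is less than 2 Q + L.
    exponent-gap : ∀ j → 0# < fromℕ (Q j ℕ.+ (Q j ℕ.+ L j)) * ln3 - (fromℕ 2 + M ⁻¹) * (fromℕ (Q j) * ln3)
    exponent-gap j = <-respʳ (begin-equality
        M ⁻¹ * l * ln3
          ≈⟨ solve 4 (λ i m l e → i :* l :* e := (i :* (:1 :+ m)) :* l :* e :- i :* (m :* l) :* e)
               refl (M ⁻¹) (fromℕ m) l ln3 ⟩
        M ⁻¹ * M * l * ln3 - M ⁻¹ * (fromℕ m * l) * ln3
          ≈⟨ +-cong (*-congʳ (*-congʳ (⁻¹-inverseˡ (pos⇒≉0 0<M)))) (-‿cong (*-congʳ (*-congˡ (sym (fromℕ-* m (L j)))))) ⟩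
        1# * l * ln3 - M ⁻¹ * q * ln3
          ≈⟨ solve 4 (λ q l i e → :1 :* l :* e :- i :* q :* e := (q :+ (q :+ l)) :* e :- (:2 :+ i) :* (q :* e)) refl q l (M ⁻¹) ln3 ⟩
        (q + (q + l)) * ln3 - (2# + M ⁻¹) * (q * ln3)
          ≈⟨ +-cong (*-congʳ (trans (fromℕ-+ (Q j) (Q j ℕ.+ L j)) (+-congˡ (fromℕ-+ (Q j) (L j)))))
                    (-‿cong (*-congʳ (+-congʳ fromℕ-2))) ⟨
        fromℕ (Q j ℕ.+ (Q j ℕ.+ L j)) * ln3 - (fromℕ 2 + M ⁻¹) * (q * ln3) ∎)
      (*-pos (*-pos (⁻¹-pos 0<M) (fromℕ-pos (1≤L j))) 0<ln3)
      where
      q = fromℕ (Q j)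
      l = fromℕ (L j)

    ∣error∣< : ∀ j → ∣ error j ∣ < fromℕ (denominator j) ^ʳ (- (fromℕ 2 + M ⁻¹))
    ∣error∣< j = ≰⇒> λ small → <⇒≱ (begin-strict
        1#                             ≈⟨ exp-0 ⟨
        exp 0#                         <⟨ exp-mono-< (exponent-gap j) ⟩
        exp (V - u)                    ≈⟨ exp-+ V (- u) ⟩
        exp V * exp (- u)              ≈⟨ *-cong (exp-*ln3 (Z j)) (sym power) ⟩
        3# ^ Z j * (D ^ʳ (- e))        ∎)
      (≤-trans (*-monoˡ-≤ (3# ^ Z j) (0≤3^ (Z j)) small) (3^*∣error∣≤1 j))
      where
      D = fromℕ (denominator j)
      0<D = fromℕ-pos (0<denominator j)
      e = fromℕ 2 + M ⁻¹
      V = fromℕ (Z j) * ln3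
      u = e * (fromℕ (Q j) * ln3)
      log-D : log D ≈ fromℕ (Q j) * ln3
      log-D = log-cong-exp 0<D (trans (exp-*ln3 (Q j)) (sym (3#^ (Q j))))
      power : D ^ʳ (- e) ≈ exp (- u)
      power = begin-equality
        D ^ʳ (- e)          ≡⟨ ^ʳ-pos (- e) 0<D ⟩
        exp (- e * log D)   ≈⟨ exp-cong (trans (*-congˡ log-D) (solve 2 (λ e y → :- e :* y := :- (e :* y)) refl e (fromℕ (Q j) * ln3))) ⟩
        exp (- u)           ∎

    -- Infinitely many approximations: the truncation with index b has denominator 3^(Q b) > b,
    -- larger than every denominator in the given list.
    x∈𝓦 : 𝓦 x
    x∈𝓦 = M ⁻¹ , ⁻¹-pos 0<M , λ xs → let b , bounded = snds-bounded xs in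
      (+ numerator b , denominator b) , (0<denominator b , ∣error∣< b) ,
      λ ∈xs → ℕ.<⇒≱ (ℕ.<-trans (n<Q b) (n<b^n (s≤s (s≤s z≤n)) (Q b))) (bounded ∈xs)

  -- A finite irrationality exponent

  log-1 : log (fromℕ 1) ≈ 0#
  log-1 = log-cong-exp (fromℕ-pos {1} (s≤s z≤n)) (trans exp-0 (sym fromℕ-1))

  fromℤ-/1 : ∀ p → fromℤ p / fromℕ 1 ≈ fromℤ p
  fromℤ-/1 p = begin-equality
    fromℤ p / fromℕ 1             ≈⟨ *-identityʳ _ ⟨
    fromℤ p / fromℕ 1 * 1#        ≈⟨ *-congˡ fromℕ-1 ⟨
    fromℤ p / fromℕ 1 * fromℕ 1   ≈⟨ */-cancel (fromℕ 1) (pos⇒≉0 (fromℕ-pos {1} (s≤s z≤n))) ⟩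
    fromℤ p                       ∎

  -- For denominator 1, where every power of q is 1 and raising the exponent gains nothing.
  integer-distance : ∀ {x} → 0# ≤ x → x ≤ 1# → ∀ p → ¬ p ≡ + 0 → ¬ p ≡ + 1 → 1# ≤ ∣ x - fromℤ p ∣
  integer-distance 0≤x x≤1 (+ zero)          p≢0 p≢1 = contradiction ≡.refl p≢0
  integer-distance 0≤x x≤1 (+ suc zero)      p≢0 p≢1 = contradiction ≡.refl p≢1
  integer-distance {x} 0≤x x≤1 (+ suc (suc n)) p≢0 p≢1 = ≤-trans
    (≤-from (x≤y⇒0≤y-x x≤1 ⊕ fromℕ-nonNeg n) (solve 2 (λ x n → :1 :- x :+ n := :1 :+ (:1 :+ n) :- x :- :1) refl x (fromℕ n)))
    (∣-∣-comm-≤ x (fromℤ (+ suc (suc n))))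
  integer-distance {x} 0≤x x≤1 (-[1+ n ]) p≢0 p≢1 = ≤-trans
    (≤-from (0≤x ⊕ fromℕ-nonNeg n) (solve 2 (λ x n → x :+ n := x :- :- (:1 :+ n) :- :1) refl x (fromℕ n)))
    (x≤∣x∣ (x - fromℤ (-[1+ n ])))

  module NotLiouville (m : ℕ) (8≤m : 8 ℕ.≤ m) (t : ℕ → Bool) where

    open Blocks m 8≤m
    open Approximation m 8≤m t

    -- Let j be the scale given by scale-exists.  If p/q differs from the j-th
    -- approximation of x, their distance is at least 1/(q 3^Q), and the j-th error
    -- is at most half of that.  If the two fractions agree, the digit 2 that ends
    -- the block bounds the error from below.
    irrationality-measure : ∀ {q} → 2 ℕ.≤ q → ∀ p → 1# ≤ fromℕ q ^ v * ∣ x - fromℤ p / fromℕ q ∣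
    irrationality-measure {q} 2≤q p = case fromℤ-trichotomy D of λ
        -- Here `r * θ j` and `d` are both nonnegative, so nothing cancels.
        { (inj₁ 1≤D) → large k₁ 2qN≤ (begin
            1#                     ≤⟨ ≤-from (0≤rθ ⊕ 0≤rθ ⊕ x≤y⇒0≤y-x 1≤D ⊕ x≤y⇒0≤y-x 1≤D ⊕ 0≤1)
                                        (solve 2 (λ y d → y :+ y :+ (d :- :1) :+ (d :- :1) :+ :1 := :2 :* (y :+ d) :- :1) refl (r * θ j) d) ⟩
            2# * (r * θ j + d)     ≈⟨ 2rN*e ⟨
            2rN * e                ≤⟨ *-monoˡ-≤ 2rN 0≤2rN (x≤∣x∣ e) ⟩
            2rN * ∣ e ∣            ∎)
        ; (inj₂ (inj₁ D≈0)) → large k₂ 33zN≤ (begin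
            1#                         ≤⟨ ≤-from 0≤1 (solve 0 (:1 := :2 :- :1) refl) ⟩
            2#                         ≤⟨ 2≤3*3^*θ j ⟩
            3# * (3# ^ z * θ j)        ≈⟨ *-congˡ (*-congˡ (N*e D≈0)) ⟨
            3# * (3# ^ z * (N * e))    ≈⟨ solve 4 (λ t z n e → t :* (z :* (n :* e)) := t :* z :* n :* e) refl 3# (3# ^ z) N e ⟩
            3# * 3# ^ z * N * e        ≈⟨ *-congʳ 33zN≈ ⟨
            33zN * e                   ≤⟨ *-monoˡ-≤ 33zN (fromℕ-nonNeg k₂) (x≤∣x∣ e) ⟩
            33zN * ∣ e ∣               ∎)
        -- Here the two terms have opposite signs; 2rθ ≤ 1, which comes from the choice of the
        -- scale, leaves at least half of the distance.
        ; (inj₂ (inj₂ D≤-1)) → large k₁ 2qN≤ (begin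
            1#                         ≤⟨ ≤-from (x≤y⇒0≤y-x 2rθ≤1 ⊕ x≤y⇒0≤y-x D≤-1 ⊕ x≤y⇒0≤y-x D≤-1)
                                            (solve 3 (λ r θ d → :1 :- :2 :* r :* θ :+ (:- :1 :- d) :+ (:- :1 :- d)
                                              := :- (:2 :* (r :* θ :+ d)) :- :1) refl r (θ j) d) ⟩
            - (2# * (r * θ j + d))     ≈⟨ -‿cong 2rN*e ⟨
            - (2rN * e)                ≈⟨ solve 2 (λ a e → :- (a :* e) := a :* :- e) refl 2rN e ⟩
            2rN * - e                  ≤⟨ *-monoˡ-≤ 2rN 0≤2rN (-x≤∣x∣ e) ⟩
            2rN * ∣ e ∣                ∎) }
      where
      scale = scale-exists 2≤q
      j = proj₁ scale
      z = Q j ℕ.+ L j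
      r = fromℕ q
      e = x - fromℤ p / r
      N = 3# ^ Q j
      -- The numerator of the difference between the j-th approximation and p/q over the common
      -- denominator q 3^Q.
      D = + q ℤ.* + numerator j ℤ.+ ℤ.- (+ denominator j ℤ.* p)
      d = fromℤ D
      k₁ k₂ : ℕ
      k₁ = 2 ℕ.* q ℕ.* 3 ℕ.^ Q j
      k₂ = 3 ℕ.* 3 ℕ.^ z ℕ.* 3 ℕ.^ Q j
      2rN 33zN : ℝ
      2rN = fromℕ k₁
      33zN = fromℕ k₂
      0≤2rN : 0# ≤ 2rN
      0≤2rN = fromℕ-nonNeg k₁
      0<r : 0# < r
      0<r = fromℕ-pos (ℕ.<-≤-trans (s≤s z≤n) 2≤q)
      0≤rθ : 0# ≤ r * θ j
      0≤rθ = *-nonNeg (proj₁ 0<r) (val-nonNeg _)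
      2qN≤ : k₁ ℕ.≤ q ℕ.^ v
      2qN≤ = 2q3^Q≤q^v j 2≤q (proj₂ (proj₂ scale))
      33zN≤ : k₂ ℕ.≤ q ℕ.^ v
      33zN≤ = 3·3^z3^Q≤q^v j 2≤q (proj₂ (proj₂ scale))
      large : ∀ k → k ℕ.≤ q ℕ.^ v → 1# ≤ fromℕ k * ∣ e ∣ → 1# ≤ r ^ v * ∣ e ∣
      large k k≤ 1≤ = ≤-trans 1≤ (*-monoʳ-≤ ∣ e ∣ (0≤∣x∣ e)
        (≤-trans (fromℕ-mono-≤ k≤) (≤-reflexive (fromℕ-^ q v))))
      2q≈2r : fromℕ (2 ℕ.* q) ≈ 2# * r
      2q≈2r = trans (fromℕ-* 2 q) (*-congʳ fromℕ-2)
      2rN≈ : 2rN ≈ 2# * r * N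
      2rN≈ = trans (fromℕ-* (2 ℕ.* q) (3 ℕ.^ Q j)) (*-cong 2q≈2r (3#^ (Q j)))
      33zN≈ : 33zN ≈ 3# * 3# ^ z * N
      33zN≈ = trans (fromℕ-* (3 ℕ.* 3 ℕ.^ z) (3 ℕ.^ Q j))
        (*-cong (trans (fromℕ-* 3 (3 ℕ.^ z)) (*-cong fromℕ-3 (3#^ z))) (3#^ (Q j)))
      2rθ≤1 : 2# * r * θ j ≤ 1#
      2rθ≤1 = begin
        2# * r * θ j               ≈⟨ *-congʳ 2q≈2r ⟨
        fromℕ (2 ℕ.* q) * θ j      ≤⟨ *-monoʳ-≤ (θ j) (val-nonNeg _) (fromℕ-mono-≤ (proj₁ (proj₂ scale))) ⟩
        fromℕ (3 ℕ.^ z) * θ j      ≈⟨ *-congʳ (3#^ z) ⟩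
        3# ^ z * θ j               ≤⟨ 3^*θ≤1 j ⟩
        1#                         ∎
      d≈ : d ≈ r * fromℕ (numerator j) - N * fromℤ p
      d≈ = trans (fromℤ-+ (+ q ℤ.* + numerator j) (ℤ.- (+ denominator j ℤ.* p)))
        (+-cong (fromℤ-* (+ q) (+ numerator j))
                (trans (fromℤ-neg (+ denominator j ℤ.* p)) (-‿cong (trans (fromℤ-* (+ denominator j) p) (*-congʳ (3#^ (Q j)))))))
      r*N*e : r * (N * e) ≈ r * θ j + d
      r*N*e = begin-equality
        r * (N * e)                                        ≈⟨ solve 3 (λ r n e → r :* (n :* e) := n :* (r :* e)) refl r N e ⟩
        N * (r * e)                                        ≈⟨ *-congˡ (*-[-/] 0<r) ⟩
        N * (r * x - fromℤ p)                              ≈⟨ solve 4 (λ n r x p → n :* (r :* x :- p) := r :* (n :* x) :- n :* p) refl N r x (fromℤ p) ⟩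
        r * (N * x) - N * fromℤ p                          ≈⟨ +-congʳ (*-congˡ (x-expansion j)) ⟩
        r * (fromℕ (numerator j) + θ j) - N * fromℤ p      ≈⟨ solve 4 (λ r a θ y → r :* (a :+ θ) :- y := r :* θ :+ (r :* a :- y))
                                                                refl r (fromℕ (numerator j)) (θ j) (N * fromℤ p) ⟩
        r * θ j + (r * fromℕ (numerator j) - N * fromℤ p)  ≈⟨ +-congˡ d≈ ⟨
        r * θ j + d                                        ∎
      2rN*e : 2rN * e ≈ 2# * (r * θ j + d)
      2rN*e = begin-equality
        2rN * e             ≈⟨ *-congʳ 2rN≈ ⟩
        2# * r * N * e      ≈⟨ solve 3 (λ r n e → :2 :* r :* n :* e := :2 :* (r :* (n :* e))) refl r N e ⟩
        2# * (r * (N * e))  ≈⟨ *-congˡ r*N*e ⟩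
        2# * (r * θ j + d)  ∎
      N*e : d ≈ 0# → N * e ≈ θ j
      N*e d≈0 = antisym (cancel (≤-reflexive r*N*e≈r*θ)) (cancel (≤-reflexive (sym r*N*e≈r*θ)))
        where
        r*N*e≈r*θ : r * (N * e) ≈ r * θ j
        r*N*e≈r*θ = trans r*N*e (trans (+-congˡ d≈0) (+-identityʳ _))
        cancel : ∀ {y w} → r * y ≤ r * w → y ≤ w
        cancel {y} {w} h = *-cancelʳ-≤ r 0<r (≤-trans (≤-reflexive (*-comm y r)) (≤-trans h (≤-reflexive (*-comm r w))))

    -- The product is q^-2. It makes ε = v a value at which the Liouville condition contradicts the
    -- irrationality measure.
    power-bound : ∀ {q} → 2 ℕ.≤ q → fromℕ q ^ v * fromℕ q ^ʳ (- (fromℕ 2 + fromℕ v)) ≤ 1#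
    power-bound {q} 2≤q = begin
      r ^ v * r ^ʳ (- (fromℕ 2 + fromℕ v))        ≡⟨ ≡.cong (r ^ v *_) (^ʳ-pos _ 0<r) ⟩
      r ^ v * exp (- (fromℕ 2 + fromℕ v) * log r) ≈⟨ *-congʳ (trans (^-congˡ v (sym (exp-log 0<r))) (sym (exp-fromℕ-* v (log r)))) ⟩
      exp (fromℕ v * log r) * exp (- (fromℕ 2 + fromℕ v) * log r) ≈⟨ exp-+ _ _ ⟨
      exp (fromℕ v * log r + - (fromℕ 2 + fromℕ v) * log r) ≤⟨ exp-mono-≤ (≤-from (*-nonNeg (fromℕ-nonNeg 2) (proj₁ (log-pos (1<fromℕ 2≤q))))
                                                               (solve 3 (λ w v l → w :* l := :0 :- (v :* l :+ :- (w :+ v) :* l)) refl (fromℕ 2) (fromℕ v) (log r))) ⟩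
      exp 0#                                      ≈⟨ exp-0 ⟩
      1#                                          ∎
      where
      r = fromℕ q
      0<r : 0# < r
      0<r = fromℕ-pos (ℕ.<-≤-trans (s≤s z≤n) 2≤q)

    -- A single fraction outside the list gives the contradiction: for q ≥ 2 none is close enough,
    -- and for q = 1 only 0 and 1 could be, which the list excludes.
    x∉𝓛 : ¬ 𝓛 x
    x∉𝓛 liouville = impossible (liouville (fromℕ v) (fromℕ-pos 0<v) ((+ 0 , 1) ∷ (+ 1 , 1) ∷ []))
      where
      0<v : 0 ℕ.< v
      0<v = ℕ.<-≤-trans (s≤s z≤n) (ℕ.m≤n+m 2 (6 ℕ.* m))
      impossible : ∃[ pq ] (0 ℕ.< proj₂ pq × ∣ x - fromℤ (proj₁ pq) / fromℕ (proj₂ pq) ∣ < fromℕ (proj₂ pq) ^ʳ (- (fromℕ 2 + fromℕ v)))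
                     × pq ∉ ((+ 0 , 1) ∷ (+ 1 , 1) ∷ []) → ⊥
      impossible ((p , suc zero) , (_ , near) , new) = <⇒≱ near (begin
        fromℕ 1 ^ʳ (- (fromℕ 2 + fromℕ v))            ≡⟨ ^ʳ-pos _ (fromℕ-pos {1} (s≤s z≤n)) ⟩
        exp (- (fromℕ 2 + fromℕ v) * log (fromℕ 1))   ≈⟨ exp-cong (trans (*-congˡ log-1) (zeroʳ _)) ⟩
        exp 0#                                        ≈⟨ exp-0 ⟩
        1#                                            ≤⟨ integer-distance (val-nonNeg a) (val≤1 a) p
                                                           (λ p≡0 → new (here (≡.cong (_, 1) p≡0)))
                                                           (λ p≡1 → new (there (here (≡.cong (_, 1) p≡1)))) ⟩
        ∣ x - fromℤ p ∣                               ≤⟨ ∣∣≤ (⊑-resp (+-congˡ (-‿cong (fromℤ-/1 p))) (⊑∣∣ _)) ⟩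
        ∣ x - fromℤ p / fromℕ 1 ∣                     ∎)
      impossible ((p , q@(suc (suc _))) , (_ , near) , _) = <⇒≱
        (<-from (*-pos (^-pos v (fromℕ-pos {q} (s≤s z≤n))) (x<y⇒0<y-x near))
          (solve 3 (λ r a b → r :* (a :- b) := r :* a :- r :* b) refl (fromℕ q ^ v) _ _))
        (≤-trans (power-bound {q} (s≤s (s≤s z≤n))) (irrationality-measure {q} (s≤s (s≤s z≤n)) p))

  -- Coverings of the space of binary sequences by cylinders

  -- The measure of a cylinder under fair coin tossing.
  weight : Maybe (List Bool) → ℝ
  weight nothing  = 0#
  weight (just w) = ½ ^ length w

  -- `just w` stands for the cylinder of the sequences extending w, and `nothing`
  -- for the empty set.
  child : Bool → Maybe (List Bool) → Maybe (List Bool)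
  child b     nothing            = nothing
  child b     (just [])          = just []
  child false (just (false ∷ w)) = just w
  child false (just (true ∷ w))  = nothing
  child true  (just (false ∷ w)) = nothing
  child true  (just (true ∷ w))  = just w

  Extends : List Bool → (ℕ → Bool) → Set
  Extends []      t = ⊤
  Extends (b ∷ w) t = t 0 ≡ b × Extends w (tail t)

  weight-nonNeg : ∀ c → 0# ≤ weight c
  weight-nonNeg nothing  = ≤-refl
  weight-nonNeg (just w) = ^-nonNeg (length w) 0≤½

  -- Each child is the trace on one half, rescaled to the whole space, so the weights average. The
  -- full space is its own child on both sides.
  weight-split : ∀ c → weight c ≈ ½ * (weight (child false c) + weight (child true c))
  weight-split nothing            = sym (trans (*-congˡ (+-identityʳ 0#)) (zeroʳ ½))
  weight-split (just [])          = sym ½*2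
  weight-split (just (false ∷ w)) = *-congˡ (sym (+-identityʳ _))
  weight-split (just (true ∷ w))  = *-congˡ (sym (+-identityˡ _))

  Small : ℝ → (ℕ → Maybe (List Bool)) → Set
  Small c W = ∀ n → ∑ n (weight ∘ W) ≤ c

  child-weights : (ℕ → Maybe (List Bool)) → Bool → ℕ → ℝ
  child-weights W b i = weight (child b (W i))

  ∑-weight-split : ∀ n W → ∑ n (weight ∘ W) ≈ ½ * (∑ n (child-weights W false) + ∑ n (child-weights W true))
  ∑-weight-split n W = begin-equality
    ∑ n (weight ∘ W)                                                    ≈⟨ ∑-cong n (weight-split ∘ W) ⟩
    ∑ n (λ i → ½ * (child-weights W false i + child-weights W true i))  ≈⟨ ∑-*ˡ n ½ (λ i → child-weights W false i + child-weights W true i) ⟩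
    ½ * ∑ n (λ i → child-weights W false i + child-weights W true i)    ≈⟨ *-congˡ (∑-+ n (child-weights W false) (child-weights W true)) ⟩
    ½ * (∑ n (child-weights W false) + ∑ n (child-weights W true))      ∎

  not-small : ∀ {c} W → ¬ Small c W → ∃[ n ] c < ∑ n (weight ∘ W)
  not-small {c} W ¬small with em {P = ∃[ n ] c < ∑ n (weight ∘ W)}
  ... | yes p = p
  ... | no ¬p = contradiction (λ n → ≮⇒≥ λ c< → ¬p (n , c<)) ¬small

  -- If both halves exceeded c, so would their average.
  small-child : ∀ {c} W → Small c W → ∃[ b ] Small c (child b ∘ W)
  small-child {c} W small with em {P = Small c (child false ∘ W)} | em {P = Small c (child true ∘ W)}
  ... | yes s | _     = false , s
  ... | no _  | yes s = true , s
  ... | no ¬s | no ¬r = contradiction (small n) (<⇒≱ (begin-strict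
          c                                                   ≈⟨ ½+½ c ⟨
          ½ * c + ½ * c                                       ≈⟨ distribˡ ½ c c ⟨
          ½ * (c + c)                                         <⟨ <-from (*-pos 0<½ (+-pos-nonNeg (x<y⇒0<y-x c<f) (proj₁ (x<y⇒0<y-x c<g))))
                                                                   (solve 4 (λ h c f g → h :* (f :- c :+ (g :- c)) := h :* (f :+ g) :- h :* (c :+ c))
                                                                     refl ½ c (∑ n (child-weights W false)) (∑ n (child-weights W true))) ⟩
          ½ * (∑ n (child-weights W false) + ∑ n (child-weights W true)) ≈⟨ ∑-weight-split n W ⟨
          ∑ n (weight ∘ W)                                    ∎))
    where
    p = not-small (child false ∘ W) ¬s
    q = not-small (child true ∘ W) ¬r
    -- Partial sums of nonnegative weights increase, so both exceed c at this common index.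
    n = proj₁ p ℕ.+ proj₁ q
    c<f : c < ∑ n (child-weights W false)
    c<f = begin-strict
      c                                     <⟨ proj₂ p ⟩
      ∑ (proj₁ p) (child-weights W false)   ≤⟨ ∑-monoˡ (λ i → weight-nonNeg (child false (W i))) (ℕ.m≤m+n (proj₁ p) (proj₁ q)) ⟩
      ∑ n (child-weights W false)           ∎
    c<g : c < ∑ n (child-weights W true)
    c<g = begin-strict
      c                                     <⟨ proj₂ q ⟩
      ∑ (proj₁ q) (child-weights W true)    ≤⟨ ∑-monoˡ (λ i → weight-nonNeg (child true (W i))) (ℕ.m≤n+m (proj₁ q) (proj₁ p)) ⟩
      ∑ n (child-weights W true)            ∎

  branch : ∀ {c} W → Small c W → ℕ → Bool
  branch W small zero    = proj₁ (small-child W small)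
  branch W small (suc k) = branch (child (proj₁ (small-child W small)) ∘ W) (proj₂ (small-child W small)) k

  child-extends : ∀ {b b′ w c} → c ≡ just (b ∷ w) → b′ ≡ b → child b′ c ≡ just w
  child-extends {false} ≡.refl ≡.refl = ≡.refl
  child-extends {true}  ≡.refl ≡.refl = ≡.refl

  -- Following the branch through w would turn the i-th cylinder into the full space, whose weight 1
  -- alone exceeds c.
  branch-avoids : ∀ {c} → c < 1# → ∀ W (small : Small c W) i w → W i ≡ just w → ¬ Extends w (branch W small)
  branch-avoids {c} c<1 W small i [] Wi≡ _ = <⇒≱ c<1 (begin
    1#                                 ≡⟨ ≡.cong weight Wi≡ ⟨
    weight (W i)                       ≤⟨ ≤-from (∑-nonNeg i (λ k → weight-nonNeg (W k)))
                                            (solve 2 (λ s x → s := s :+ x :- x) refl (∑ i (weight ∘ W)) (weight (W i))) ⟩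
    ∑ i (weight ∘ W) + weight (W i)    ≈⟨ ∑-last i (weight ∘ W) ⟨
    ∑ (suc i) (weight ∘ W)             ≤⟨ small (suc i) ⟩
    c                                  ∎)
  branch-avoids c<1 W small i (b ∷ w) Wi≡ (t₀ , ext) =
    branch-avoids c<1 (child (proj₁ (small-child W small)) ∘ W) (proj₂ (small-child W small)) i w (child-extends Wi≡ t₀) ext

  take : ℕ → (ℕ → Bool) → List Bool
  take zero    t = []
  take (suc n) t = t 0 ∷ take n (tail t)

  take-length : ∀ n t → length (take n t) ≡ n
  take-length zero    t = ≡.refl
  take-length (suc n) t = ≡.cong suc (take-length n (tail t))

  agree⇒extends : ∀ n {t u} → (∀ k → k ℕ.< n → t k ≡ u k) → Extends (take n t) u
  agree⇒extends zero    agree = tt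
  agree⇒extends (suc n) agree = ≡.sym (agree 0 (s≤s z≤n)) , agree⇒extends n λ k k<n → agree (suc k) (s≤s k<n)

  -- Each inhabited `V i` lies in the cylinder given by the first `l i` entries of any one member,
  -- so the argument for cylinders applies to arbitrary sets.
  uncovered : ∀ {c} → c < 1# → (V : ℕ → (ℕ → Bool) → Set) (l : ℕ → ℕ) →
    (∀ i {t u} → V i t → V i u → ∀ k → k ℕ.< l i → t k ≡ u k) →
    (∀ n → ∑ n (λ i → ½ ^ l i) ≤ c) → ∃[ t ] (∀ i → ¬ V i t)
  uncovered {c} c<1 V l V-agree light = branch W small , avoids
    where
    -- The decision is an argument so that the properties of the hull are proved by splitting on it.
    hull : ∀ i → Dec (∃[ t ] V i t) → Maybe (List Bool)
    hull i (yes (t , _)) = just (take (l i) t)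
    hull i (no _)        = nothing
    weight-hull : ∀ i d → weight (hull i d) ≤ ½ ^ l i
    weight-hull i (yes (t , _)) = ≤-reflexive (reflexive (≡.cong (½ ^_) (take-length (l i) t)))
    weight-hull i (no _)        = ^-nonNeg (l i) 0≤½
    W : ℕ → Maybe (List Bool)
    W i = hull i em
    small : Small c W
    small n = ≤-trans (∑-mono n λ i → weight-hull i em) (light n)
    extends : ∀ i d {u} → V i u → ∃[ w ] hull i d ≡ just w × Extends w u
    extends i (yes (t , Vt)) Vu = take (l i) t , ≡.refl , agree⇒extends (l i) (V-agree i Vt Vu)
    extends i (no none)      Vu = contradiction (_ , Vu) none
    avoids : ∀ i → ¬ V i (branch W small)
    avoids i Vt = let w , W≡ , ext = extends i em Vt in branch-avoids c<1 W small i w W≡ ext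

  -- The lower bound for the dimension

  E₀ : Pred ℝ 0ℓ
  E₀ = (𝓦 ∖ 𝓛) ∩ K

  val-digits∈ : ∀ m (8≤m : 8 ℕ.≤ m) t → E₀ (val (Blocks.digits m 8≤m t))
  val-digits∈ m 8≤m t = (Approximation.x∈𝓦 m 8≤m t , NotLiouville.x∉𝓛 m 8≤m t) , val∈K _

  ln2 : ℝ
  ln2 = log (fromℕ 2)

  0<fromℕ2 : 0# < fromℕ 2
  0<fromℕ2 = fromℕ-pos {2} (s≤s z≤n)

  0<ln2 : 0# < ln2
  0<ln2 = log-pos (1<fromℕ {2} (s≤s (s≤s z≤n)))

  exp-*ln2 : ∀ n → exp (- (fromℕ n * ln2)) ≈ ½ ^ n
  exp-*ln2 n = begin-equality
    exp (- (fromℕ n * ln2))  ≈⟨ exp-cong (solve 2 (λ n l → :- (n :* l) := n :* :- l) refl (fromℕ n) ln2) ⟩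
    exp (fromℕ n * - ln2)    ≈⟨ exp-fromℕ-* n (- ln2) ⟩
    exp (- ln2) ^ n          ≈⟨ ^-congˡ n (exp-neg-cancel (trans (exp-log 0<fromℕ2) fromℕ-2)) ⟩
    ½ ^ n                    ∎

  ^ʳ-nonNeg : ∀ x s → 0# ≤ x ^ʳ s
  ^ʳ-nonNeg x s with em {P = 0# < x}
  ... | yes _ = proj₁ (exp-pos _)
  ... | no  _ = ≤-refl

  ∑-halves : ∀ n → ∑ n (½ ^_) + 2# * ½ ^ n ≈ 2#
  ∑-halves zero    = solve 0 (:0 :+ :2 :* :1 := :2) refl
  ∑-halves (suc n) = begin-equality
    ∑ (suc n) (½ ^_) + 2# * (½ * ½ ^ n)       ≈⟨ +-congʳ (∑-last n (½ ^_)) ⟩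
    ∑ n (½ ^_) + ½ ^ n + 2# * (½ * ½ ^ n)     ≈⟨ solve 3 (λ s h p → s :+ p :+ :2 :* (h :* p) := s :+ p :+ h :* :2 :* p) refl (∑ n (½ ^_)) ½ (½ ^ n) ⟩
    ∑ n (½ ^_) + ½ ^ n + ½ * 2# * ½ ^ n       ≈⟨ +-congˡ (*-congʳ ½*2) ⟩
    ∑ n (½ ^_) + ½ ^ n + 1# * ½ ^ n           ≈⟨ solve 2 (λ s p → s :+ p :+ :1 :* p := s :+ :2 :* p) refl (∑ n (½ ^_)) (½ ^ n) ⟩
    ∑ n (½ ^_) + 2# * ½ ^ n                   ≈⟨ ∑-halves n ⟩
    2#                                        ∎

  ∑-½^2+i≤½ : ∀ n → ∑ n (λ i → ½ ^ (2 ℕ.+ i)) ≤ ½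
  ∑-½^2+i≤½ n = begin
    ∑ n (λ i → ½ * (½ * ½ ^ i))   ≈⟨ ∑-*ˡ n ½ (λ i → ½ * ½ ^ i) ⟩
    ½ * ∑ n (λ i → ½ * ½ ^ i)     ≈⟨ *-congˡ (∑-*ˡ n ½ (½ ^_)) ⟩
    ½ * (½ * ∑ n (½ ^_))          ≤⟨ *-monoˡ-≤ ½ 0≤½ (*-monoˡ-≤ ½ 0≤½ (≤-from (*-nonNeg (proj₁ 0<2) (^-nonNeg n 0≤½)) (begin-equality
        2# * ½ ^ n                              ≈⟨ solve 2 (λ s p → p := s :+ p :- s) refl (∑ n (½ ^_)) (2# * ½ ^ n) ⟩
        ∑ n (½ ^_) + 2# * ½ ^ n - ∑ n (½ ^_)    ≈⟨ +-congʳ (∑-halves n) ⟩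
        2# - ∑ n (½ ^_)                         ∎))) ⟩
    ½ * (½ * 2#)                  ≈⟨ trans (*-congˡ ½*2) (*-identityʳ ½) ⟩
    ½                             ∎

  -- Descend from some K > 1/d, where 3^K d ≥ 1; as d < 1 the search stops before exponent 0.
  triadic-scale : ∀ {d} → 0# < d → d < 1# → ∃[ n ] 3# ^ n * d < 1# × 1# ≤ 3# ^ suc n * d
  triadic-scale {d} 0<d d<1 =
    let K , d⁻¹<K = archimedean (d ⁻¹) in
    search K (begin
      1#             ≈⟨ ⁻¹-inverseˡ (pos⇒≉0 0<d) ⟨
      d ⁻¹ * d       ≤⟨ *-monoʳ-≤ d (proj₁ 0<d) (≤-trans (proj₁ d⁻¹<K)
                          (≤-trans (fromℕ-mono-≤ (ℕ.<⇒≤ (n<b^n (s≤s (s≤s z≤n)) K))) (≤-reflexive (3#^ K)))) ⟩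
      3# ^ K * d     ∎)
    where
    search : ∀ k → 1# ≤ 3# ^ k * d → ∃[ n ] 3# ^ n * d < 1# × 1# ≤ 3# ^ suc n * d
    search zero    1≤ = contradiction (≤-trans 1≤ (≤-reflexive (*-identityˡ d))) (<⇒≱ d<1)
    search (suc k) 1≤ = case em {P = 1# ≤ 3# ^ k * d} of λ
      { (yes 1≤′) → search k 1≤′ ; (no 1≰) → k , ≰⇒> 1≰ , 1≤ }

  ½^-anti : ∀ {k n} → k ℕ.≤ n → ½ ^ n ≤ ½ ^ k
  ½^-anti {n = n} z≤n = ^-≤1 n 0≤½ ½≤1
  ½^-anti (s≤s k≤n)   = *-monoˡ-≤ ½ 0≤½ (½^-anti k≤n)

  ≤½⇒<1 : ∀ {x} → x ≤ ½ → x < 1#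
  ≤½⇒<1 {x} x≤½ = begin-strict
    x       ≤⟨ x≤½ ⟩
    ½       ≈⟨ *-identityʳ ½ ⟨
    ½ * 1#  <⟨ ½*< 0<1 ⟩
    1#      ∎

  x≤x+y : ∀ x {y} → 0# ≤ y → x ≤ x + y
  x≤x+y x {y} 0≤y = ≤-from 0≤y (solve 2 (λ x y → y := x :+ y :- x) refl x y)

  y≤x+y : ∀ y {x} → 0# ≤ x → y ≤ x + y
  y≤x+y y {x} 0≤x = ≤-from 0≤x (solve 2 (λ y x → x := x :+ y :- y) refl y x)

  -- The dyadic mass of a triadic interval of level n is ½ ^ #free n, and the
  -- hypothesis `subcritical` compares it with the s-th power of the length.
  module MassDistribution {s : ℝ} (0<s : 0# < s) (m : ℕ) (8≤m : 8 ℕ.≤ m)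
    (subcritical : fromℕ (2 ℕ.* m ℕ.+ 20) * (s * ln3) ≤ fromℕ m * ln2) where

    open Blocks m 8≤m

    c : ℕ
    c = 2 ℕ.* m ℕ.+ 20

    0<c : 0 ℕ.< c
    0<c = ℕ.<-≤-trans (s≤s z≤n) (ℕ.m≤n+m 20 (2 ℕ.* m))

    s-ln3≤#free-ln2 : ∀ n → fromℕ n * (s * ln3) ≤ fromℕ (#free n) * ln2
    s-ln3≤#free-ln2 n = *-cancelʳ-≤ (fromℕ c) (fromℕ-pos 0<c) (begin
      fromℕ n * (s * ln3) * fromℕ c        ≈⟨ solve 3 (λ n x c → n :* x :* c := n :* (c :* x)) refl (fromℕ n) (s * ln3) (fromℕ c) ⟩
      fromℕ n * (fromℕ c * (s * ln3))      ≤⟨ *-monoˡ-≤ (fromℕ n) (fromℕ-nonNeg n) subcritical ⟩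
      fromℕ n * (fromℕ m * ln2)            ≈⟨ solve 3 (λ n m l → n :* (m :* l) := m :* n :* l) refl (fromℕ n) (fromℕ m) ln2 ⟩
      fromℕ m * fromℕ n * ln2              ≤⟨ *-monoʳ-≤ ln2 (proj₁ 0<ln2) (begin
        fromℕ m * fromℕ n                    ≈⟨ fromℕ-* m n ⟨
        fromℕ (m ℕ.* n)                      ≤⟨ fromℕ-mono-≤ (#free-density n) ⟩
        fromℕ (c ℕ.* #free n)                ≈⟨ fromℕ-* c (#free n) ⟩
        fromℕ c * fromℕ (#free n)            ∎) ⟩
      fromℕ c * fromℕ (#free n) * ln2      ≈⟨ solve 3 (λ c f l → c :* f :* l := f :* l :* c) refl (fromℕ c) (fromℕ (#free n)) ln2 ⟩
      fromℕ (#free n) * ln2 * fromℕ c      ∎)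

    C : ℝ
    C = exp (s * ln3)

    -- The density of free positions bounds the mass by 3^-(ns), while d is only known to be at
    -- least 3^-(n+1); the factor `C` = 3^s pays for this one level.
    mass≤ : ∀ n {d} → 0# < d → 1# ≤ 3# ^ suc n * d → ½ ^ #free n ≤ C * d ^ʳ s
    mass≤ n {d} 0<d 1≤ = begin
      ½ ^ #free n                             ≈⟨ exp-*ln2 (#free n) ⟨
      exp (- (fromℕ (#free n) * ln2))         ≤⟨ exp-mono-≤ (neg-mono-≤ (s-ln3≤#free-ln2 n)) ⟩
      exp (- (fromℕ n * (s * ln3)))           ≤⟨ exp-mono-≤ (≤-from (*-nonNeg (proj₁ 0<s) 0≤log)
                                                   (solve 4 (λ s n l y → s :* ((:1 :+ n) :* l :+ y) := s :* l :+ s :* y :- :- (n :* (s :* l)))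
                                                     refl s (fromℕ n) ln3 (log d))) ⟩
      exp (s * ln3 + s * log d)               ≈⟨ exp-+ _ _ ⟩
      C * exp (s * log d)                     ≡⟨ ≡.cong (C *_) (^ʳ-pos s 0<d) ⟨
      C * d ^ʳ s                              ∎
      where
      0≤log : 0# ≤ fromℕ (suc n) * ln3 + log d
      0≤log = exp-cancel-≤ (begin
        exp 0#                                  ≈⟨ exp-0 ⟩
        1#                                      ≤⟨ 1≤ ⟩
        3# ^ suc n * d                          ≈⟨ *-cong (exp-*ln3 (suc n)) (exp-log 0<d) ⟨
        exp (fromℕ (suc n) * ln3) * exp (log d) ≈⟨ exp-+ _ _ ⟨
        exp (fromℕ (suc n) * ln3 + log d)       ∎)

    #free-unbounded : ∀ k → k ℕ.≤ #free (c ℕ.* k)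
    #free-unbounded k = ℕ.*-cancelˡ-≤ c {{ℕ.>-nonZero 0<c}} (ℕ.≤-trans (ℕ.m≤n*m (c ℕ.* k) m) (#free-density (c ℕ.* k)))

    0≤C : 0# ≤ C
    0≤C = proj₁ (exp-pos (s * ln3))

    level-pos : ∀ {d} k → 0# < d → ∃[ n ] 3# ^ n * d < 1# × 1# ≤ 3# ^ suc n * d →
      ∃[ n ] 3# ^ n * d < 1# × ½ ^ #free n ≤ C * d ^ʳ s + ½ ^ k
    level-pos {d} k 0<d (n , small , large) = n , small ,
      ≤-trans (mass≤ n 0<d large) (x≤x+y (C * d ^ʳ s) (^-nonNeg k 0≤½))

    level-zero : ∀ {d} k → d ≈ 0# → ∃[ n ] 3# ^ n * d < 1# × ½ ^ #free n ≤ C * d ^ʳ s + ½ ^ k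
    level-zero {d} k d≈0 = c ℕ.* k , <-respˡ (sym (trans (*-congˡ d≈0) (zeroʳ _))) 0<1 ,
      ≤-trans (½^-anti (#free-unbounded k)) (y≤x+y (½ ^ k) (*-nonNeg 0≤C (^ʳ-nonNeg d s)))

    -- The summand ½^k is for d = 0: then d^s is 0 while every level is fine enough, and a level is
    -- chosen so deep that the mass drops below ½^k.
    level : ∀ {d} → 0# ≤ d → d ≤ ½ → ∀ k →
      ∃[ n ] 3# ^ n * d < 1# × ½ ^ #free n ≤ C * d ^ʳ s + ½ ^ k
    level {d} 0≤d d≤½ k = case em {P = 0# < d} of λ
      { (yes 0<d) → level-pos k 0<d (triadic-scale 0<d (≤½⇒<1 d≤½))
      ; (no 0≮d)  → level-zero k (antisym (≮⇒≥ 0≮d) 0≤d) }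

    0<C : 0# < C
    0<C = exp-pos (s * ln3)

    -- Chosen so that `C * ε` is 1/4. The extra summands for the individual sets add at most 1/2,
    -- and the total remains below 1.
    ε : ℝ
    ε = ½ * ½ * C ⁻¹

    C*ε≈ : C * ε ≈ ½ * ½
    C*ε≈ = trans (*-comm C ε) (*/-cancel {½ * ½} C (pos⇒≉0 0<C))

    C*ε+½<1 : C * ε + ½ < 1#
    C*ε+½<1 = begin-strict
      C * ε + ½    ≈⟨ +-congʳ C*ε≈ ⟩
      ½ * ½ + ½    <⟨ <-from (x<y⇒0<y-x (½*< 0<½)) (solve 2 (λ h k → h :- k := h :+ h :- (k :+ h)) refl ½ (½ * ½)) ⟩
      ½ + ½        ≈⟨ solve 1 (λ h → h :+ h := h :* :2) refl ½ ⟩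
      ½ * 2#       ≈⟨ ½*2 ⟩
      1#           ∎

    -- The cover is pulled back along the coding of points by binary sequences; a sequence missed by
    -- all preimages codes an uncovered point of `E₀`.
    no-small-cover : ∀ {d} → CoverBy E₀ d → (∀ n → ∑ n (λ i → d i ^ʳ s) ≤ ε) → (n : ℕ → ℕ) →
      (∀ i → 3# ^ n i * d i < 1#) → (∀ i → ½ ^ #free (n i) ≤ C * d i ^ʳ s + ½ ^ (2 ℕ.+ i)) → ⊥
    no-small-cover {d} cover ∑d^s≤ε n small mass =
      let t , t-avoids = uncovered C*ε+½<1 V (λ i → #free (n i)) V-agree light
          i , t∈Uᵢ = covers (val-digits∈ m 8≤m t)
      in t-avoids i t∈Uᵢ
      where
      open CoverBy cover
      V : ℕ → (ℕ → Bool) → Set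
      V i t = U i (val (digits t))
      V-agree : ∀ i {t u} → V i t → V i u → ∀ k → k ℕ.< #free (n i) → t k ≡ u k
      V-agree i {t} {u} Vt Vu = agree⇒agree-free (n i) (close⇒agree (n i) (digits t) (digits u) (begin-strict
        3# ^ n i * ∣ val (digits t) - val (digits u) ∣  ≤⟨ *-monoˡ-≤ (3# ^ n i) (0≤3^ (n i)) (within i Vt Vu) ⟩
        3# ^ n i * d i                                  <⟨ small i ⟩
        1#                                              ∎))
      light : ∀ N → ∑ N (λ i → ½ ^ #free (n i)) ≤ C * ε + ½
      light N = begin
        ∑ N (λ i → ½ ^ #free (n i))                        ≤⟨ ∑-mono N mass ⟩
        ∑ N (λ i → C * d i ^ʳ s + ½ ^ (2 ℕ.+ i))           ≈⟨ ∑-+ N (λ i → C * d i ^ʳ s) (λ i → ½ ^ (2 ℕ.+ i)) ⟩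
        ∑ N (λ i → C * d i ^ʳ s) + ∑ N (λ i → ½ ^ (2 ℕ.+ i)) ≈⟨ +-congʳ (∑-*ˡ N C (λ i → d i ^ʳ s)) ⟩
        C * ∑ N (λ i → d i ^ʳ s) + ∑ N (λ i → ½ ^ (2 ℕ.+ i)) ≤⟨ +-mono-≤ (*-monoˡ-≤ C 0≤C (∑d^s≤ε N)) (∑-½^2+i≤½ N) ⟩
        C * ε + ½                                          ∎

    no-fine-cover : ¬ (∃[ d ] CoverBy E₀ d × (∀ i → 0# ≤ d i × d i ≤ ½) × (∀ n → ∑ n (λ i → d i ^ʳ s) ≤ ε))
    no-fine-cover (d , cover , d-bounds , ∑d^s≤ε) =
      pick λ i → level (proj₁ (d-bounds i)) (proj₂ (d-bounds i)) (2 ℕ.+ i)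
      where
      pick : ¬ (∀ i → ∃[ n ] 3# ^ n * d i < 1# × ½ ^ #free n ≤ C * d i ^ʳ s + ½ ^ (2 ℕ.+ i))
      pick n-spec = no-small-cover cover ∑d^s≤ε (λ i → proj₁ (n-spec i))
        (λ i → proj₁ (proj₂ (n-spec i))) (λ i → proj₂ (proj₂ (n-spec i)))

    not-null : ¬ hausdorffMeasure s E₀ ≈⁺ [ 0# ]
    -- Mesh ½ keeps all diameters below 1, where a triadic scale exists.
    not-null null = no-fine-cover (null⇒small-cover null 0<½ (*-pos (*-pos 0<½ 0<½) (⁻¹-pos 0<C)))

  -- Rearranged, the conclusion reads 20y ≤ m(ln 2 - 2y), which holds for large m as soon as the gap
  -- is positive.
  subcritical-from : ∀ {y gap} m → 0# < gap → gap ≈ ln2 - 2# * y → fromℕ 20 * y / gap ≤ fromℕ m →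
    fromℕ (2 ℕ.* m ℕ.+ 20) * y ≤ fromℕ m * ln2
  subcritical-from {y} {gap} m 0<gap gap≈ large = begin
    fromℕ (2 ℕ.* m ℕ.+ 20) * y             ≈⟨ *-congʳ (trans (fromℕ-+ (2 ℕ.* m) 20) (+-congʳ (trans (fromℕ-* 2 m) (*-congʳ fromℕ-2)))) ⟩
    (2# * fromℕ m + w) * y                 ≤⟨ ≤-from (x≤y⇒0≤y-x 20y≤)
        (trans (+-congʳ (*-congˡ gap≈))
          (solve 4 (λ m w y l → m :* (l :- :2 :* y) :- w :* y := m :* l :- (:2 :* m :+ w) :* y) refl (fromℕ m) w y ln2)) ⟩
    fromℕ m * ln2                          ∎
    where
    w : ℝ
    w = fromℕ 20
    20y≤ : w * y ≤ fromℕ m * gap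
    20y≤ = ≤-trans (≤-reflexive (sym (*/-cancel gap (pos⇒≉0 0<gap)))) (*-monoʳ-≤ gap (proj₁ 0<gap) large)

  subcritical-exists : ∀ {s} → 0# < s → s < γ / fromℕ 2 →
    ∃[ m ] 8 ℕ.≤ m × fromℕ (2 ℕ.* m ℕ.+ 20) * (s * ln3) ≤ fromℕ m * ln2
  subcritical-exists {s} 0<s s<γ/2 = 8 ℕ.+ k , ℕ.m≤m+n 8 k ,
    subcritical-from (8 ℕ.+ k) 0<gap refl (≤-trans (proj₁ (proj₂ k-large)) (fromℕ-mono-≤ (ℕ.m≤n+m k 8)))
    where
    y gap : ℝ
    y = s * ln3
    gap = ln2 - 2# * y
    k-large = archimedean (fromℕ 20 * y / gap)
    k = proj₁ k-large
    -- This is s < γ/2 multiplied by 2 ln 3.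
    0<gap : 0# < gap
    0<gap = <-respʳ (begin-equality
      (γ / fromℕ 2 - s) * (fromℕ 2 * ln3)
        ≈⟨ solve 4 (λ g s w l → (g :- s) :* (w :* l) := g :* w :* l :- w :* (s :* l)) refl (γ / fromℕ 2) s (fromℕ 2) ln3 ⟩
      γ / fromℕ 2 * fromℕ 2 * ln3 - fromℕ 2 * y
        ≈⟨ +-cong (trans (*-congʳ (*/-cancel (fromℕ 2) (pos⇒≉0 0<fromℕ2))) (*/-cancel ln3 (pos⇒≉0 0<ln3)))
                  (-‿cong (*-congʳ fromℕ-2)) ⟩
      gap ∎) (*-pos (x<y⇒0<y-x s<γ/2) (*-pos 0<fromℕ2 0<ln3))

  γ/2≤dim : [ γ / fromℕ 2 ] ≤⁺ dim E₀
  γ/2≤dim = ≤-dim (proj₁ (*-pos (*-pos 0<ln2 (⁻¹-pos 0<ln3)) (⁻¹-pos 0<fromℕ2))) λ s 0<s null →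
    ≮⇒≥ λ s<γ/2 → let m , 8≤m , subcritical = subcritical-exists 0<s s<γ/2 in
      MassDistribution.not-null 0<s m 8≤m subcritical null

mainTheorem2 : (em : ∀ {ℓ} → ExcludedMiddle ℓ) (R : RealNumbers) →
    let open Analysis em R in
    [ γ / fromℕ 2 ] ≤⁺ dim ((𝓦 ∖ 𝓛) ∩ K) × Satisfiable ((𝓦 ∖ 𝓛) ∩ K)
-- An explicit point witnesses nonemptiness: the least admissible m, with all free digits 0.
mainTheorem2 em R = γ/2≤dim , (_ , val-digits∈ 8 ℕ.≤-refl (λ _ → false))
  where open Proof em R
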